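{- For every $0<\varepsilon<1$ and every $C>0$ there exists $n_0$ such that the following holds for all $n\ge n_0$. Let $G$ be a multipartite graph with parts $V_1,\ldots,V_k$, each of size $|V_i|\ge n$, such that the maximum degree of $G$ is at most $(1-\varepsilon)n$ and the local degree of $G$ is at most $C$. Then $G$ contains at least $(1-\varepsilon)n$ pairwise disjoint independent transversals.
   Context: A multipartite graph with parts $V_1,\ldots,V_k$ is a graph whose vertex set is the disjoint union $V_1\cup\cdots\cup V_k$ and which has no edge inside any part. An independent transversal is an independent set containing exactly one vertex from each part $V_i$. The local degree of $G$ is the maximum, over all vertices $v$ and all parts $V_i$, of the number of neighbours of $v$ in $V_i$. Quantities such as $(1-\varepsilon)n$ are understood up to rounding. -}

module Defs where

open import Data.Nat using (ℕ; zero; suc; _+_)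
open import Data.Bool using (Bool; true; false; if_then_else_)
open import Data.Fin using (Fin; zero; suc)
open import Data.Product using (Σ; _,_; _×_; ∃-syntax)
open import Data.Integer using (+_)
open import Data.Rational using (ℚ; _/_; _≤_; _<_; _-_; _*_; 0ℚ; 1ℚ)
open import Relation.Binary.PropositionalEquality using (_≡_; _≢_)

count : ∀ {n} → (Fin n → Bool) → ℕ
count {zero}  p = 0
count {suc n} p = (if p zero then 1 else 0) + count (λ x → p (suc x))

Σfin : ∀ {k} → (Fin k → ℕ) → ℕ
Σfin {zero}  f = 0
Σfin {suc k} f = f zero + Σfin (λ i → f (suc i))

ℕ→ℚ : ℕ → ℚ
ℕ→ℚ n = + n / 1

Vtx : (k : ℕ) → (Fin k → ℕ) → Set
Vtx k s = Σ (Fin k) (λ i → Fin (s i))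

record MultipartiteGraph (k : ℕ) (s : Fin k → ℕ) : Set where
  field
    adj       : Vtx k s → Vtx k s → Bool
    symmetric : ∀ u v → adj u v ≡ adj v u
    noEdgeInPart : ∀ i (x y : Fin (s i)) → adj (i , x) (i , y) ≡ false
open MultipartiteGraph public

module _ {k : ℕ} {s : Fin k → ℕ} (G : MultipartiteGraph k s) where

  localDeg : Vtx k s → Fin k → ℕ
  localDeg v j = count (λ (x : Fin (s j)) → adj G v (j , x))

  degree : Vtx k s → ℕ
  degree v = Σfin (localDeg v)

  Transversal : Set
  Transversal = (i : Fin k) → Fin (s i)

  IndependentTransversal : Transversal → Set
  IndependentTransversal t = ∀ i j → adj G (i , t i) (j , t j) ≡ false

  DisjointIndepTransversals : (m : ℕ) → (Fin m → Transversal) → Set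
  DisjointIndepTransversals m T =
    (∀ a → IndependentTransversal (T a)) ×
    (∀ a b → a ≢ b → ∀ i → T a i ≢ T b i)

{-# OPTIONS --safe #-}
module Submission where

-- A packing of m transversals is a choice of one vertex for every group (part, color), subject to two kinds of
-- conflicts: equal color and adjacent vertices, or equal part and equal vertex.  Both kinds have degree at most
-- (1 − ε) n, and each is locally sparse in the direction of the other label.  The choice is made by a nibble with
-- a number of rounds independent of n.  In a round every group picks each vertex of its list with probability 1/M;
-- a pick is kept unless an earlier variable hits it, and coins equalize the rate at which the pairs (group, vertex)
-- die.  With lists of size ℓ and conflict degrees at most D, lists shrink by a factor 1 − 2D/M, whereas the degrees
-- of either kind shrink by about 1 − (ℓ + D)/M, because groups get settled and because the conflicts of the other
-- kind kill neighbours independently; starting from D < ℓ the ratio D/ℓ improves.  Concentration holds with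
-- exponentially small error in n, which the local lemma turns into a bound for all groups at once, uniformly in
-- the number of parts.  When D ≤ ℓ/32 a last application of the local lemma settles all remaining groups.

open import Defs

-- Colors and parts are two labellings that play interchangeable roles, so every estimate is proved
-- once, for conflicts of a kind `t`. The obstacle is that pairs may have large common
-- neighbourhoods of the same kind: one pick can destroy many kind-`t` neighbours of a pair at once,
-- so threats of kind `t` give no concentrated loss of the kind-`t` degrees. They are discarded for
-- the degrees, which leaves the rate ℓ + D in place of ℓ + 2 D. That this still exceeds the rate 2
-- D of the lists means precisely D < ℓ, and the ε provides it. The coins never raise the rate at
-- which lists shrink above 2 D, but they guarantee the degrees a loss of D even around pairs whose
-- actual degrees are smaller. Deciding between clashing picks by the order of the variables makes
-- rejections adapted, so that exponential moments still multiply although rejections are not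
-- independent. Probabilities are counts in a finite product space, and powers of 1 + 1/K replace
-- exponentials, so that all estimates are inequalities between natural numbers.

module Nibble where

  open import Data.Bool using (Bool; true; false; if_then_else_; not; _∧_; _∨_; T)
  open import Data.Empty using (⊥; ⊥-elim)
  open import Data.Fin using (Fin; zero; suc; toℕ; fromℕ<; inject≤; combine; remQuot; splitAt; _↑ˡ_; _↑ʳ_)
  import Data.Fin.Properties as Fin
  open import Data.List using (List; []; _∷_; length; allFin)
  open import Data.List.Membership.Propositional using (_∈_)
  open import Data.List.Membership.Propositional.Properties using (∈-allFin)
  open import Data.List.Relation.Unary.Any using (here; there)
  open import Data.Nat using (ℕ; zero; suc; _+_; _*_; _∸_; _^_; _≤_; _<_; z≤n; s≤s; s≤s⁻¹; NonZero; >-nonZero; _≤ᵇ_; _<ᵇ_)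
  open import Data.Nat.Properties
  open import Algebra.Properties.CommutativeSemigroup *-commutativeSemigroup using (x∙yz≈y∙xz; x∙yz≈z∙xy; x∙yz≈xz∙y; x∙yz≈zx∙y; x∙yz≈yx∙z; xy∙z≈zx∙y; xy∙z≈xz∙y; xy∙z≈y∙xz)
  open import Algebra.Properties.CommutativeSemigroup +-commutativeSemigroup using () renaming (interchange to +-interchange)
  open import Data.Nat.Tactic.RingSolver using (solve-∀)
  open import Data.Product using (∃; _×_; _,_; proj₁; proj₂)
  open import Data.Sum using (_⊎_; inj₁; inj₂; [_,_]′)
  open import Data.Vec using (Vec; []; _∷_; lookup; replicate; _[_]≔_)
  open import Data.Vec.Properties using (lookup∘update; lookup∘update′)
  open import Function using (_∘_; case_of_; const)
  open import Relation.Binary.Definitions using (tri<; tri≈; tri>)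
  open import Relation.Binary.PropositionalEquality
  open import Relation.Nullary using (yes; no)

  -- Indicators, finite sums and products.

  ind : Bool → ℕ
  ind b = if b then 1 else 0

  ind≤1 : ∀ b → ind b ≤ 1
  ind≤1 false = z≤n
  ind≤1 true  = ≤-refl

  ind-∧ : ∀ a b → ind (a ∧ b) ≡ ind a * ind b
  ind-∧ false b = refl
  ind-∧ true  b = sym (+-identityʳ (ind b))

  ind-∨ : ∀ a b → ind (a ∨ b) ≤ ind a + ind b
  ind-∨ false b = ≤-refl
  ind-∨ true  b = s≤s z≤n

  ind-mono : ∀ {a b} → (a ≡ true → b ≡ true) → ind a ≤ ind b
  ind-mono {false} h = z≤n
  ind-mono {true} {b} h rewrite h refl = ≤-refl

  ∧-trueˡ : ∀ {a b} → a ∧ b ≡ true → a ≡ true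
  ∧-trueˡ {true} _ = refl

  ∧-trueʳ : ∀ {a b} → a ∧ b ≡ true → b ≡ true
  ∧-trueʳ {true} e = e

  ∧-true : ∀ {a b} → a ≡ true → b ≡ true → a ∧ b ≡ true
  ∧-true refl e = e

  ∨-trueˡ : ∀ {a} b → a ≡ true → a ∨ b ≡ true
  ∨-trueˡ b refl = refl

  ∨-trueʳ : ∀ a {b} → b ≡ true → a ∨ b ≡ true
  ∨-trueʳ false e = e
  ∨-trueʳ true  e = refl

  false-true : ∀ {b} {P : Set} → b ≡ false → b ≡ true → P
  false-true refl ()

  not-true : ∀ {b} → not b ≡ true → b ≡ false
  not-true {false} _ = refl

  <⇒<ᵇ≡true : ∀ {a b} → a < b → (a <ᵇ b) ≡ true
  <⇒<ᵇ≡true {a} {b} p with a <ᵇ b | <⇒<ᵇ p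
  ... | true | _ = refl

  _==_ : ∀ {n} → Fin n → Fin n → Bool
  zero  == zero  = true
  zero  == suc _ = false
  suc _ == zero  = false
  suc i == suc j = i == j

  ==-refl : ∀ {n} (i : Fin n) → (i == i) ≡ true
  ==-refl zero    = refl
  ==-refl (suc i) = ==-refl i

  ==⇒≡ : ∀ {n} (i j : Fin n) → (i == j) ≡ true → i ≡ j
  ==⇒≡ zero    zero    _ = refl
  ==⇒≡ (suc i) (suc j) e = cong suc (==⇒≡ i j e)

  ==-sym : ∀ {n} (i j : Fin n) → (i == j) ≡ (j == i)
  ==-sym zero    zero    = refl
  ==-sym zero    (suc _) = refl
  ==-sym (suc _) zero    = refl
  ==-sym (suc i) (suc j) = ==-sym i j

  opaque

    ∑ : ∀ {n} → (Fin n → ℕ) → ℕ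
    ∑ = Σfin

    ∑-suc : ∀ {n} (f : Fin (suc n) → ℕ) → ∑ f ≡ f zero + ∑ (λ i → f (suc i))
    ∑-suc f = refl

    ∑≡Σfin : ∀ {n} (f : Fin n → ℕ) → ∑ f ≡ Σfin f
    ∑≡Σfin f = refl

    ∑-cong : ∀ {n} {f g : Fin n → ℕ} → (∀ i → f i ≡ g i) → ∑ f ≡ ∑ g
    ∑-cong {zero}  h = refl
    ∑-cong {suc n} h = cong₂ _+_ (h zero) (∑-cong (h ∘ suc))

    ∑-mono : ∀ {n} {f g : Fin n → ℕ} → (∀ i → f i ≤ g i) → ∑ f ≤ ∑ g
    ∑-mono {zero}  h = z≤n
    ∑-mono {suc n} h = +-mono-≤ (h zero) (∑-mono (h ∘ suc))

    ∑-const : ∀ n c → ∑ {n} (λ _ → c) ≡ n * c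
    ∑-const zero    c = refl
    ∑-const (suc n) c = cong (c +_) (∑-const n c)

    ∑-zero : ∀ {n} {f : Fin n → ℕ} → (∀ i → f i ≡ 0) → ∑ f ≡ 0
    ∑-zero {zero}  h = refl
    ∑-zero {suc n} h rewrite h zero = ∑-zero (h ∘ suc)

    ∑-+ : ∀ {n} (f g : Fin n → ℕ) → ∑ (λ i → f i + g i) ≡ ∑ f + ∑ g
    ∑-+ {zero}  f g = refl
    ∑-+ {suc n} f g = trans (cong (f zero + g zero +_) (∑-+ (f ∘ suc) (g ∘ suc)))
                            (+-interchange (f zero) (g zero) _ _)

    ∑-*ˡ : ∀ {n} c (f : Fin n → ℕ) → ∑ (λ i → c * f i) ≡ c * ∑ f
    ∑-*ˡ {zero}  c f = sym (*-zeroʳ c)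
    ∑-*ˡ {suc n} c f = trans (cong (c * f zero +_) (∑-*ˡ c (f ∘ suc)))
                             (sym (*-distribˡ-+ c (f zero) _))

    ∑-*ʳ : ∀ {n} c (f : Fin n → ℕ) → ∑ (λ i → f i * c) ≡ ∑ f * c
    ∑-*ʳ c f = trans (∑-cong (λ i → *-comm (f i) c)) (trans (∑-*ˡ c f) (*-comm c _))

    ∑-swap : ∀ {m n} (f : Fin m → Fin n → ℕ) →
      ∑ (λ i → ∑ (λ j → f i j)) ≡ ∑ (λ j → ∑ (λ i → f i j))
    ∑-swap {zero} {n} f = sym (∑-zero {n} (λ _ → refl))
    ∑-swap {suc m} f = trans (cong (∑ (f zero) +_) (∑-swap (f ∘ suc)))
                             (sym (∑-+ (f zero) (λ j → ∑ (λ i → f (suc i) j))))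

    ∑-term : ∀ {n} (f : Fin n → ℕ) i → f i ≤ ∑ f
    ∑-term f zero    = m≤m+n _ _
    ∑-term f (suc i) = ≤-trans (∑-term (f ∘ suc) i) (m≤n+m _ (f zero))

    ∑-pos : ∀ {n} (f : Fin n → ℕ) → 0 < ∑ f → ∃ λ i → 0 < f i
    ∑-pos {suc n} f 0<Σ with f zero in eq
    ... | suc _ = zero , subst (0 <_) (sym eq) (s≤s z≤n)
    ... | zero with ∑-pos (f ∘ suc) 0<Σ
    ...   | i , 0<fi = suc i , 0<fi

    ∑-split : ∀ m {n} (f : Fin (m + n) → ℕ) →
      ∑ f ≡ ∑ (λ i → f (i ↑ˡ n)) + ∑ (λ j → f (m ↑ʳ j))
    ∑-split zero    f = refl
    ∑-split (suc m) f = trans (cong (f zero +_) (∑-split m (f ∘ suc))) (sym (+-assoc (f zero) _ _))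

    ∑-combine : ∀ m {n} (f : Fin (m * n) → ℕ) →
      ∑ f ≡ ∑ (λ (i : Fin m) → ∑ (λ (j : Fin n) → f (combine i j)))
    ∑-combine zero    f = refl
    ∑-combine (suc m) {n} f = trans (∑-split n f) (cong (∑ (λ j → f (j ↑ˡ (m * n))) +_) (∑-combine m (f ∘ (n ↑ʳ_))))

    ∑-delta : ∀ {n} (i : Fin n) (f : Fin n → ℕ) → ∑ (λ j → ind (i == j) * f j) ≡ f i
    ∑-delta {suc n} zero f = trans (cong₂ _+_ (+-identityʳ (f zero)) (∑-zero {n} {λ _ → 0} (λ _ → refl)))
                                   (+-identityʳ (f zero))
    ∑-delta (suc i) f = ∑-delta i (f ∘ suc)

    ∑-below : ∀ M c → c ≤ M → ∑ {M} (λ i → ind (toℕ i <ᵇ c)) ≡ c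
    ∑-below zero    zero    _         = refl
    ∑-below (suc M) zero    _         = ∑-zero {M} (λ _ → refl)
    ∑-below (suc M) (suc c) (s≤s c≤M) = cong suc (∑-below M c c≤M)

    count≡∑ : ∀ {n} (p : Fin n → Bool) → count p ≡ ∑ (λ i → ind (p i))
    count≡∑ {zero}  p = refl
    count≡∑ {suc n} p = cong (ind (p zero) +_) (count≡∑ (p ∘ suc))

  opaque
    unfolding ∑

    ∏ : ∀ {n} → (Fin n → ℕ) → ℕ
    ∏ {zero}  f = 1
    ∏ {suc n} f = f zero * ∏ (f ∘ suc)

    ∏-zero : (f : Fin 0 → ℕ) → ∏ f ≡ 1
    ∏-zero f = refl

    ∏-suc : ∀ {n} (f : Fin (suc n) → ℕ) → ∏ f ≡ f zero * ∏ (λ i → f (suc i))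
    ∏-suc f = refl

    ∏-cong : ∀ {n} {f g : Fin n → ℕ} → (∀ i → f i ≡ g i) → ∏ f ≡ ∏ g
    ∏-cong {zero}  h = refl
    ∏-cong {suc n} h = cong₂ _*_ (h zero) (∏-cong (h ∘ suc))

    ∏-mono : ∀ {n} {f g : Fin n → ℕ} → (∀ i → f i ≤ g i) → ∏ f ≤ ∏ g
    ∏-mono {zero}  h = ≤-refl
    ∏-mono {suc n} h = *-mono-≤ (h zero) (∏-mono (h ∘ suc))

    ∏-const : ∀ n c → ∏ {n} (λ _ → c) ≡ c ^ n
    ∏-const zero    c = refl
    ∏-const (suc n) c = cong (c *_) (∏-const n c)

    ∏-* : ∀ {n} (f g : Fin n → ℕ) → ∏ (λ i → f i * g i) ≡ ∏ f * ∏ g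
    ∏-* {zero}  f g = refl
    ∏-* {suc n} f g = trans (cong (f zero * g zero *_) (∏-* (f ∘ suc) (g ∘ suc)))
      ([m*n]*[o*p]≡[m*o]*[n*p] (f zero) (g zero) _ _)

    ∏-^ : ∀ {n} c (e : Fin n → ℕ) → ∏ (λ i → c ^ e i) ≡ c ^ ∑ e
    ∏-^ {zero}  c e = refl
    ∏-^ {suc n} c e = trans (cong (c ^ e zero *_) (∏-^ c (e ∘ suc))) (sym (^-distribˡ-+-* c (e zero) _))

  ^-distribʳ-* : ∀ a b n → (a * b) ^ n ≡ a ^ n * b ^ n
  ^-distribʳ-* a b zero    = refl
  ^-distribʳ-* a b (suc n) = trans (cong (a * b *_) (^-distribʳ-* a b n)) ([m*n]*[o*p]≡[m*o]*[n*p] a b (a ^ n) (b ^ n))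

  -- Counting in finite product spaces; independence.

  ΣΩ : ∀ {M} N → (Vec (Fin M) N → ℕ) → ℕ
  ΣΩ zero    f = f []
  ΣΩ (suc N) f = ∑ (λ x → ΣΩ N (λ ω → f (x ∷ ω)))

  module _ {M : ℕ} where

    Ω-cong : ∀ N {f g : Vec (Fin M) N → ℕ} → (∀ ω → f ω ≡ g ω) → ΣΩ N f ≡ ΣΩ N g
    Ω-cong zero    h = h []
    Ω-cong (suc N) h = ∑-cong (λ x → Ω-cong N (λ ω → h (x ∷ ω)))

    Ω-mono : ∀ N {f g : Vec (Fin M) N → ℕ} → (∀ ω → f ω ≤ g ω) → ΣΩ N f ≤ ΣΩ N g
    Ω-mono zero    h = h []
    Ω-mono (suc N) h = ∑-mono (λ x → Ω-mono N (λ ω → h (x ∷ ω)))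

    Ω-+ : ∀ N (f g : Vec (Fin M) N → ℕ) → ΣΩ N (λ ω → f ω + g ω) ≡ ΣΩ N f + ΣΩ N g
    Ω-+ zero    f g = refl
    Ω-+ (suc N) f g = trans (∑-cong (λ x → Ω-+ N (f ∘ (x ∷_)) (g ∘ (x ∷_)))) (∑-+ _ _)

    Ω-*ˡ : ∀ N c (f : Vec (Fin M) N → ℕ) → ΣΩ N (λ ω → c * f ω) ≡ c * ΣΩ N f
    Ω-*ˡ zero    c f = refl
    Ω-*ˡ (suc N) c f = trans (∑-cong (λ x → Ω-*ˡ N c (f ∘ (x ∷_)))) (∑-*ˡ c _)

    Ω-*ʳ : ∀ N c (f : Vec (Fin M) N → ℕ) → ΣΩ N (λ ω → f ω * c) ≡ ΣΩ N f * c
    Ω-*ʳ N c f = trans (Ω-cong N (λ ω → *-comm (f ω) c)) (trans (Ω-*ˡ N c f) (*-comm c _))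

    Ω-const : ∀ N c → ΣΩ N (λ (_ : Vec (Fin M) N) → c) ≡ M ^ N * c
    Ω-const zero    c = sym (+-identityʳ c)
    Ω-const (suc N) c = trans (∑-cong (λ _ → Ω-const N c)) (trans (∑-const M _) (sym (*-assoc M (M ^ N) c)))

    Ω-Σ : ∀ N {n} (f : Fin n → Vec (Fin M) N → ℕ) →
      ΣΩ N (λ ω → ∑ (λ i → f i ω)) ≡ ∑ (λ i → ΣΩ N (f i))
    Ω-Σ zero    f = refl
    Ω-Σ (suc N) f = trans (∑-cong (λ x → Ω-Σ N (λ i → f i ∘ (x ∷_)))) (∑-swap _)

    Ω-pos : ∀ N (f : Vec (Fin M) N → ℕ) → 0 < ΣΩ N f → ∃ λ ω → 0 < f ω
    Ω-pos zero    f p = [] , p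
    Ω-pos (suc N) f p with ∑-pos _ p
    ... | x , q with Ω-pos N (f ∘ (x ∷_)) q
    ...   | ω , r = x ∷ ω , r

    Ω-Π : ∀ N (s : Fin N → Fin M → ℕ) →
      ΣΩ N (λ ω → ∏ (λ v → s v (lookup ω v))) ≡ ∏ (λ v → ∑ (s v))
    Ω-Π zero    s = trans (∏-zero _) (sym (∏-zero _))
    Ω-Π (suc N) s = trans (∑-cong (λ x → Ω-cong N (λ ω → ∏-suc (λ v → s v (lookup (x ∷ ω) v))))) (trans (trans (∑-cong (λ x → trans (Ω-*ˡ N (s zero x) _) (cong (s zero x *_) (Ω-Π N (s ∘ suc)))))
                          (∑-*ʳ _ (s zero))) (sym (∏-suc (λ v → ∑ (s v)))))

    DependsOn : ∀ {N} → (Fin N → Set) → (Vec (Fin M) N → ℕ) → Set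
    DependsOn S f = ∀ ω ω′ → (∀ v → S v → lookup ω v ≡ lookup ω′ v) → f ω ≡ f ω′

    ∑-*-const : (A B : Fin M → ℕ) → (∀ x y → A x ≡ A y) → M * ∑ (λ x → A x * B x) ≡ ∑ A * ∑ B
    ∑-*-const A B h = begin
      M * ∑ (λ x → A x * B x)                 ≡⟨ ∑-const M _ ⟨
      ∑ (λ (y : Fin M) → ∑ (λ x → A x * B x)) ≡⟨ ∑-cong (λ y → ∑-cong (λ x → cong (_* B x) (h x y))) ⟩
      ∑ (λ y → ∑ (λ x → A y * B x))        ≡⟨ ∑-cong (λ y → ∑-*ˡ (A y) B) ⟩
      ∑ (λ y → A y * ∑ B)                  ≡⟨ ∑-*ʳ (∑ B) A ⟩
      ∑ A * ∑ B                            ∎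
      where open ≡-Reasoning

    -- A constant factor is uncorrelated with any other, so the factors split off one at a time. The
    -- index of the varying factor is a natural number because it may lie out of range: once that
    -- factor is split off, none of the remaining ones varies.
    Σ-Π-one-varying : ∀ K (l₀ : ℕ) (f : Fin K → Fin M → ℕ) → (∀ l → toℕ l ≢ l₀ → ∀ x y → f l x ≡ f l y) →
      M ^ K * ∑ (λ x → ∏ (λ l → f l x)) ≡ M * ∏ (λ l → ∑ (f l))
    Σ-Π-one-varying zero l₀ f h = trans (+-identityʳ _) (trans (∑-cong (λ x → ∏-zero (λ l → f l x)))
      (trans (∑-const M 1) (cong (M *_) (sym (∏-zero (λ l → ∑ (f l)))))))
    Σ-Π-one-varying (suc K) l₀ f h = begin
      M * M ^ K * ∑ (λ x → ∏ (λ l → f l x))     ≡⟨ cong (M * M ^ K *_) (∑-cong (λ x → ∏-suc (λ l → f l x))) ⟩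
      M * M ^ K * ∑ (λ x → f zero x * R x)   ≡⟨ cong (_* ∑ (λ x → f zero x * R x)) (*-comm M (M ^ K)) ⟩
      M ^ K * M * ∑ (λ x → f zero x * R x)   ≡⟨ *-assoc (M ^ K) M _ ⟩
      M ^ K * (M * ∑ (λ x → f zero x * R x)) ≡⟨ cong (M ^ K *_) (split l₀ h) ⟩
      M ^ K * (∑ (f zero) * ∑ R)          ≡⟨ x∙yz≈y∙xz (M ^ K) (∑ (f zero)) (∑ R) ⟩
      ∑ (f zero) * (M ^ K * ∑ R)          ≡⟨ cong (∑ (f zero) *_) (rest l₀ h) ⟩
      ∑ (f zero) * (M * ∏ (λ l → ∑ (f (suc l)))) ≡⟨ x∙yz≈y∙xz (∑ (f zero)) M _ ⟩
      M * (∑ (f zero) * ∏ (λ l → ∑ (f (suc l)))) ≡⟨ cong (M *_) (∏-suc (λ l → ∑ (f l))) ⟨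
      M * ∏ (λ l → ∑ (f l)) ∎
      where
      open ≡-Reasoning
      R : Fin M → ℕ
      R x = ∏ (λ l → f (suc l) x)
      rest : ∀ l₀ → (∀ l → toℕ l ≢ l₀ → ∀ x y → f l x ≡ f l y) →
        M ^ K * ∑ R ≡ M * ∏ (λ l → ∑ (f (suc l)))
      rest zero     h = Σ-Π-one-varying K K (f ∘ suc) (λ l _ → h (suc l) λ ())
      rest (suc l₀) h = Σ-Π-one-varying K l₀ (f ∘ suc) (λ l n → h (suc l) (n ∘ suc-injective))
      split : ∀ l₀ → (∀ l → toℕ l ≢ l₀ → ∀ x y → f l x ≡ f l y) →
        M * ∑ (λ x → f zero x * R x) ≡ ∑ (f zero) * ∑ R
      split (suc _) h = ∑-*-const (f zero) R (h zero λ ())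
      split zero    h = trans (cong (M *_) (∑-cong (λ x → *-comm (f zero x) (R x))))
        (trans (∑-*-const R (f zero) (λ x y → ∏-cong (λ l → h (suc l) (λ ()) x y)))
               (*-comm (∑ R) _))

    -- Independence of functions of disjoint blocks of coordinates: divided by the powers of
    -- `M ^ N`, this is E ∏ = ∏ E. The first coordinate is seen only by the block that owns it,
    -- which is the situation of `Σ-Π-one-varying`.
    Ω-Π-independent : ∀ N {K} (own : Fin N → Fin K) (F : Fin K → Vec (Fin M) N → ℕ) →
      (∀ l → DependsOn (λ v → own v ≡ l) (F l)) →
      (M ^ N) ^ K * ΣΩ N (λ ω → ∏ (λ l → F l ω)) ≡ M ^ N * ∏ (λ l → ΣΩ N (F l))
    Ω-Π-independent zero {K} own F dep = cong (_* ∏ (λ l → F l [])) (^-zeroˡ K)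
    Ω-Π-independent (suc N) {K} own F dep = begin
      (M * M ^ N) ^ K * ∑ (λ x → ΣΩ N (λ ω → ∏ (λ l → F l (x ∷ ω))))
        ≡⟨ cong (_* ∑ (λ x → ΣΩ N (λ ω → ∏ (λ l → F l (x ∷ ω))))) (^-distribʳ-* M (M ^ N) K) ⟩
      M ^ K * (M ^ N) ^ K * ∑ (λ x → ΣΩ N (λ ω → ∏ (λ l → F l (x ∷ ω))))
        ≡⟨ *-assoc (M ^ K) _ _ ⟩
      M ^ K * ((M ^ N) ^ K * ∑ (λ x → ΣΩ N (λ ω → ∏ (λ l → F l (x ∷ ω)))))
        ≡⟨ cong (M ^ K *_) (∑-*ˡ ((M ^ N) ^ K) _) ⟨
      M ^ K * ∑ (λ x → (M ^ N) ^ K * ΣΩ N (λ ω → ∏ (λ l → F l (x ∷ ω))))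
        ≡⟨ cong (M ^ K *_) (∑-cong (λ x → Ω-Π-independent N (own ∘ suc) (λ l → F l ∘ (x ∷_)) (dep′ x))) ⟩
      M ^ K * ∑ (λ x → M ^ N * ∏ (λ l → f l x))
        ≡⟨ cong (M ^ K *_) (∑-*ˡ (M ^ N) _) ⟩
      M ^ K * (M ^ N * ∑ (λ x → ∏ (λ l → f l x)))
        ≡⟨ x∙yz≈y∙xz (M ^ K) (M ^ N) _ ⟩
      M ^ N * (M ^ K * ∑ (λ x → ∏ (λ l → f l x)))
        ≡⟨ cong (M ^ N *_) (Σ-Π-one-varying K (toℕ (own zero)) f constant) ⟩
      M ^ N * (M * ∏ (λ l → ∑ (f l)))
        ≡⟨ x∙yz≈y∙xz (M ^ N) M _ ⟩
      M * (M ^ N * ∏ (λ l → ∑ (f l)))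
        ≡⟨ *-assoc M (M ^ N) _ ⟨
      M * M ^ N * ∏ (λ l → ∑ (f l)) ∎
      where
      open ≡-Reasoning
      f : Fin K → Fin M → ℕ
      f l x = ΣΩ N (λ ω → F l (x ∷ ω))
      dep′ : ∀ x l → DependsOn (λ v → own (suc v) ≡ l) (F l ∘ (x ∷_))
      dep′ x l ω ω′ e = dep l (x ∷ ω) (x ∷ ω′) λ { zero _ → refl ; (suc v) q → e v q }
      constant : ∀ l → toℕ l ≢ toℕ (own zero) → ∀ x y → f l x ≡ f l y
      constant l l≢ x y = Ω-cong N (λ ω → dep l (x ∷ ω) (y ∷ ω)
        λ { zero q → ⊥-elim (l≢ (cong toℕ (sym q))) ; (suc v) _ → refl })

  -- The local lemma and adapted exponential moments

  isZero : ℕ → ℕ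
  isZero zero    = 1
  isZero (suc _) = 0

  isZero≤1 : ∀ n → isZero n ≤ 1
  isZero≤1 zero    = ≤-refl
  isZero≤1 (suc _) = z≤n

  -- The last two hypotheses make the correction `X` at most half of `G₂`. Used to undo the removal
  -- of near events in the local lemma.
  ≤-double-of-≤-half : ∀ {P G₂ G X B} → 0 < P → G₂ ≤ G + X → P * X ≤ 2 * (B * G₂) → 4 * B ≤ P → G₂ ≤ 2 * G
  ≤-double-of-≤-half {P} {G₂} {G} {X} {B} 0<P G₂≤ PX≤ 4B≤ =
    *-cancelˡ-≤ P {{>-nonZero 0<P}} (+-cancelʳ-≤ (P * G₂) (P * G₂) (P * (2 * G)) (begin
      P * G₂ + P * G₂               ≡⟨ e₁ P G₂ ⟩
      2 * (P * G₂)                  ≤⟨ *-monoʳ-≤ 2 (*-monoʳ-≤ P G₂≤) ⟩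
      2 * (P * (G + X))             ≡⟨ e₂ P G X ⟩
      P * (2 * G) + 2 * (P * X)     ≤⟨ +-monoʳ-≤ (P * (2 * G)) (*-monoʳ-≤ 2 PX≤) ⟩
      P * (2 * G) + 2 * (2 * (B * G₂)) ≡⟨ cong (P * (2 * G) +_) (e₃ B G₂) ⟩
      P * (2 * G) + 4 * B * G₂      ≤⟨ +-monoʳ-≤ (P * (2 * G)) (*-monoˡ-≤ G₂ 4B≤) ⟩
      P * (2 * G) + P * G₂          ∎))
    where
    open ≤-Reasoning
    e₁ : ∀ p g → p * g + p * g ≡ 2 * (p * g)
    e₁ = solve-∀
    e₂ : ∀ p g x → 2 * (p * (g + x)) ≡ p * (2 * g) + 2 * (p * x)
    e₂ = solve-∀
    e₃ : ∀ b g → 2 * (2 * (b * g)) ≡ 4 * b * g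
    e₃ = solve-∀

  module _ {M : ℕ} where

    Ω-*-independent : ∀ N (S : Fin N → Bool) (f g : Vec (Fin M) N → ℕ) → 0 < M →
      DependsOn (λ v → S v ≡ true) f → DependsOn (λ v → S v ≡ false) g →
      M ^ N * ΣΩ N (λ ω → f ω * g ω) ≡ ΣΩ N f * ΣΩ N g
    Ω-*-independent N S f g 0<M df dg = *-cancelˡ-≡ _ _ (M ^ N) {{m^n≢0 M N {{>-nonZero 0<M}}}} (begin
      M ^ N * (M ^ N * ΣΩ N (λ ω → f ω * g ω)) ≡⟨ *-assoc (M ^ N) (M ^ N) _ ⟨
      M ^ N * M ^ N * ΣΩ N (λ ω → f ω * g ω)
        ≡⟨ cong₂ _*_ (cong (M ^ N *_) (sym (*-identityʳ (M ^ N)))) (Ω-cong N (λ ω → sym (∏₂ (λ l → F l ω)))) ⟩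
      (M ^ N) ^ 2 * ΣΩ N (λ ω → ∏ (λ l → F l ω)) ≡⟨ Ω-Π-independent N own F dep ⟩
      M ^ N * ∏ (λ l → ΣΩ N (F l))               ≡⟨ cong (M ^ N *_) (∏₂ (λ l → ΣΩ N (F l))) ⟩
      M ^ N * (ΣΩ N f * ΣΩ N g)                  ∎)
      where
      open ≡-Reasoning
      own : Fin N → Fin 2
      own v = if S v then zero else suc zero
      F : Fin 2 → Vec (Fin M) N → ℕ
      F zero       = f
      F (suc zero) = g
      ∏₂ : (h : Fin 2 → ℕ) → ∏ h ≡ h zero * h (suc zero)
      ∏₂ h = trans (∏-suc h) (cong (h zero *_) (trans (∏-suc _) (trans (cong (h (suc zero) *_) (∏-zero _)) (*-identityʳ _))))
      dep : ∀ l → DependsOn (λ v → own v ≡ l) (F l)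
      dep zero ω ω′ e = df ω ω′ (λ v Sv → e v (cong (if_then zero else suc zero) Sv))
      dep (suc zero) ω ω′ e = dg ω ω′ (λ v Sv → e v (cong (if_then zero else suc zero) Sv))

  -- `bad` and `near` are multiplicities rather than predicates: a union of events can be entered as
  -- a sum of indicators, and `rare` asks only for a weighted sum of expectations over the
  -- neighbourhood, not for a maximum degree and a maximum probability.
  module LocalLemma {M N E : ℕ}
    (bad : Fin E → Vec (Fin M) N → ℕ)
    (support : Fin E → Fin N → Bool)
    (depends : ∀ e → DependsOn (λ v → support e v ≡ true) (bad e))
    (near : Fin E → Fin E → ℕ)
    (near-refl : ∀ e → 0 < near e e)
    (far⇒disjoint : ∀ e f → near e f ≡ 0 → ∀ v → support f v ≡ true → support e v ≡ false)
    (0<M : 0 < M)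
    (rare : ∀ e → 4 * ∑ (λ f → near e f * ΣΩ N (bad f)) ≤ M ^ N)
    where

    private
      Ω : Set
      Ω = Vec (Fin M) N

      0<Mᴺ : 0 < M ^ N
      0<Mᴺ = m^n>0 M {{>-nonZero 0<M}} N

      good : List (Fin E) → Ω → ℕ
      good []      ω = 1
      good (f ∷ S) ω = isZero (bad f ω) * good S ω

      far : Fin E → List (Fin E) → List (Fin E)
      far e [] = []
      far e (f ∷ S) with near e f
      ... | zero  = f ∷ far e S
      ... | suc _ = far e S

      far-shrinks : ∀ e S → far e S ≡ S ⊎ length (far e S) < length S
      far-shrinks e [] = inj₁ refl
      far-shrinks e (f ∷ S) with near e f | far-shrinks e S
      ... | zero  | inj₁ eq = inj₁ (cong (f ∷_) eq)
      ... | zero  | inj₂ lt = inj₂ (s≤s lt)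
      ... | suc _ | inj₁ eq = inj₂ (s≤s (≤-reflexive (cong length eq)))
      ... | suc _ | inj₂ lt = inj₂ (m<n⇒m<1+n lt)

      good≤far : ∀ e S ω → good S ω ≤ good (far e S) ω
      good≤far e [] ω = ≤-refl
      good≤far e (f ∷ S) ω with near e f
      ... | zero  = *-monoʳ-≤ (isZero (bad f ω)) (good≤far e S ω)
      ... | suc _ = ≤-trans (*-mono-≤ (isZero≤1 (bad f ω)) (good≤far e S ω)) (≤-reflexive (*-identityˡ _))

      far≡good : ∀ e S ω → (∀ f → near e f * bad f ω ≡ 0) → good (far e S) ω ≡ good S ω
      far≡good e [] ω h = refl
      far≡good e (f ∷ S) ω h with near e f in eq
      ... | zero  = cong (isZero (bad f ω) *_) (far≡good e S ω h)
      ... | suc k with bad f ω in eq′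
      ...   | zero  = trans (far≡good e S ω h) (sym (*-identityˡ _))
      ...   | suc b with () ← trans (sym (cong₂ _*_ eq eq′)) (h f)

      -- Either no event near `e` occurs, and then dropping the near conditions changes nothing, or
      -- the sum contains at least one full copy of the left side.
      far≤ : ∀ e S ω → good (far e S) ω ≤ good S ω + ∑ (λ f → near e f * (bad f ω * good (far e S) ω))
      far≤ e S ω = ≤-trans (by-cases (∑ λ f → near e f * bad f ω) refl)
        (≤-reflexive (cong (good S ω +_) (trans (sym (∑-*ʳ (good (far e S) ω) (λ f → near e f * bad f ω)))
          (∑-cong (λ f → *-assoc (near e f) (bad f ω) _)))))
        where
        by-cases : ∀ B → (∑ λ f → near e f * bad f ω) ≡ B →
          good (far e S) ω ≤ good S ω + (∑ λ f → near e f * bad f ω) * good (far e S) ω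
        by-cases zero eq = ≤-trans (≤-reflexive (far≡good e S ω (λ f → n≤0⇒n≡0
          (≤-trans (∑-term (λ f → near e f * bad f ω) f) (≤-reflexive eq))))) (m≤m+n _ _)
        by-cases (suc B) eq = ≤-trans (m≤m+n _ (B * good (far e S) ω))
          (≤-trans (≤-reflexive (cong (_* good (far e S) ω) (sym eq))) (m≤n+m _ (good S ω)))

      good-far-depends : ∀ e S → DependsOn (λ v → support e v ≡ false) (good (far e S))
      good-far-depends e [] ω ω′ h = refl
      good-far-depends e (f ∷ S) ω ω′ h with near e f in eq
      ... | zero  = cong₂ _*_ (cong isZero (depends f ω ω′ (λ v s → h v (far⇒disjoint e f eq v s))))
                              (good-far-depends e S ω ω′ h)
      ... | suc _ = good-far-depends e S ω ω′ h

      bad-far : ∀ e S → M ^ N * ΣΩ N (λ ω → bad e ω * good (far e S) ω) ≡ ΣΩ N (bad e) * ΣΩ N (good (far e S))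
      bad-far e S = Ω-*-independent N (support e) (bad e) (good (far e S)) 0<M (depends e) (good-far-depends e S)

      -- The conditional bound P(bad e | good S) ≤ 2 P(bad e). `bad e` is independent of the
      -- conditions far from it. Dropping the near conditions costs at most a factor 2, by a union
      -- bound over the near events, each of which obeys the same bound relative to the strictly
      -- shorter list `far e S`.
      bad-good≤ : ∀ n S → length S ≤ n → ∀ e →
        M ^ N * ΣΩ N (λ ω → bad e ω * good S ω) ≤ 2 * (ΣΩ N (bad e) * ΣΩ N (good S))
      bad-good≤ n S len e with far-shrinks e S
      ... | inj₁ eq = subst (λ S′ → M ^ N * ΣΩ N (λ ω → bad e ω * good S′ ω) ≤ 2 * (ΣΩ N (bad e) * ΣΩ N (good S′))) eq
                        (≤-trans (≤-reflexive (bad-far e S)) (m≤m+n _ _))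
      bad-good≤ zero    S len e | inj₂ lt = case ≤-trans lt len of λ ()
      bad-good≤ (suc n) S len e | inj₂ lt = begin
        M ^ N * ΣΩ N (λ ω → bad e ω * good S ω)
          ≤⟨ *-monoʳ-≤ (M ^ N) (Ω-mono N (λ ω → *-monoʳ-≤ (bad e ω) (good≤far e S ω))) ⟩
        M ^ N * ΣΩ N (λ ω → bad e ω * good F ω)     ≡⟨ bad-far e S ⟩
        ΣΩ N (bad e) * ΣΩ N (good F)                ≤⟨ *-monoʳ-≤ (ΣΩ N (bad e)) far≤2good ⟩
        ΣΩ N (bad e) * (2 * ΣΩ N (good S))          ≡⟨ e₁ (ΣΩ N (bad e)) _ ⟩
        2 * (ΣΩ N (bad e) * ΣΩ N (good S))          ∎
        where
        open ≤-Reasoning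
        F : List (Fin E)
        F = far e S
        e₁ : ∀ a b → a * (2 * b) ≡ 2 * (a * b)
        e₁ = solve-∀
        e₃ : ∀ a b c → a * (2 * (b * c)) ≡ a * b * (2 * c)
        e₃ = solve-∀
        e₄ : ∀ a b → a * (2 * b) ≡ 2 * (a * b)
        e₄ = solve-∀
        Y : ℕ
        Y = ∑ (λ f → near e f * ΣΩ N (λ ω → bad f ω * good F ω))
        split : ΣΩ N (good F) ≤ ΣΩ N (good S) + Y
        split = begin
          ΣΩ N (good F) ≤⟨ Ω-mono N (far≤ e S) ⟩
          ΣΩ N (λ ω → good S ω + ∑ (λ f → near e f * (bad f ω * good F ω))) ≡⟨ Ω-+ N (good S) _ ⟩
          ΣΩ N (good S) + ΣΩ N (λ ω → ∑ (λ f → near e f * (bad f ω * good F ω)))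
            ≡⟨ cong (ΣΩ N (good S) +_) (Ω-Σ N (λ f ω → near e f * (bad f ω * good F ω))) ⟩
          ΣΩ N (good S) + ∑ (λ f → ΣΩ N (λ ω → near e f * (bad f ω * good F ω)))
            ≡⟨ cong (ΣΩ N (good S) +_) (∑-cong (λ f → Ω-*ˡ N (near e f) (λ ω → bad f ω * good F ω))) ⟩
          ΣΩ N (good S) + Y ∎
        union : M ^ N * Y ≤ 2 * (∑ (λ f → near e f * ΣΩ N (bad f)) * ΣΩ N (good F))
        union = begin
          M ^ N * Y ≡⟨ ∑-*ˡ (M ^ N) _ ⟨
          ∑ (λ f → M ^ N * (near e f * ΣΩ N (λ ω → bad f ω * good F ω)))
            ≡⟨ ∑-cong (λ f → x∙yz≈y∙xz (M ^ N) (near e f) (ΣΩ N (λ ω → bad f ω * good F ω))) ⟩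
          ∑ (λ f → near e f * (M ^ N * ΣΩ N (λ ω → bad f ω * good F ω)))
            ≤⟨ ∑-mono (λ f → *-monoʳ-≤ (near e f) (bad-good≤ n F (≤-pred (≤-trans lt len)) f)) ⟩
          ∑ (λ f → near e f * (2 * (ΣΩ N (bad f) * ΣΩ N (good F))))
            ≡⟨ ∑-cong (λ f → e₃ (near e f) (ΣΩ N (bad f)) (ΣΩ N (good F))) ⟩
          ∑ (λ f → near e f * ΣΩ N (bad f) * (2 * ΣΩ N (good F)))
            ≡⟨ ∑-*ʳ (2 * ΣΩ N (good F)) (λ f → near e f * ΣΩ N (bad f)) ⟩
          ∑ (λ f → near e f * ΣΩ N (bad f)) * (2 * ΣΩ N (good F))
            ≡⟨ e₄ (∑ (λ f → near e f * ΣΩ N (bad f))) _ ⟩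
          2 * (∑ (λ f → near e f * ΣΩ N (bad f)) * ΣΩ N (good F)) ∎
        far≤2good : ΣΩ N (good F) ≤ 2 * ΣΩ N (good S)
        far≤2good = ≤-double-of-≤-half {B = ∑ (λ f → near e f * ΣΩ N (bad f))} 0<Mᴺ split union (rare e)

      good-cons : ∀ f S ω → good S ω ≤ good (f ∷ S) ω + bad f ω * good S ω
      good-cons f S ω with bad f ω
      ... | zero  = ≤-reflexive (sym (trans (+-identityʳ _) (*-identityˡ _)))
      ... | suc b = m≤m+n _ _

      0<good : ∀ S → 0 < ΣΩ N (good S)
      0<good [] = ≤-trans 0<Mᴺ (≤-reflexive (sym (trans (Ω-const N 1) (*-identityʳ _))))
      0<good (f ∷ S) = n≢0⇒n>0 (λ eq → n≮0 (≤-trans (0<good S) (≤-trans half (≤-reflexive (cong (2 *_) eq)))))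
        where
        A≤ : ΣΩ N (bad f) ≤ ∑ (λ f′ → near f f′ * ΣΩ N (bad f′))
        A≤ = ≤-trans (≤-trans (≤-reflexive (sym (*-identityˡ _))) (*-monoˡ-≤ (ΣΩ N (bad f)) (near-refl f)))
                     (∑-term (λ f′ → near f f′ * ΣΩ N (bad f′)) f)
        half : ΣΩ N (good S) ≤ 2 * ΣΩ N (good (f ∷ S))
        half = ≤-double-of-≤-half {B = ΣΩ N (bad f)} 0<Mᴺ
          (≤-trans (Ω-mono N (good-cons f S)) (≤-reflexive (Ω-+ N (good (f ∷ S)) (λ ω → bad f ω * good S ω))))
          (bad-good≤ (length S) S ≤-refl f) (≤-trans (*-monoʳ-≤ 4 A≤) (rare f))

      good⇒avoids : ∀ S ω → 0 < good S ω → ∀ {e} → e ∈ S → bad e ω ≡ 0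
      good⇒avoids (f ∷ S) ω p q with bad f ω in eq
      good⇒avoids (f ∷ S) ω p (here refl) | zero = eq
      good⇒avoids (f ∷ S) ω p (there q)   | zero = good⇒avoids S ω (subst (0 <_) (*-identityˡ _) p) q

    avoid-all : ∃ λ ω → ∀ e → bad e ω ≡ 0
    avoid-all with Ω-pos N (good (allFin E)) (0<good (allFin E))
    ... | ω , p = ω , λ e → good⇒avoids (allFin E) ω p (∈-allFin e)

  module _ {M : ℕ} where

    Adapted : ∀ {N} → (Fin N → Vec (Fin M) N → ℕ) → Set
    Adapted c = ∀ v → DependsOn (λ u → toℕ u ≤ toℕ v) (c v)

    ∑≤-if-inhabited : ∀ {M b} {f : Fin M → ℕ} → (Fin M → ∑ f ≤ b) → ∑ f ≤ b
    ∑≤-if-inhabited {zero}  h = ≤-trans (≤-reflexive (∑-zero λ ())) z≤n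
    ∑≤-if-inhabited {suc M} h = h zero

    -- A supermartingale bound: whatever the earlier coordinates, summation over the coordinate `v`
    -- turns the factor of `v` into at most `M * Λ + h v`. Once the first coordinate is fixed, the
    -- remaining factors are adapted again.
    Ω-Π-adapted : ∀ N Λ (c : Fin N → Vec (Fin M) N → ℕ) (h : Fin N → ℕ) → Adapted c →
      (∀ v ω → ∑ (λ x → c v (ω [ v ]≔ x)) ≤ h v) →
      ΣΩ N (λ ω → ∏ (λ v → Λ + c v ω)) ≤ ∏ (λ v → M * Λ + h v)
    Ω-Π-adapted zero Λ c h ad b = ≤-reflexive (trans (∏-zero _) (sym (∏-zero _)))
    Ω-Π-adapted (suc N) Λ c h ad b = begin
      ∑ (λ x → ΣΩ N (λ ω → ∏ (λ v → Λ + c v (x ∷ ω))))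
        ≡⟨ ∑-cong (λ x → Ω-cong N (λ ω → ∏-suc (λ v → Λ + c v (x ∷ ω)))) ⟩
      ∑ (λ x → ΣΩ N (λ ω → (Λ + c zero (x ∷ ω)) * R x ω))
        ≡⟨ ∑-cong (λ x → Ω-cong N (λ ω → cong (λ y → (Λ + y) * R x ω) (first x ω (replicate N x)))) ⟩
      ∑ (λ x → ΣΩ N (λ ω → (Λ + c₀ x) * R x ω))
        ≡⟨ ∑-cong (λ x → Ω-*ˡ N (Λ + c₀ x) (R x)) ⟩
      ∑ (λ x → (Λ + c₀ x) * ΣΩ N (R x))
        ≤⟨ ∑-mono (λ x → *-monoʳ-≤ (Λ + c₀ x) (Ω-Π-adapted N Λ (λ v ω → c (suc v) (x ∷ ω)) (h ∘ suc)
             (λ v ω ω′ e → ad (suc v) (x ∷ ω) (x ∷ ω′) λ { zero _ → refl ; (suc u) (s≤s le) → e u le })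
             (λ v ω → b (suc v) (x ∷ ω)))) ⟩
      ∑ (λ x → (Λ + c₀ x) * ∏ (λ v → M * Λ + h (suc v)))
        ≡⟨ ∑-*ʳ _ (λ x → Λ + c₀ x) ⟩
      ∑ (λ x → Λ + c₀ x) * ∏ (λ v → M * Λ + h (suc v))
        ≤⟨ *-monoˡ-≤ _ (≤-trans (≤-reflexive (∑-+ (λ _ → Λ) c₀)) (+-mono-≤ (≤-reflexive (∑-const M Λ)) ∑c₀≤)) ⟩
      (M * Λ + h zero) * ∏ (λ v → M * Λ + h (suc v))
        ≡⟨ ∏-suc (λ v → M * Λ + h v) ⟨
      ∏ (λ v → M * Λ + h v) ∎
      where
      open ≤-Reasoning
      R : Fin M → Vec (Fin M) N → ℕ
      R x ω = ∏ (λ v → Λ + c (suc v) (x ∷ ω))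
      -- The later coordinates are a dummy that adaptedness makes irrelevant. It is built from `x`
      -- itself because the alphabet could be empty; `∑≤-if-inhabited` serves the same purpose.
      c₀ : Fin M → ℕ
      c₀ x = c zero (x ∷ replicate N x)
      first : ∀ x ω ω′ → c zero (x ∷ ω) ≡ c zero (x ∷ ω′)
      first x ω ω′ = ad zero (x ∷ ω) (x ∷ ω′) λ { zero _ → refl ; (suc u) () }
      ∑c₀≤ : ∑ c₀ ≤ h zero
      ∑c₀≤ = ∑≤-if-inhabited (λ y → ≤-trans
        (≤-reflexive (∑-cong (λ x → first x (replicate N x) (replicate N y)))) (b zero (y ∷ replicate N y)))

  -- Exponential tail bounds

  -- (1 + 1/x)^p ≤ x/(x − p), for x = p + d.
  [1+1/x]^p≤ : ∀ p d → suc (p + d) ^ p * d ≤ (p + d) ^ p * (p + d)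
  [1+1/x]^p≤ p d = go p d (p + d) refl
    where
    open ≤-Reasoning
    e₂ : ∀ p d → suc (suc (p + d)) * d + suc p ≡ (suc p + d) * suc d
    e₂ = solve-∀
    go : ∀ p d x → x ≡ p + d → suc x ^ p * d ≤ x ^ p * x
    go zero d x refl = ≤-refl
    go (suc p) d x refl = begin
      suc x * suc x ^ p * d   ≡⟨ xy∙z≈y∙xz (suc x) (suc x ^ p) d ⟩
      suc x ^ p * (suc x * d) ≤⟨ *-monoʳ-≤ (suc x ^ p) (≤-trans (m≤m+n (suc x * d) (suc p)) (≤-reflexive (e₂ p d))) ⟩
      suc x ^ p * (x * suc d) ≡⟨ x∙yz≈y∙xz (suc x ^ p) x (suc d) ⟩
      x * (suc x ^ p * suc d) ≤⟨ *-monoʳ-≤ x (go p (suc d) x (sym (+-suc p d))) ⟩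
      x * (x ^ p * x)         ≡⟨ *-assoc x (x ^ p) x ⟨
      x * x ^ p * x           ∎

  -- The previous bound at d = p q. It stands in for exp(1/(q+1)) ≤ 1 + 1/q.
  [1+1/pq]^p≤ : ∀ p q → suc (p * suc q) ^ p * q ≤ (p * suc q) ^ p * suc q
  [1+1/pq]^p≤ zero      q = *-monoʳ-≤ 1 (n≤1+n q)
  [1+1/pq]^p≤ p@(suc _) q = *-cancelʳ-≤ _ _ p (begin
    suc (p * suc q) ^ p * q * p     ≡⟨ e₁ p q (suc (p * suc q) ^ p) ⟩
    suc (p * suc q) ^ p * (p * q)   ≤⟨ subst (λ x → suc x ^ p * (p * q) ≤ x ^ p * x) (sym (*-suc p q)) ([1+1/x]^p≤ p (p * q)) ⟩
    (p * suc q) ^ p * (p * suc q)   ≡⟨ e₂ p (suc q) ((p * suc q) ^ p) ⟩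
    (p * suc q) ^ p * suc q * p     ∎)
    where
    open ≤-Reasoning
    e₁ : ∀ p q a → a * q * p ≡ a * (p * q)
    e₁ = solve-∀
    e₂ : ∀ p q a → a * (p * q) ≡ a * q * p
    e₂ = solve-∀

  ^-distribʳ-≤ : ∀ {a b c d} n → a * b ≤ c * d → a ^ n * b ^ n ≤ c ^ n * d ^ n
  ^-distribʳ-≤ {a} {b} {c} {d} n le =
    subst₂ _≤_ (^-distribʳ-* a b n) (^-distribʳ-* c d n) (^-monoˡ-≤ n le)

  bernoulli : ∀ x h → (x + h) * x ^ h ≤ x * suc x ^ h
  bernoulli x zero    = ≤-reflexive (cong (_* 1) (+-identityʳ x))
  bernoulli x (suc h) = begin
    (x + suc h) * (x * x ^ h)                ≡⟨ e₁ x h (x ^ h) ⟩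
    x * ((x + h) * x ^ h) + x * x ^ h        ≤⟨ +-mono-≤ (*-monoʳ-≤ x (bernoulli x h)) (*-monoʳ-≤ x (^-monoˡ-≤ h (n≤1+n x))) ⟩
    x * (x * suc x ^ h) + x * suc x ^ h      ≡⟨ e₂ x (suc x ^ h) ⟩
    x * (suc x * suc x ^ h)                  ∎
    where
    open ≤-Reasoning
    e₁ : ∀ x h p → (x + suc h) * (x * p) ≡ x * ((x + h) * p) + x * p
    e₁ = solve-∀
    e₂ : ∀ x p → x * (x * p) + x * p ≡ x * (suc x * p)
    e₂ = solve-∀

  module TailBound (C J : ℕ) where

    -- A weight Y ≤ C satisfies (1 + 1/K)^Y ≤ 1 + Y/Λ, and J bounds the ratio of mean to deviation.
    Λ₀ Λ K : ℕ
    Λ₀ = suc C * J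
    Λ  = suc Λ₀
    K  = Λ + C

    -- Raising `Y` by one multiplies the left side by 1 + 1/K, relative to `K ^ Y`, and the right
    -- side by 1 + 1/(Λ + Y), which is no smaller because Λ + Y ≤ K.
    weight-bound : ∀ Y → Y ≤ C → Λ * suc K ^ Y ≤ (Λ + Y) * K ^ Y
    weight-bound zero    _  = ≤-reflexive (cong (_* 1) (sym (+-identityʳ Λ)))
    weight-bound (suc Y) le = begin
      Λ * (suc K * suc K ^ Y)     ≡⟨ x∙yz≈y∙xz Λ (suc K) (suc K ^ Y) ⟩
      suc K * (Λ * suc K ^ Y)     ≤⟨ *-monoʳ-≤ (suc K) (weight-bound Y (≤-trans (n≤1+n Y) le)) ⟩
      suc K * ((Λ + Y) * K ^ Y)   ≡⟨ e₂ K (Λ + Y) (K ^ Y) ⟩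
      (Λ + Y + (Λ + Y) * K) * K ^ Y ≤⟨ *-monoˡ-≤ (K ^ Y) (+-monoˡ-≤ ((Λ + Y) * K) (+-monoʳ-≤ Λ (≤-trans (n≤1+n Y) le))) ⟩
      (K + (Λ + Y) * K) * K ^ Y   ≡⟨ e₃ Λ Y K (K ^ Y) ⟩
      (Λ + suc Y) * (K * K ^ Y)   ∎
      where
      open ≤-Reasoning
      e₂ : ∀ k a b → suc k * (a * b) ≡ (a + a * k) * b
      e₂ = solve-∀
      e₃ : ∀ l y k p → (k + (l + y) * k) * p ≡ (l + suc y) * (k * p)
      e₃ = solve-∀

    -- The exponential Markov inequality with base 1 + 1/K. The linear factors 1 + Y/Λ dominate the
    -- powers and are the ones whose product can be averaged under independence or adaptedness.
    markov : ∀ {L} (Y : Fin L → ℕ) t → (∀ l → Y l ≤ C) →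
      ind (t ≤ᵇ ∑ Y) * (Λ ^ L * suc K ^ t) ≤ K ^ t * ∏ (λ l → Λ + Y l)
    markov {L} Y t Y≤C with t ≤ᵇ ∑ Y in eq
    ... | false = z≤n
    ... | true with m≤n⇒∃[o]m+o≡n (≤ᵇ⇒≤ t (∑ Y) (subst T (sym eq) _))
    ...   | o , t+o≡ = *-cancelʳ-≤ _ _ (K ^ o) {{m^n≢0 K o}} (begin
      1 * (Λ ^ L * suc K ^ t) * K ^ o     ≡⟨ cong (_* K ^ o) (*-identityˡ (Λ ^ L * suc K ^ t)) ⟩
      Λ ^ L * suc K ^ t * K ^ o           ≤⟨ *-monoʳ-≤ (Λ ^ L * suc K ^ t) (^-monoˡ-≤ o (n≤1+n K)) ⟩
      Λ ^ L * suc K ^ t * suc K ^ o       ≡⟨ *-assoc (Λ ^ L) _ _ ⟩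
      Λ ^ L * (suc K ^ t * suc K ^ o)     ≡⟨ cong (Λ ^ L *_) (trans (sym (^-distribˡ-+-* (suc K) t o)) (cong (suc K ^_) t+o≡)) ⟩
      Λ ^ L * suc K ^ ∑ Y                 ≡⟨ cong₂ _*_ (∏-const L Λ) (∏-^ (suc K) Y) ⟨
      ∏ {L} (λ _ → Λ) * ∏ (λ l → suc K ^ Y l) ≡⟨ ∏-* (λ _ → Λ) (λ l → suc K ^ Y l) ⟨
      ∏ (λ l → Λ * suc K ^ Y l)           ≤⟨ ∏-mono (λ l → weight-bound (Y l) (Y≤C l)) ⟩
      ∏ (λ l → (Λ + Y l) * K ^ Y l)       ≡⟨ ∏-* (λ l → Λ + Y l) (λ l → K ^ Y l) ⟩
      ∏ (λ l → Λ + Y l) * ∏ (λ l → K ^ Y l) ≡⟨ cong (∏ (λ l → Λ + Y l) *_) (∏-^ K Y) ⟩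
      ∏ (λ l → Λ + Y l) * K ^ ∑ Y         ≡⟨ cong (λ z → ∏ (λ l → Λ + Y l) * K ^ z) (sym t+o≡) ⟩
      ∏ (λ l → Λ + Y l) * K ^ (t + o)     ≡⟨ cong (∏ (λ l → Λ + Y l) *_) (^-distribˡ-+-* K t o) ⟩
      ∏ (λ l → Λ + Y l) * (K ^ t * K ^ o) ≡⟨ x∙yz≈yx∙z (∏ (λ l → Λ + Y l)) (K ^ t) (K ^ o) ⟩
      K ^ t * ∏ (λ l → Λ + Y l) * K ^ o   ∎)
      where
      open ≤-Reasoning

    -- Bernoulli bounds each factor 1 + h/(P Λ) by a power of 1 + 1/(P Λ). The exponents add up to
    -- at most P B, and the P-th power of the base is at most Λ/Λ₀.
    moment-bound : ∀ {L} P B (h : Fin L → ℕ) → 0 < P → ∑ h ≤ P * B →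
      ∏ (λ l → P * Λ + h l) * Λ₀ ^ B ≤ (P * Λ) ^ L * Λ ^ B
    moment-bound {L} P B h 0<P ∑h≤ = *-cancelʳ-≤ _ _ (x ^ (P * B)) {{m^n≢0 x (P * B) {{>-nonZero 0<x}}}} (begin
      ∏ (λ l → x + h l) * Λ₀ ^ B * x ^ (P * B)   ≡⟨ xy∙z≈xz∙y (∏ (λ l → x + h l)) (Λ₀ ^ B) (x ^ (P * B)) ⟩
      ∏ (λ l → x + h l) * x ^ (P * B) * Λ₀ ^ B   ≤⟨ *-monoˡ-≤ (Λ₀ ^ B) step ⟩
      x ^ L * suc x ^ (P * B) * Λ₀ ^ B           ≡⟨ *-assoc (x ^ L) _ _ ⟩
      x ^ L * (suc x ^ (P * B) * Λ₀ ^ B)         ≡⟨ cong (λ z → x ^ L * (z * Λ₀ ^ B)) (^-*-assoc (suc x) P B) ⟨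
      x ^ L * ((suc x ^ P) ^ B * Λ₀ ^ B)         ≤⟨ *-monoʳ-≤ (x ^ L) (^-distribʳ-≤ {suc x ^ P} B ([1+1/pq]^p≤ P Λ₀)) ⟩
      x ^ L * ((x ^ P) ^ B * Λ ^ B)              ≡⟨ cong (λ z → x ^ L * (z * Λ ^ B)) (^-*-assoc x P B) ⟩
      x ^ L * (x ^ (P * B) * Λ ^ B)              ≡⟨ x∙yz≈xz∙y (x ^ L) (x ^ (P * B)) (Λ ^ B) ⟩
      x ^ L * Λ ^ B * x ^ (P * B)                ∎)
      where
      open ≤-Reasoning
      x : ℕ
      x = P * Λ
      0<x : 0 < x
      0<x = *-mono-≤ {1} {P} {1} {Λ} 0<P (s≤s z≤n)
      exact : ∏ (λ l → x + h l) * x ^ ∑ h ≤ x ^ L * suc x ^ ∑ h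
      exact = begin
        ∏ (λ l → x + h l) * x ^ ∑ h              ≡⟨ cong (∏ (λ l → x + h l) *_) (∏-^ x h) ⟨
        ∏ (λ l → x + h l) * ∏ (λ l → x ^ h l)    ≡⟨ ∏-* (λ l → x + h l) (λ l → x ^ h l) ⟨
        ∏ (λ l → (x + h l) * x ^ h l)            ≤⟨ ∏-mono (λ l → bernoulli x (h l)) ⟩
        ∏ (λ l → x * suc x ^ h l)                ≡⟨ ∏-* (λ _ → x) (λ l → suc x ^ h l) ⟩
        ∏ {L} (λ _ → x) * ∏ (λ l → suc x ^ h l)  ≡⟨ cong₂ _*_ (∏-const L x) (∏-^ (suc x) h) ⟩
        x ^ L * suc x ^ ∑ h                      ∎
      step : ∏ (λ l → x + h l) * x ^ (P * B) ≤ x ^ L * suc x ^ (P * B)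
      step with m≤n⇒∃[o]m+o≡n ∑h≤
      ... | o , eq = begin
        ∏ (λ l → x + h l) * x ^ (P * B)          ≡⟨ cong (λ z → ∏ (λ l → x + h l) * x ^ z) eq ⟨
        ∏ (λ l → x + h l) * x ^ (∑ h + o)        ≡⟨ cong (∏ (λ l → x + h l) *_) (^-distribˡ-+-* x (∑ h) o) ⟩
        ∏ (λ l → x + h l) * (x ^ ∑ h * x ^ o)    ≡⟨ *-assoc (∏ (λ l → x + h l)) _ _ ⟨
        ∏ (λ l → x + h l) * x ^ ∑ h * x ^ o      ≤⟨ *-mono-≤ exact (^-monoˡ-≤ o (n≤1+n x)) ⟩
        x ^ L * suc x ^ ∑ h * suc x ^ o          ≡⟨ *-assoc (x ^ L) _ _ ⟩
        x ^ L * (suc x ^ ∑ h * suc x ^ o)        ≡⟨ cong (x ^ L *_) (^-distribˡ-+-* (suc x) (∑ h) o) ⟨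
        x ^ L * suc x ^ (∑ h + o)                ≡⟨ cong (λ z → x ^ L * suc x ^ z) eq ⟩
        x ^ L * suc x ^ (P * B)                  ∎

    -- Each unit of the mean costs the factor (Λ/Λ₀) · K/(K+1), the gap between linear and
    -- exponential weights. The constants are chosen so that K = (C+1)(J+1), which makes this factor
    -- exactly 1 + 1/(J (K+1)). Its J-th power is at most 1 + 1/K, so a mean of at most J s costs no
    -- more than s powers of 1 + 1/K.
    mean-vs-deviation : ∀ {B s} → B ≤ J * s → (Λ * K) ^ B * K ^ s ≤ (suc K * Λ₀) ^ B * suc K ^ s
    mean-vs-deviation {B} {s} B≤ with m≤n⇒∃[o]m+o≡n B≤
    ... | o , eq = *-cancelʳ-≤ _ _ ((Λ * K) ^ o) {{m^n≢0 (Λ * K) o}} (begin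
      u ^ B * K ^ s * u ^ o             ≡⟨ xy∙z≈xz∙y (u ^ B) (K ^ s) (u ^ o) ⟩
      u ^ B * u ^ o * K ^ s             ≡⟨ cong (_* K ^ s) (trans (sym (^-distribˡ-+-* u B o)) (cong (u ^_) eq)) ⟩
      u ^ (J * s) * K ^ s               ≡⟨ cong (_* K ^ s) (^-*-assoc u J s) ⟨
      (u ^ J) ^ s * K ^ s               ≤⟨ ^-distribʳ-≤ {u ^ J} s block ⟩
      (y ^ J) ^ s * suc K ^ s           ≡⟨ cong (_* suc K ^ s) (^-*-assoc y J s) ⟩
      y ^ (J * s) * suc K ^ s           ≡⟨ cong (_* suc K ^ s) (trans (cong (y ^_) (sym eq)) (^-distribˡ-+-* y B o)) ⟩
      y ^ B * y ^ o * suc K ^ s         ≤⟨ *-monoˡ-≤ (suc K ^ s) (*-monoʳ-≤ (y ^ B) (^-monoˡ-≤ o y≤u)) ⟩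
      y ^ B * u ^ o * suc K ^ s         ≡⟨ xy∙z≈xz∙y (y ^ B) (u ^ o) (suc K ^ s) ⟩
      y ^ B * suc K ^ s * u ^ o         ∎)
      where
      open ≤-Reasoning
      u y : ℕ
      u = Λ * K
      y = suc K * Λ₀
      e₂ : ∀ j c → suc (suc c * j) * (suc (suc c * j) + c) ≡ suc c * suc (j * suc (suc (suc c * j) + c))
      e₂ = solve-∀
      e₃ : ∀ j c k → suc k * (suc c * j) ≡ suc c * (j * suc k)
      e₃ = solve-∀
      u≡ : u ≡ suc C * suc (J * suc K)
      u≡ = e₂ J C
      y≡ : y ≡ suc C * (J * suc K)
      y≡ = e₃ J C K
      y≤u : y ≤ u
      y≤u = subst₂ _≤_ (sym y≡) (sym u≡) (*-monoʳ-≤ (suc C) (n≤1+n (J * suc K)))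
      block : u ^ J * K ≤ y ^ J * suc K
      block = begin
        u ^ J * K                                  ≡⟨ cong (λ z → z ^ J * K) u≡ ⟩
        (suc C * suc (J * suc K)) ^ J * K          ≡⟨ cong (_* K) (^-distribʳ-* (suc C) _ J) ⟩
        suc C ^ J * suc (J * suc K) ^ J * K        ≡⟨ *-assoc (suc C ^ J) _ _ ⟩
        suc C ^ J * (suc (J * suc K) ^ J * K)      ≤⟨ *-monoʳ-≤ (suc C ^ J) ([1+1/pq]^p≤ J K) ⟩
        suc C ^ J * ((J * suc K) ^ J * suc K)      ≡⟨ *-assoc (suc C ^ J) _ _ ⟨
        suc C ^ J * (J * suc K) ^ J * suc K        ≡⟨ cong (_* suc K) (^-distribʳ-* (suc C) _ J) ⟨
        (suc C * (J * suc K)) ^ J * suc K          ≡⟨ cong (λ z → z ^ J * suc K) y≡ ⟨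
        y ^ J * suc K                              ∎

    -- Of the excess 2 s over the mean, one s pays for `mean-vs-deviation`, and the other remains as
    -- the bound (K/(K+1))^s. The moment hypothesis leaves `P` and `h` open so that adapted sums and
    -- sums of independent variables are both covered.
    tail : ∀ {M N L} (Y : Fin L → Vec (Fin M) N → ℕ) P B s (h : Fin L → ℕ) →
      (∀ l ω → Y l ω ≤ C) → 0 < P → 0 < J →
      P ^ L * ΣΩ N (λ ω → ∏ (λ l → Λ + Y l ω)) ≤ M ^ N * ∏ (λ l → P * Λ + h l) →
      ∑ h ≤ P * B → B ≤ J * s →
      ΣΩ N (λ ω → ind ((B + 2 * s) ≤ᵇ ∑ (λ l → Y l ω))) * suc K ^ s ≤ M ^ N * K ^ s
    tail {M} {N} {L} Y P B s h Y≤C 0<P 0<J moment ∑h≤ B≤ =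
      *-cancelʳ-≤ _ _ (suc K ^ s * K ^ s * ((suc K * Λ₀) ^ B))
        {{m*n≢0 _ _ {{m*n≢0 _ _ {{m^n≢0 (suc K) s}} {{m^n≢0 K s}}}} {{m^n≢0 _ B {{m*n≢0 (suc K) Λ₀ {{_}} {{>-nonZero 0<Λ₀}}}}}}}} (begin
      X * suc K ^ s * (suc K ^ s * K ^ s * y ^ B)
        ≡⟨ cong (λ z → X * suc K ^ s * (suc K ^ s * K ^ s * z)) (^-distribʳ-* (suc K) Λ₀ B) ⟩
      X * suc K ^ s * (suc K ^ s * K ^ s * (suc K ^ B * Λ₀ ^ B))
        ≡⟨ e₁ X (suc K ^ s) (K ^ s) (suc K ^ B) (Λ₀ ^ B) ⟩
      X * (suc K ^ B * (suc K ^ s * suc K ^ s)) * Λ₀ ^ B * K ^ s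
        ≡⟨ cong (λ z → X * z * Λ₀ ^ B * K ^ s) (split-t (suc K)) ⟨
      X * suc K ^ t * Λ₀ ^ B * K ^ s
        ≤⟨ *-monoˡ-≤ (K ^ s) main ⟩
      M ^ N * (K ^ t * Λ ^ B) * K ^ s
        ≡⟨ cong (λ z → M ^ N * (z * Λ ^ B) * K ^ s) (split-t K) ⟩
      M ^ N * (K ^ B * (K ^ s * K ^ s) * Λ ^ B) * K ^ s
        ≡⟨ e₂ (M ^ N) (K ^ B) (K ^ s) (Λ ^ B) ⟩
      M ^ N * K ^ s * (K ^ s * ((Λ ^ B * K ^ B) * K ^ s))
        ≡⟨ cong (λ z → M ^ N * K ^ s * (K ^ s * (z * K ^ s))) (^-distribʳ-* Λ K B) ⟨
      M ^ N * K ^ s * (K ^ s * ((Λ * K) ^ B * K ^ s))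
        ≤⟨ *-monoʳ-≤ (M ^ N * K ^ s) (*-monoʳ-≤ (K ^ s) (mean-vs-deviation B≤)) ⟩
      M ^ N * K ^ s * (K ^ s * (y ^ B * suc K ^ s))
        ≡⟨ cong (M ^ N * K ^ s *_) (x∙yz≈zx∙y (K ^ s) (y ^ B) (suc K ^ s)) ⟩
      M ^ N * K ^ s * (suc K ^ s * K ^ s * y ^ B) ∎)
      where
      open ≤-Reasoning
      t y X : ℕ
      t = B + 2 * s
      y = suc K * Λ₀
      X = ΣΩ N (λ ω → ind (t ≤ᵇ ∑ (λ l → Y l ω)))
      0<Λ₀ : 0 < Λ₀
      0<Λ₀ = *-mono-≤ {1} {suc C} {1} {J} (s≤s z≤n) 0<J
      split-t : ∀ a → a ^ t ≡ a ^ B * (a ^ s * a ^ s)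
      split-t a = trans (^-distribˡ-+-* a B (2 * s)) (cong (a ^ B *_)
        (trans (cong (λ z → a ^ (s + z)) (+-identityʳ s)) (^-distribˡ-+-* a s s)))
      e₁ : ∀ x k₁ k b l → x * k₁ * (k₁ * k * (b * l)) ≡ x * (b * (k₁ * k₁)) * l * k
      e₁ = solve-∀
      e₂ : ∀ m b k l → m * (b * (k * k) * l) * k ≡ m * k * (k * ((l * b) * k))
      e₂ = solve-∀
      e₄ : ∀ p l x k → p * l * (x * k) ≡ p * (x * (l * k))
      e₄ = solve-∀
      e₆ : ∀ k m o l → k * (m * o) * l ≡ k * m * (o * l)
      e₆ = solve-∀
      e₇ : ∀ k m x l → k * m * (x * l) ≡ x * (m * (k * l))
      e₇ = solve-∀
      instance
        nz : NonZero ((P * Λ) ^ L)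
        nz = m^n≢0 (P * Λ) L {{m*n≢0 P Λ {{>-nonZero 0<P}}}}
      main : X * suc K ^ t * Λ₀ ^ B ≤ M ^ N * (K ^ t * Λ ^ B)
      main = *-cancelˡ-≤ ((P * Λ) ^ L) (begin
        (P * Λ) ^ L * (X * suc K ^ t * Λ₀ ^ B)
          ≡⟨ *-assoc ((P * Λ) ^ L) _ _ ⟨
        (P * Λ) ^ L * (X * suc K ^ t) * Λ₀ ^ B
          ≡⟨ cong (λ z → z * (X * suc K ^ t) * Λ₀ ^ B) (^-distribʳ-* P Λ L) ⟩
        P ^ L * Λ ^ L * (X * suc K ^ t) * Λ₀ ^ B
          ≡⟨ cong (_* Λ₀ ^ B) (e₄ (P ^ L) (Λ ^ L) X (suc K ^ t)) ⟩
        P ^ L * (X * (Λ ^ L * suc K ^ t)) * Λ₀ ^ B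
          ≡⟨ cong (λ z → P ^ L * z * Λ₀ ^ B) (sym (Ω-*ʳ N (Λ ^ L * suc K ^ t) (λ ω → ind (t ≤ᵇ ∑ (λ l → Y l ω))))) ⟩
        P ^ L * ΣΩ N (λ ω → ind (t ≤ᵇ ∑ (λ l → Y l ω)) * (Λ ^ L * suc K ^ t)) * Λ₀ ^ B
          ≤⟨ *-monoˡ-≤ (Λ₀ ^ B) (*-monoʳ-≤ (P ^ L) (Ω-mono N (λ ω → markov (λ l → Y l ω) t (λ l → Y≤C l ω)))) ⟩
        P ^ L * ΣΩ N (λ ω → K ^ t * ∏ (λ l → Λ + Y l ω)) * Λ₀ ^ B
          ≡⟨ cong (λ z → P ^ L * z * Λ₀ ^ B) (Ω-*ˡ N (K ^ t) _) ⟩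
        P ^ L * (K ^ t * ΣΩ N (λ ω → ∏ (λ l → Λ + Y l ω))) * Λ₀ ^ B
          ≡⟨ cong (_* Λ₀ ^ B) (x∙yz≈y∙xz (P ^ L) (K ^ t) _) ⟩
        K ^ t * (P ^ L * ΣΩ N (λ ω → ∏ (λ l → Λ + Y l ω))) * Λ₀ ^ B
          ≤⟨ *-monoˡ-≤ (Λ₀ ^ B) (*-monoʳ-≤ (K ^ t) moment) ⟩
        K ^ t * (M ^ N * ∏ (λ l → P * Λ + h l)) * Λ₀ ^ B
          ≡⟨ e₆ (K ^ t) (M ^ N) _ (Λ₀ ^ B) ⟩
        K ^ t * M ^ N * (∏ (λ l → P * Λ + h l) * Λ₀ ^ B)
          ≤⟨ *-monoʳ-≤ (K ^ t * M ^ N) (moment-bound P B h 0<P ∑h≤) ⟩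
        K ^ t * M ^ N * ((P * Λ) ^ L * Λ ^ B)
          ≡⟨ e₇ (K ^ t) (M ^ N) ((P * Λ) ^ L) (Λ ^ B) ⟩
        (P * Λ) ^ L * (M ^ N * (K ^ t * Λ ^ B)) ∎)

  -- One round of the nibble

  -- In rates, ∏ (1 - κ/M) ≤ 1/(1 + ∑ κ/M): the rational substitute for exp(-∑ κ/M) as a bound for
  -- surviving independent threats.
  ∏-complement : ∀ {L} M (a κ : Fin L → ℕ) → (∀ v → a v + κ v ≡ M) →
    ∏ a * (M + ∑ κ) ≤ M ^ L * M
  ∏-complement {zero} M a κ h = ≤-reflexive (cong₂ _*_ (∏-zero a)
    (trans (cong (M +_) (∑-zero λ ())) (+-identityʳ M)))
  ∏-complement {suc L} M a κ h = begin
    ∏ a * (M + ∑ κ)                       ≡⟨ cong₂ _*_ (∏-suc a) (cong (M +_) (∑-suc κ)) ⟩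
    a₀ * A′ * (M + (κ₀ + K′))             ≡⟨ xy∙z≈y∙xz a₀ A′ (M + (κ₀ + K′)) ⟩
    A′ * (a₀ * (M + (κ₀ + K′)))           ≤⟨ *-monoʳ-≤ A′ shift ⟩
    A′ * (M * (M + K′))                   ≡⟨ x∙yz≈y∙xz A′ M (M + K′) ⟩
    M * (A′ * (M + K′))                   ≤⟨ *-monoʳ-≤ M (∏-complement M (a ∘ suc) (κ ∘ suc) (h ∘ suc)) ⟩
    M * (M ^ L * M)                       ≡⟨ *-assoc M (M ^ L) M ⟨
    M * M ^ L * M                         ∎
    where
    open ≤-Reasoning
    a₀ κ₀ A′ K′ : ℕ
    a₀ = a zero
    κ₀ = κ zero
    A′ = ∏ (λ v → a (suc v))
    K′ = ∑ (λ v → κ (suc v))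
    e₃ : ∀ a k K → (a + k) * ((a + k) + K) ≡ a * ((a + k) + (k + K)) + k * (k + K)
    e₃ = solve-∀
    shift : a₀ * (M + (κ₀ + K′)) ≤ M * (M + K′)
    shift rewrite sym (h zero) = ≤-trans (m≤m+n _ (κ₀ * (κ₀ + K′))) (≤-reflexive (sym (e₃ a₀ κ₀ K′)))

  ind-not : ∀ b → ind (not b) + ind b ≡ 1
  ind-not false = refl
  ind-not true  = refl

  anyᶠ : ∀ {n} → (Fin n → Bool) → Bool
  anyᶠ {zero}  p = false
  anyᶠ {suc n} p = p zero ∨ anyᶠ (p ∘ suc)

  anyᶠ-intro : ∀ {n} (p : Fin n → Bool) i → p i ≡ true → anyᶠ p ≡ true
  anyᶠ-intro p zero    e rewrite e = refl
  anyᶠ-intro p (suc i) e with p zero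
  ... | true  = refl
  ... | false = anyᶠ-intro (p ∘ suc) i e

  anyᶠ-cong : ∀ {n} {p q : Fin n → Bool} → (∀ i → p i ≡ q i) → anyᶠ p ≡ anyᶠ q
  anyᶠ-cong {zero}  h = refl
  anyᶠ-cong {suc n} h = cong₂ _∨_ (h zero) (anyᶠ-cong (h ∘ suc))

  anyᶠ≤∑ : ∀ {n} (p : Fin n → Bool) → ind (anyᶠ p) ≤ ∑ (λ i → ind (p i))
  anyᶠ≤∑ {zero}  p = z≤n
  anyᶠ≤∑ {suc n} p = ≤-trans (ind-∨ (p zero) _)
    (≤-trans (+-monoʳ-≤ (ind (p zero)) (anyᶠ≤∑ (p ∘ suc))) (≤-reflexive (sym (∑-suc (λ i → ind (p i))))))

  ∏-ind-false : ∀ {n} (p : Fin n → Bool) → (∀ i → p i ≡ false) → ∏ (λ i → ind (not (p i))) ≡ 1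
  ∏-ind-false {n} p h = trans (∏-cong (λ i → cong (ind ∘ not) (h i))) (trans (∏-const n 1) (^-zeroˡ n))

  ∏≤1 : ∀ {n} (f : Fin n → ℕ) → (∀ i → f i ≤ 1) → ∏ f ≤ 1
  ∏≤1 {n} f h = ≤-trans (∏-mono h) (≤-reflexive (trans (∏-const n 1) (^-zeroˡ n)))

  -- `lab t` names the classes inside which conflicts of kind `t` stay. `spread` is the crosswise
  -- condition: a pair has at most `C` conflicts of kind `t` with each class of the other labelling.
  -- `degree≤n` is what bounds the dependencies in the local lemma.
  record Board (W n C : ℕ) : Set where
    field
      cf       : Bool → Fin W → Fin n → Fin W → Fin n → Bool
      cf-sym   : ∀ t w x w′ x′ → cf t w x w′ x′ ≡ cf t w′ x′ w x
      cf-irr   : ∀ t w x x′ → cf t w x w x′ ≡ false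
      L        : Bool → ℕ
      lab      : ∀ t → Fin W → Fin (L t)
      lab-cf   : ∀ t {w x w′ x′} → cf t w x w′ x′ ≡ true → lab t w ≡ lab t w′
      spread   : ∀ t w x l → ∑ (λ w′ → ind (lab (not t) w′ == l) * ∑ (λ x′ → ind (cf t w x w′ x′))) ≤ C
      degree≤n : ∀ t w x → ∑ (λ w′ → ∑ (λ x′ → ind (cf t w x w′ x′))) ≤ n

  -- Every list is either empty, as for settled groups, or of size exactly ℓ; this is what `list≤ℓ`
  -- and `ℓ≤list` say together.
  module Round {W n C : ℕ} (𝔹 : Board W n C) (R D ℓ : ℕ)
    (alive : Fin W → Fin n → Bool)
    (list≤ℓ : ∀ w → ∑ (λ x → ind (alive w x)) ≤ ℓ)
    (ℓ≤list : ∀ w x → alive w x ≡ true → ℓ ≤ ∑ (λ x′ → ind (alive w x′)))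
    (degs≤D : ∀ t w x → ∑ (λ w′ → ∑ (λ x′ → ind (Board.cf 𝔹 t w x w′ x′ ∧ alive w′ x′))) ≤ D)
    (2D≤M : 2 * D ≤ n + R)
    where

    open Board 𝔹

    M N : ℕ
    M = n + R
    N = W * suc n

    Ω : Set
    Ω = Vec (Fin M) N

    group : Fin N → Fin W
    group v = proj₁ (remQuot (suc n) v)

    slot : Fin N → Fin (suc n)
    slot v = proj₂ (remQuot {W} (suc n) v)

    selector : Fin W → Fin N
    selector w = combine w zero

    ∑-variables : (F : Fin W → Fin (suc n) → ℕ) →
      ∑ (λ v → F (group v) (slot v)) ≡ ∑ (λ w → F w zero) + ∑ (λ w → ∑ (λ y → F w (suc y)))
    ∑-variables F = begin
      ∑ (λ v → F (group v) (slot v))                  ≡⟨ ∑-combine W _ ⟩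
      ∑ (λ w → ∑ (λ z → F (group (combine w z)) (slot (combine w z))))
        ≡⟨ ∑-cong (λ w → ∑-cong (λ z → cong (λ p → F (proj₁ p) (proj₂ p)) (Fin.remQuot-combine {W} w z))) ⟩
      ∑ (λ w → ∑ (λ z → F w z))                       ≡⟨ ∑-cong (λ w → ∑-suc (F w)) ⟩
      ∑ (λ w → F w zero + ∑ (λ y → F w (suc y)))      ≡⟨ ∑-+ _ _ ⟩
      ∑ (λ w → F w zero) + ∑ (λ w → ∑ (λ y → F w (suc y))) ∎
      where open ≡-Reasoning

    -- The `R` surplus values leave a group idle, which frees the pick rate 1/M from the number of
    -- vertices.
    pick : (Fin n → Bool) → Fin M → Bool
    pick p val = [ p , const false ]′ (splitAt n val)

    ∑-pick : (p : Fin n → Bool) → ∑ (λ val → ind (pick p val)) ≡ ∑ (λ x → ind (p x))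
    ∑-pick p = begin
      ∑ (λ val → ind (pick p val)) ≡⟨ ∑-split n _ ⟩
      ∑ (λ x → ind (pick p (x ↑ˡ R))) + ∑ (λ r → ind (pick p (n ↑ʳ r)))
        ≡⟨ cong₂ _+_ (∑-cong (λ x → cong (ind ∘ [ p , const false ]′) (Fin.splitAt-↑ˡ n x R)))
                     (∑-zero (λ r → cong (ind ∘ [ p , const false ]′) (Fin.splitAt-↑ʳ n R r))) ⟩
      ∑ (λ x → ind (p x)) + 0 ≡⟨ +-identityʳ _ ⟩
      ∑ (λ x → ind (p x)) ∎
      where open ≡-Reasoning

    picked : ∀ {p} val → pick p val ≡ true → ∃ λ x → p x ≡ true × (∀ q → pick q val ≡ q x)
    picked val e with splitAt n val
    ... | inj₁ x = x , e , λ q → refl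

    pick-∑-swap : ∀ {m} (p : Fin m → Fin n → Bool) val c →
      (∀ x → ∑ (λ i → ind (p i x)) ≤ c) → ∑ (λ i → ind (pick (p i) val)) ≤ c
    pick-∑-swap p val c h with splitAt n val
    ... | inj₁ x = h x
    ... | inj₂ r = ≤-trans (≤-reflexive (∑-zero (λ _ → refl))) z≤n

    pick-false : ∀ {p} val → (∀ x → p x ≡ false) → pick p val ≡ false
    pick-false val h with splitAt n val
    ... | inj₁ x = h x
    ... | inj₂ r = refl

    pick-cong : ∀ {p q} val → (∀ x → p x ≡ q x) → pick p val ≡ pick q val
    pick-cong val h with splitAt n val
    ... | inj₁ x = h x
    ... | inj₂ r = refl

    conflict : Fin W → Fin n → Fin W → Fin n → Bool
    conflict w′ x′ w x = cf true w′ x′ w x ∨ cf false w′ x′ w x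

    degs : Bool → Fin W → Fin n → ℕ
    degs t w x = ∑ (λ w′ → ∑ (λ x′ → ind (cf t w x w′ x′ ∧ alive w′ x′)))

    -- The coin of (w , x) tops up the number of threats against it to exactly 2 D.
    coin : Fin W → Fin n → ℕ
    coin w x = 2 * D ∸ (degs true w x + degs false w x)

    degs≤2D : ∀ w x → degs true w x + degs false w x ≤ 2 * D
    degs≤2D w x = ≤-trans (+-mono-≤ (degs≤D true w x) (degs≤D false w x))
      (≤-reflexive (cong (D +_) (sym (+-identityʳ D))))

    coinHit : Fin W → Fin n → Fin M → Fin W → Fin n → Bool
    coinHit w′ y val w x = (w′ == w) ∧ ((y == x) ∧ (toℕ val <ᵇ coin w x))

    hit : Fin W → Fin (suc n) → Fin M → Fin W → Fin n → Bool
    hit w′ zero    val w x = pick (λ x′ → alive w′ x′ ∧ conflict w′ x′ w x) val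
    hit w′ (suc y) val w x = coinHit w′ y val w x

    -- The group's own pick counts as a threat even if it is going to be rejected: rejection depends
    -- on earlier variables from other classes and would destroy the independence between labels.
    -- Rejected picks are charged separately to `failStat`.
    kill : Bool → Fin W → Fin (suc n) → Fin M → Fin W → Fin n → Bool
    kill t w′ zero    val w x = pick (λ x′ → alive w′ x′ ∧ ((w′ == w) ∨ cf (not t) w′ x′ w x)) val
    kill t w′ (suc y) val w x = coinHit w′ y val w x

    ∑-coinHit : ∀ w x → ∑ (λ w′ → ∑ (λ y → ∑ (λ val → ind (coinHit w′ y val w x)))) ≡ coin w x
    ∑-coinHit w x = begin
      ∑ (λ w′ → ∑ (λ y → ∑ (λ val → ind (coinHit w′ y val w x))))
        ≡⟨ ∑-cong (λ w′ → ∑-cong (λ y → ∑-cong (λ val → expand w′ y val))) ⟩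
      ∑ (λ w′ → ∑ (λ y → ∑ (λ val → ind (w == w′) * (ind (x == y) * ind (toℕ val <ᵇ coin w x)))))
        ≡⟨ ∑-cong (λ w′ → ∑-cong (λ y → ∑-*ˡ (ind (w == w′)) _)) ⟩
      ∑ (λ w′ → ∑ (λ y → ind (w == w′) * ∑ (λ val → ind (x == y) * ind (toℕ val <ᵇ coin w x))))
        ≡⟨ ∑-cong (λ w′ → ∑-*ˡ (ind (w == w′)) _) ⟩
      ∑ (λ w′ → ind (w == w′) * ∑ (λ y → ∑ (λ val → ind (x == y) * ind (toℕ val <ᵇ coin w x))))
        ≡⟨ ∑-delta w _ ⟩
      ∑ (λ y → ∑ (λ val → ind (x == y) * ind (toℕ val <ᵇ coin w x)))
        ≡⟨ ∑-cong (λ y → ∑-*ˡ (ind (x == y)) _) ⟩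
      ∑ (λ y → ind (x == y) * ∑ (λ val → ind (toℕ val <ᵇ coin w x)))
        ≡⟨ ∑-delta x _ ⟩
      ∑ {M} (λ val → ind (toℕ val <ᵇ coin w x))
        ≡⟨ ∑-below M (coin w x) (≤-trans (m∸n≤m (2 * D) (degs true w x + degs false w x)) 2D≤M) ⟩
      coin w x ∎
      where
      open ≡-Reasoning
      expand : ∀ w′ y val → ind (coinHit w′ y val w x) ≡ ind (w == w′) * (ind (x == y) * ind (toℕ val <ᵇ coin w x))
      expand w′ y val = trans (ind-∧ (w′ == w) _) (cong₂ _*_ (cong ind (==-sym w′ w))
        (trans (ind-∧ (y == x) _) (cong (_* ind (toℕ val <ᵇ coin w x)) (cong ind (==-sym y x)))))

    alive∧cf≤ : ∀ t w x w′ x′ → ind (alive w′ x′ ∧ cf t w′ x′ w x) ≡ ind (cf t w x w′ x′ ∧ alive w′ x′)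
    alive∧cf≤ t w x w′ x′ = trans (ind-∧ (alive w′ x′) _) (trans (*-comm (ind (alive w′ x′)) _)
      (trans (cong (_* ind (alive w′ x′)) (cong ind (cf-sym t w′ x′ w x))) (sym (ind-∧ (cf t w x w′ x′) _))))

    ∑-hit : ∀ w x → ∑ (λ v → ∑ (λ val → ind (hit (group v) (slot v) val w x))) ≤ 2 * D
    ∑-hit w x = begin
      ∑ (λ v → ∑ (λ val → ind (hit (group v) (slot v) val w x)))
        ≡⟨ ∑-variables (λ w′ z → ∑ (λ val → ind (hit w′ z val w x))) ⟩
      ∑ (λ w′ → ∑ (λ val → ind (pick (λ x′ → alive w′ x′ ∧ conflict w′ x′ w x) val)))
        + ∑ (λ w′ → ∑ (λ y → ∑ (λ val → ind (coinHit w′ y val w x))))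
        ≡⟨ cong₂ _+_ (∑-cong (λ w′ → ∑-pick _)) (∑-coinHit w x) ⟩
      ∑ (λ w′ → ∑ (λ x′ → ind (alive w′ x′ ∧ conflict w′ x′ w x))) + coin w x
        ≤⟨ +-monoˡ-≤ (coin w x) (∑-mono (λ w′ → ∑-mono (λ x′ → both w′ x′))) ⟩
      ∑ (λ w′ → ∑ (λ x′ → ind (cf true w x w′ x′ ∧ alive w′ x′) + ind (cf false w x w′ x′ ∧ alive w′ x′))) + coin w x
        ≡⟨ cong (_+ coin w x) (trans (∑-cong (λ w′ → ∑-+ _ _)) (∑-+ _ _)) ⟩
      degs true w x + degs false w x + coin w x
        ≡⟨ m+[n∸m]≡n (degs≤2D w x) ⟩
      2 * D ∎
      where
      open ≤-Reasoning
      distrib : ∀ a b c → ind (a ∧ (b ∨ c)) ≤ ind (a ∧ b) + ind (a ∧ c)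
      distrib false b c = z≤n
      distrib true  b c = ind-∨ b c
      both : ∀ w′ x′ → ind (alive w′ x′ ∧ conflict w′ x′ w x)
        ≤ ind (cf true w x w′ x′ ∧ alive w′ x′) + ind (cf false w x w′ x′ ∧ alive w′ x′)
      both w′ x′ = ≤-trans (distrib (alive w′ x′) (cf true w′ x′ w x) (cf false w′ x′ w x))
        (≤-reflexive (cong₂ _+_ (alive∧cf≤ true w x w′ x′) (alive∧cf≤ false w x w′ x′)))

    -- The own list contributes ℓ. The conflicts of both kinds and the coin add up to 2 D, of which
    -- the discarded kind takes at most D, so at least D is left however small the actual degrees
    -- are.
    ∑-kill : ∀ t w x → alive w x ≡ true → ℓ + D ≤ ∑ (λ v → ∑ (λ val → ind (kill t (group v) (slot v) val w x)))
    ∑-kill t w x aw = begin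
      ℓ + D ≤⟨ +-mono-≤ (ℓ≤list w x aw) D≤ ⟩
      ∑ (λ x′ → ind (alive w x′)) + (degs (not t) w x + coin w x)
        ≡⟨ +-assoc _ (degs (not t) w x) (coin w x) ⟨
      ∑ (λ x′ → ind (alive w x′)) + degs (not t) w x + coin w x
        ≡⟨ cong (λ z → z + degs (not t) w x + coin w x) (∑-delta w (λ w′ → ∑ (λ x′ → ind (alive w′ x′)))) ⟨
      ∑ (λ w′ → ind (w == w′) * ∑ (λ x′ → ind (alive w′ x′))) + degs (not t) w x + coin w x
        ≡⟨ cong (_+ coin w x) (trans (cong (_+ degs (not t) w x) (∑-cong (λ w′ → sym (∑-*ˡ (ind (w == w′)) _)))) (sym (trans (∑-cong (λ w′ → ∑-+ _ _)) (∑-+ _ _)))) ⟩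
      ∑ (λ w′ → ∑ (λ x′ → ind (w == w′) * ind (alive w′ x′) + ind (cf (not t) w x w′ x′ ∧ alive w′ x′))) + coin w x
        ≤⟨ +-monoˡ-≤ (coin w x) (∑-mono (λ w′ → ∑-mono (λ x′ → both w′ x′))) ⟩
      ∑ (λ w′ → ∑ (λ x′ → ind (alive w′ x′ ∧ ((w′ == w) ∨ cf (not t) w′ x′ w x)))) + coin w x
        ≡⟨ cong₂ _+_ (∑-cong (λ w′ → ∑-pick _)) (∑-coinHit w x) ⟨
      ∑ (λ w′ → ∑ (λ val → ind (pick (λ x′ → alive w′ x′ ∧ ((w′ == w) ∨ cf (not t) w′ x′ w x)) val)))
        + ∑ (λ w′ → ∑ (λ y → ∑ (λ val → ind (coinHit w′ y val w x))))
        ≡⟨ ∑-variables (λ w′ z → ∑ (λ val → ind (kill t w′ z val w x))) ⟨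
      ∑ (λ v → ∑ (λ val → ind (kill t (group v) (slot v) val w x))) ∎
      where
      open ≤-Reasoning
      cancel : ∀ a b c → a + b + c ≡ 2 * D → a ≤ D → D ≤ b + c
      cancel a b c e a≤D = +-cancelˡ-≤ D _ _ (≤-trans (≤-reflexive (trans (cong (D +_) (sym (+-identityʳ D))) (sym e)))
        (≤-trans (≤-reflexive (+-assoc a b c)) (+-monoˡ-≤ (b + c) a≤D)))
      total : degs true w x + degs false w x + coin w x ≡ 2 * D
      total = m+[n∸m]≡n (degs≤2D w x)
      D≤ : D ≤ degs (not t) w x + coin w x
      D≤ = go t
        where
        go : ∀ t → D ≤ degs (not t) w x + coin w x
        go true  = cancel (degs true w x) (degs false w x) (coin w x) total (degs≤D true w x)
        go false = cancel (degs false w x) (degs true w x) (coin w x)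
          (trans (cong (_+ coin w x) (+-comm (degs false w x) _)) total) (degs≤D false w x)
      or : ∀ a b c → (b ≡ true → c ≡ false) → ind b * ind a + ind (a ∧ c) ≤ ind (a ∧ (b ∨ c))
      or false false c h = z≤n
      or false true  c h = z≤n
      or true  false c h = ≤-refl
      or true  true  c h rewrite h refl = ≤-refl
      irr : ∀ w′ x′ → (w == w′) ≡ true → cf (not t) w′ x′ w x ≡ false
      irr w′ x′ e with refl ← ==⇒≡ w w′ e = cf-irr (not t) w x′ x
      both : ∀ w′ x′ → ind (w == w′) * ind (alive w′ x′) + ind (cf (not t) w x w′ x′ ∧ alive w′ x′)
        ≤ ind (alive w′ x′ ∧ ((w′ == w) ∨ cf (not t) w′ x′ w x))
      both w′ x′ = ≤-trans (≤-reflexive (cong (ind (w == w′) * ind (alive w′ x′) +_) (sym (alive∧cf≤ (not t) w x w′ x′))))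
        (subst (λ b → ind (w == w′) * ind (alive w′ x′) + ind (alive w′ x′ ∧ cf (not t) w′ x′ w x)
                    ≤ ind (alive w′ x′ ∧ (b ∨ cf (not t) w′ x′ w x))) (==-sym w w′)
          (or (alive w′ x′) (w == w′) (cf (not t) w′ x′ w x) (irr w′ x′)))

    spread₁ : ∀ t w x w′ → ∑ (λ x′ → ind (cf t w x w′ x′)) ≤ C
    spread₁ t w x w′ = ≤-trans (≤-reflexive (sym (trans (cong (λ b → ind b * ∑ (λ x′ → ind (cf t w x w′ x′)))
        (==-refl (lab (not t) w′))) (*-identityˡ _))))
      (≤-trans (∑-term (λ w″ → ind (lab (not t) w″ == lab (not t) w′) * ∑ (λ x′ → ind (cf t w x w″ x′))) w′)
               (spread t w x (lab (not t) w′)))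

  -- Three statistics of a round (hits on a list, failed picks, survivors) and their tails.

  module RoundStatistics {W n C : ℕ} (𝔹 : Board W n C) (R D ℓ : ℕ)
    (alive : Fin W → Fin n → Bool)
    (list≤ℓ : ∀ w → ∑ (λ x → ind (alive w x)) ≤ ℓ)
    (ℓ≤list : ∀ w x → alive w x ≡ true → ℓ ≤ ∑ (λ x′ → ind (alive w x′)))
    (degs≤D : ∀ t w x → ∑ (λ w′ → ∑ (λ x′ → ind (Board.cf 𝔹 t w x w′ x′ ∧ alive w′ x′))) ≤ D)
    (2D≤M : 2 * D ≤ n + R) (1≤C : 1 ≤ C)
    (J s A S F : ℕ) (0<J : 0 < J) (0<n : 0 < n)
    (A-mean : ℓ * (2 * D) ≤ (n + R) * A) (A≤ : A ≤ J * s)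
    (S-mean : (n + R) * D ≤ (n + R + (ℓ + D)) * S) (S≤ : S ≤ J * s)
    (F-mean : D * (A + 2 * s) ≤ (n + R) * F) (F≤ : F ≤ J * s)
    where

    open Board 𝔹
    open Round 𝔹 R D ℓ alive list≤ℓ ℓ≤list degs≤D 2D≤M public
    open TailBound (2 * C) J public

    0<M : 0 < M
    0<M = ≤-trans 0<n (m≤m+n n R)

    tA tS tF : ℕ
    tA = A + 2 * s
    tS = S + 2 * s
    tF = F + 2 * s

    C≤2C : C ≤ 2 * C
    C≤2C = m≤m+n C _

    listHits : Fin W → Fin N → Fin M → ℕ
    listHits w v val = ∑ (λ x → ind (alive w x ∧ hit (group v) (slot v) val w x))

    hitStat : Fin W → Fin N → Ω → ℕ
    hitStat w v ω = listHits w v (lookup ω v)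

    ind-∧ʳ : ∀ a b → ind (a ∧ b) ≤ ind b
    ind-∧ʳ false b = z≤n
    ind-∧ʳ true  b = ≤-refl

    ind-∧ˡ : ∀ a b → ind (a ∧ b) ≤ ind a
    ind-∧ˡ false b = z≤n
    ind-∧ˡ true  b = ind≤1 b

    hits-on-list≤ : ∀ w′ z val w → ∑ (λ x → ind (hit w′ z val w x)) ≤ 2 * C
    hits-on-list≤ w′ zero val w = pick-∑-swap (λ x x′ → alive w′ x′ ∧ conflict w′ x′ w x) val (2 * C) (λ x′ → begin
      ∑ (λ x → ind (alive w′ x′ ∧ conflict w′ x′ w x))
        ≤⟨ ∑-mono (λ x → ≤-trans (ind-∧ʳ (alive w′ x′) _) (ind-∨ (cf true w′ x′ w x) _)) ⟩
      ∑ (λ x → ind (cf true w′ x′ w x) + ind (cf false w′ x′ w x)) ≡⟨ ∑-+ _ _ ⟩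
      ∑ (λ x → ind (cf true w′ x′ w x)) + ∑ (λ x → ind (cf false w′ x′ w x))
        ≤⟨ +-mono-≤ (spread₁ true w′ x′ w) (spread₁ false w′ x′ w) ⟩
      C + C ≡⟨ cong (C +_) (+-identityʳ C) ⟨
      2 * C ∎)
      where open ≤-Reasoning
    hits-on-list≤ w′ (suc y) val w = begin
      ∑ (λ x → ind (coinHit w′ y val w x))
        ≤⟨ ∑-mono (λ x → ≤-trans (ind-∧ʳ (w′ == w) _) (ind-∧ˡ (y == x) _)) ⟩
      ∑ (λ x → ind (y == x))     ≡⟨ ∑-cong (λ x → sym (*-identityʳ _)) ⟩
      ∑ (λ x → ind (y == x) * 1) ≡⟨ ∑-delta y (λ _ → 1) ⟩
      1                          ≤⟨ 1≤C ⟩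
      C                          ≤⟨ C≤2C ⟩
      2 * C                      ∎
      where open ≤-Reasoning

    listHits≤ : ∀ w v val → listHits w v val ≤ 2 * C
    listHits≤ w v val = ≤-trans (∑-mono (λ x → ind-∧ʳ (alive w x) _)) (hits-on-list≤ (group v) (slot v) val w)

    ∑-listHits : ∀ w → ∑ (λ v → ∑ (λ val → listHits w v val)) ≤ M * A
    ∑-listHits w = begin
      ∑ (λ v → ∑ (λ val → ∑ (λ x → ind (alive w x ∧ hit (group v) (slot v) val w x))))
        ≡⟨ ∑-cong (λ v → ∑-cong (λ val → ∑-cong (λ x → ind-∧ (alive w x) _))) ⟩
      ∑ (λ v → ∑ (λ val → ∑ (λ x → ind (alive w x) * ind (hit (group v) (slot v) val w x))))
        ≡⟨ ∑-cong (λ v → ∑-swap _) ⟩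
      ∑ (λ v → ∑ (λ x → ∑ (λ val → ind (alive w x) * ind (hit (group v) (slot v) val w x))))
        ≡⟨ ∑-cong (λ v → ∑-cong (λ x → ∑-*ˡ (ind (alive w x)) _)) ⟩
      ∑ (λ v → ∑ (λ x → ind (alive w x) * ∑ (λ val → ind (hit (group v) (slot v) val w x))))
        ≡⟨ ∑-swap _ ⟩
      ∑ (λ x → ∑ (λ v → ind (alive w x) * ∑ (λ val → ind (hit (group v) (slot v) val w x))))
        ≡⟨ ∑-cong (λ x → ∑-*ˡ (ind (alive w x)) _) ⟩
      ∑ (λ x → ind (alive w x) * ∑ (λ v → ∑ (λ val → ind (hit (group v) (slot v) val w x))))
        ≤⟨ ∑-mono (λ x → *-monoʳ-≤ (ind (alive w x)) (∑-hit w x)) ⟩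
      ∑ (λ x → ind (alive w x) * (2 * D)) ≡⟨ ∑-*ʳ (2 * D) _ ⟩
      ∑ (λ x → ind (alive w x)) * (2 * D) ≤⟨ *-monoˡ-≤ (2 * D) (list≤ℓ w) ⟩
      ℓ * (2 * D)                         ≤⟨ A-mean ⟩
      M * A                               ∎
      where open ≤-Reasoning

    adapted-tail : ∀ (Y : Fin N → Ω → ℕ) (h : Fin N → ℕ) B → Adapted Y →
      (∀ v ω → ∑ (λ val → Y v (ω [ v ]≔ val)) ≤ h v) → (∀ v ω → Y v ω ≤ 2 * C) →
      ∑ h ≤ M * B → B ≤ J * s →
      ΣΩ N (λ ω → ind ((B + 2 * s) ≤ᵇ ∑ (λ v → Y v ω))) * suc K ^ s ≤ M ^ N * K ^ s
    adapted-tail Y h B ad cond Y≤ ∑h≤ B≤ = tail Y M B s h Y≤ 0<M 0<J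
      (*-monoʳ-≤ (M ^ N) (Ω-Π-adapted N Λ Y h ad cond)) ∑h≤ B≤

    hit-tail : ∀ w → ΣΩ N (λ ω → ind (tA ≤ᵇ ∑ (λ v → hitStat w v ω))) * suc K ^ s ≤ M ^ N * K ^ s
    hit-tail w = adapted-tail (hitStat w) (λ v → ∑ (listHits w v)) A
      (λ v ω ω′ e → cong (listHits w v) (e v ≤-refl))
      (λ v ω → ≤-reflexive (∑-cong (λ val → cong (listHits w v) (lookup∘update v ω val))))
      (λ v ω → listHits≤ w v (lookup ω v)) (∑-listHits w) A≤

    early : Fin N → Ω → Fin W → Fin n → Bool
    early v ω w x = anyᶠ (λ u → (toℕ u <ᵇ toℕ v) ∧ hit (group u) (slot u) (lookup ω u) w x)

    doomed : Fin W → Fin N → Ω → Fin n → Bool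
    doomed w v ω x = alive w x ∧ early v ω w x

    family : Bool → Fin W → Fin n → Fin W → Fin n → Bool
    family t w₀ x₀ w x = cf t w₀ x₀ w x ∧ alive w x

    weight : Bool → Fin W → Fin n → Fin W → ℕ
    weight t w₀ x₀ w = ∑ (λ x → ind (family t w₀ x₀ w x))

    weight≤C : ∀ t w₀ x₀ w → weight t w₀ x₀ w ≤ C
    weight≤C t w₀ x₀ w = ≤-trans (∑-mono (λ x → ind-∧ˡ (cf t w₀ x₀ w x) _)) (spread₁ t w₀ x₀ w)

    onSelector : Fin (suc n) → ℕ
    onSelector zero    = 1
    onSelector (suc _) = 0

    onSelector≤1 : ∀ z → onSelector z ≤ 1
    onSelector≤1 zero    = ≤-refl
    onSelector≤1 (suc _) = z≤n

    -- The truncation at tA makes the conditional failure probability bounded surely.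
    failure : Fin W → Fin N → Ω → ℕ
    failure w v ω = ind (pick (doomed w v ω) (lookup ω v) ∧ (∑ (λ x → ind (doomed w v ω x)) <ᵇ tA))

    failStat : Bool → Fin W → Fin n → Fin N → Ω → ℕ
    failStat t w₀ x₀ v ω = onSelector (slot v) * (weight t w₀ x₀ (group v) * failure (group v) v ω)

    early-cong : ∀ v ω ω′ w x → (∀ u → toℕ u < toℕ v → lookup ω u ≡ lookup ω′ u) → early v ω w x ≡ early v ω′ w x
    early-cong v ω ω′ w x e = anyᶠ-cong same
      where
      same : ∀ u → (toℕ u <ᵇ toℕ v) ∧ hit (group u) (slot u) (lookup ω u) w x
                 ≡ (toℕ u <ᵇ toℕ v) ∧ hit (group u) (slot u) (lookup ω′ u) w x
      same u with toℕ u <ᵇ toℕ v in eq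
      ... | false = refl
      ... | true  = cong (λ val → hit (group u) (slot u) val w x) (e u (<ᵇ⇒< _ _ (subst T (sym eq) _)))

    failure-cong : ∀ w v ω ω′ → (∀ x → early v ω w x ≡ early v ω′ w x) → lookup ω v ≡ lookup ω′ v →
      failure w v ω ≡ failure w v ω′
    failure-cong w v ω ω′ e eq = cong₂ (λ a b → ind (a ∧ (b <ᵇ tA)))
      (trans (cong (pick (doomed w v ω)) eq) (pick-cong (lookup ω′ v) (λ x → cong (alive w x ∧_) (e x))))
      (∑-cong (λ x → cong (λ b → ind (alive w x ∧ b)) (e x)))

    -- The doomed vertices are determined by earlier variables, so resampling `v` leaves them fixed,
    -- and only picks among them count.
    ∑-failure : ∀ w v ω → ∑ (λ val → failure w v (ω [ v ]≔ val)) ≤ tA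
    ∑-failure w v ω = begin
      ∑ (λ val → failure w v (ω [ v ]≔ val))
        ≡⟨ ∑-cong (λ val → cong₂ (λ a b → ind (a ∧ (b <ᵇ tA)))
             (trans (cong (pick (doomed w v (ω [ v ]≔ val))) (lookup∘update v ω val)) (pick-cong val (λ x → cong (alive w x ∧_) (same val x))))
             (∑-cong (λ x → cong (λ b → ind (alive w x ∧ b)) (same val x)))) ⟩
      ∑ (λ val → ind (pick (doomed w v ω) val ∧ (c <ᵇ tA)))
        ≡⟨ ∑-cong (λ val → ind-∧ (pick (doomed w v ω) val) _) ⟩
      ∑ (λ val → ind (pick (doomed w v ω) val) * ind (c <ᵇ tA)) ≡⟨ ∑-*ʳ (ind (c <ᵇ tA)) _ ⟩
      ∑ (λ val → ind (pick (doomed w v ω) val)) * ind (c <ᵇ tA) ≡⟨ cong (_* ind (c <ᵇ tA)) (∑-pick (doomed w v ω)) ⟩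
      c * ind (c <ᵇ tA)                                         ≤⟨ truncated ⟩
      tA                                                        ∎
      where
      open ≤-Reasoning
      c : ℕ
      c = ∑ (λ x → ind (doomed w v ω x))
      same : ∀ val x → early v (ω [ v ]≔ val) w x ≡ early v ω w x
      same val x = early-cong v (ω [ v ]≔ val) ω w x
        (λ u u<v → lookup∘update′ (λ u≡v → <-irrefl (cong toℕ u≡v) u<v) ω val)
      truncated : c * ind (c <ᵇ tA) ≤ tA
      truncated with c <ᵇ tA in eq
      ... | true  = ≤-trans (≤-reflexive (*-identityʳ c)) (<⇒≤ (<ᵇ⇒< c tA (subst T (sym eq) _)))
      ... | false = ≤-trans (≤-reflexive (*-zeroʳ c)) z≤n

    fail-tail : ∀ t w₀ x₀ → ΣΩ N (λ ω → ind (tF ≤ᵇ ∑ (λ v → failStat t w₀ x₀ v ω))) * suc K ^ s ≤ M ^ N * K ^ s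
    fail-tail t w₀ x₀ = adapted-tail (failStat t w₀ x₀) h F adapted cond bounded ∑h≤ F≤
      where
      h : Fin N → ℕ
      h v = onSelector (slot v) * (weight t w₀ x₀ (group v) * tA)
      adapted : Adapted (failStat t w₀ x₀)
      adapted v ω ω′ e = cong (λ z → onSelector (slot v) * (weight t w₀ x₀ (group v) * z))
        (failure-cong (group v) v ω ω′ (λ x → early-cong v ω ω′ (group v) x (λ u u<v → e u (<⇒≤ u<v))) (e v ≤-refl))
      cond : ∀ v ω → ∑ (λ val → failStat t w₀ x₀ v (ω [ v ]≔ val)) ≤ h v
      cond v ω = ≤-trans (≤-reflexive (trans (∑-*ˡ (onSelector (slot v)) _)
          (cong (onSelector (slot v) *_) (∑-*ˡ (weight t w₀ x₀ (group v)) _))))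
        (*-monoʳ-≤ (onSelector (slot v)) (*-monoʳ-≤ (weight t w₀ x₀ (group v)) (∑-failure (group v) v ω)))
      bounded : ∀ v ω → failStat t w₀ x₀ v ω ≤ 2 * C
      bounded v ω = ≤-trans (*-mono-≤ (onSelector≤1 (slot v)) (*-mono-≤ (weight≤C t w₀ x₀ (group v)) (ind≤1 _)))
        (≤-trans (≤-reflexive (trans (*-identityˡ _) (*-identityʳ C))) C≤2C)
      ∑h≤ : ∑ h ≤ M * F
      ∑h≤ = begin
        ∑ h ≡⟨ ∑-variables (λ w z → onSelector z * (weight t w₀ x₀ w * tA)) ⟩
        ∑ (λ w → 1 * (weight t w₀ x₀ w * tA)) + ∑ (λ w → ∑ (λ (y : Fin n) → 0 * (weight t w₀ x₀ w * tA)))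
          ≡⟨ cong₂ _+_ (∑-cong (λ w → *-identityˡ _)) (∑-zero (λ w → ∑-zero (λ y → refl))) ⟩
        ∑ (λ w → weight t w₀ x₀ w * tA) + 0 ≡⟨ +-identityʳ _ ⟩
        ∑ (λ w → weight t w₀ x₀ w * tA)     ≡⟨ ∑-*ʳ tA _ ⟩
        degs t w₀ x₀ * tA                   ≤⟨ *-monoˡ-≤ tA (degs≤D t w₀ x₀) ⟩
        D * tA                              ≤⟨ F-mean ⟩
        M * F                               ∎
        where open ≤-Reasoning

    -- Of the threats only those of kind not t are counted: against different labels they are disjoint sets of variables.
    surv : Bool → Fin W → Fin n → Ω → ℕ
    surv t w x ω = ∏ (λ v → ind (not (kill t (group v) (slot v) (lookup ω v) w x)))

    -- Collecting the neighbours by classes of the other labelling gives summands that are bounded,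
    -- by `spread`, and independent.
    survStat : (t : Bool) → Fin W → Fin n → Fin (L (not t)) → Ω → ℕ
    survStat t w₀ x₀ l ω = ∑ (λ w → ind (lab (not t) w == l) * ∑ (λ x → ind (family t w₀ x₀ w x) * surv t w x ω))

    survStat≤ : ∀ t w₀ x₀ l ω → survStat t w₀ x₀ l ω ≤ 2 * C
    survStat≤ t w₀ x₀ l ω = ≤-trans (∑-mono (λ w → *-monoʳ-≤ (ind (lab (not t) w == l)) (∑-mono (λ x →
        ≤-trans (*-mono-≤ (ind-∧ˡ (cf t w₀ x₀ w x) _) (∏≤1 _ (λ v → ind≤1 _))) (≤-reflexive (*-identityʳ _))))))
      (≤-trans (spread t w₀ x₀ l) C≤2C)

    kill-label : ∀ t w′ z val w x → lab (not t) w′ ≢ lab (not t) w → kill t w′ z val w x ≡ false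
    kill-label t w′ zero val w x ≢l = pick-false val λ x′ → none x′
      where
      none : ∀ x′ → alive w′ x′ ∧ ((w′ == w) ∨ cf (not t) w′ x′ w x) ≡ false
      none x′ with alive w′ x′
      ... | false = refl
      ... | true with w′ == w in eq
      ...   | true  = ⊥-elim (≢l (cong (lab (not t)) (==⇒≡ w′ w eq)))
      ...   | false with cf (not t) w′ x′ w x in eq′
      ...     | true  = ⊥-elim (≢l (lab-cf (not t) eq′))
      ...     | false = refl
    kill-label t w′ (suc y) val w x ≢l with w′ == w in eq
    ... | true  = ⊥-elim (≢l (cong (lab (not t)) (==⇒≡ w′ w eq)))
    ... | false = refl

    ΣΩ-surv : ∀ t w x → alive w x ≡ true → ΣΩ N (surv t w x) * (M + (ℓ + D)) ≤ M ^ N * M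
    ΣΩ-surv t w x aw = begin
      ΣΩ N (surv t w x) * (M + (ℓ + D))
        ≡⟨ cong (_* (M + (ℓ + D))) (Ω-Π N (λ v val → ind (not (kill t (group v) (slot v) val w x)))) ⟩
      ∏ (λ v → ∑ (λ val → ind (not (kill t (group v) (slot v) val w x)))) * (M + (ℓ + D))
        ≤⟨ *-monoʳ-≤ (∏ (λ v → ∑ (λ val → ind (not (kill t (group v) (slot v) val w x))))) (+-monoʳ-≤ M (∑-kill t w x aw)) ⟩
      ∏ (λ v → ∑ (λ val → ind (not (kill t (group v) (slot v) val w x))))
        * (M + ∑ (λ v → ∑ (λ val → ind (kill t (group v) (slot v) val w x))))
        ≤⟨ ∏-complement M _ _ (λ v → trans (sym (∑-+ _ _)) (trans (∑-cong (λ val → ind-not (kill t (group v) (slot v) val w x))) (trans (∑-const M 1) (*-identityʳ M)))) ⟩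
      M ^ N * M ∎
      where open ≤-Reasoning

    -- The variables are divided into blocks by the other label of their group, and `kill-label`
    -- confines the summand of `l` to its block. The scale `P` is the denominator of the survival
    -- bound M/(M + ℓ + D), so that the bounds `h` for the means stay integral.
    surv-tail : ∀ t w₀ x₀ → ΣΩ N (λ ω → ind (tS ≤ᵇ ∑ (λ l → survStat t w₀ x₀ l ω))) * suc K ^ s ≤ M ^ N * K ^ s
    surv-tail t w₀ x₀ = tail (survStat t w₀ x₀) P S s h (survStat≤ t w₀ x₀) (≤-trans 0<M (m≤m+n M _)) 0<J moment ∑h≤ S≤
      where
      open ≤-Reasoning
      P : ℕ
      P = M + (ℓ + D)
      Lᵗ : ℕ
      Lᵗ = L (not t)
      k : Fin Lᵗ → ℕ
      k l = ∑ (λ w → ind (lab (not t) w == l) * weight t w₀ x₀ w)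
      h : Fin Lᵗ → ℕ
      h l = M * k l
      ∑h≤ : ∑ h ≤ P * S
      ∑h≤ = begin
        ∑ h ≡⟨ ∑-*ˡ M k ⟩
        M * ∑ k ≡⟨ cong (M *_) (trans (∑-swap _) (∑-cong (λ w → ∑-delta (lab (not t) w) (λ _ → weight t w₀ x₀ w)))) ⟩
        M * degs t w₀ x₀ ≤⟨ *-monoʳ-≤ M (degs≤D t w₀ x₀) ⟩
        M * D ≤⟨ S-mean ⟩
        P * S ∎
      term≤ : ∀ w x → P * (ind (family t w₀ x₀ w x) * ΣΩ N (surv t w x)) ≤ M ^ N * (M * ind (family t w₀ x₀ w x))
      term≤ w x with family t w₀ x₀ w x in eq
      ... | false = ≤-trans (≤-reflexive (*-zeroʳ P)) z≤n
      ... | true  = begin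
        P * (1 * ΣΩ N (surv t w x)) ≡⟨ cong (P *_) (*-identityˡ _) ⟩
        P * ΣΩ N (surv t w x)       ≡⟨ *-comm P _ ⟩
        ΣΩ N (surv t w x) * P       ≤⟨ ΣΩ-surv t w x (∧-trueʳ {cf t w₀ x₀ w x} eq) ⟩
        M ^ N * M                   ≡⟨ cong (M ^ N *_) (*-identityʳ M) ⟨
        M ^ N * (M * 1)             ∎
      ΣΩ-stat : ∀ l → P * ΣΩ N (survStat t w₀ x₀ l) ≤ M ^ N * h l
      ΣΩ-stat l = begin
        P * ΣΩ N (survStat t w₀ x₀ l)
          ≡⟨ cong (P *_) (trans (Ω-Σ N _) (∑-cong (λ w → trans (Ω-*ˡ N (ind (lab (not t) w == l)) _)
               (cong (ind (lab (not t) w == l) *_) (trans (Ω-Σ N _) (∑-cong (λ x → Ω-*ˡ N (ind (family t w₀ x₀ w x)) _))))))) ⟩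
        P * ∑ (λ w → ind (lab (not t) w == l) * ∑ (λ x → ind (family t w₀ x₀ w x) * ΣΩ N (surv t w x)))
          ≡⟨ trans (sym (∑-*ˡ P _)) (∑-cong (λ w → trans (x∙yz≈y∙xz P (ind (lab (not t) w == l)) _)
               (cong (ind (lab (not t) w == l) *_) (sym (∑-*ˡ P _))))) ⟩
        ∑ (λ w → ind (lab (not t) w == l) * ∑ (λ x → P * (ind (family t w₀ x₀ w x) * ΣΩ N (surv t w x))))
          ≤⟨ ∑-mono (λ w → *-monoʳ-≤ (ind (lab (not t) w == l)) (∑-mono (λ x → term≤ w x))) ⟩
        ∑ (λ w → ind (lab (not t) w == l) * ∑ (λ x → M ^ N * (M * ind (family t w₀ x₀ w x))))
          ≡⟨ ∑-cong (λ w → trans (cong (ind (lab (not t) w == l) *_) (trans (∑-*ˡ (M ^ N) _) (cong (M ^ N *_) (∑-*ˡ M _))))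
               (trans (x∙yz≈y∙xz (ind (lab (not t) w == l)) (M ^ N) _) (cong (M ^ N *_) (x∙yz≈y∙xz (ind (lab (not t) w == l)) M _)))) ⟩
        ∑ (λ w → M ^ N * (M * (ind (lab (not t) w == l) * weight t w₀ x₀ w)))
          ≡⟨ trans (∑-*ˡ (M ^ N) _) (cong (M ^ N *_) (∑-*ˡ M _)) ⟩
        M ^ N * h l ∎
      factor≤ : ∀ l → P * ΣΩ N (λ ω → Λ + survStat t w₀ x₀ l ω) ≤ M ^ N * (P * Λ + h l)
      factor≤ l = begin
        P * ΣΩ N (λ ω → Λ + survStat t w₀ x₀ l ω)
          ≡⟨ cong (P *_) (trans (Ω-+ N (λ _ → Λ) (survStat t w₀ x₀ l)) (cong (_+ ΣΩ N (survStat t w₀ x₀ l)) (Ω-const N Λ))) ⟩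
        P * (M ^ N * Λ + ΣΩ N (survStat t w₀ x₀ l)) ≡⟨ *-distribˡ-+ P _ _ ⟩
        P * (M ^ N * Λ) + P * ΣΩ N (survStat t w₀ x₀ l) ≤⟨ +-mono-≤ (≤-reflexive (x∙yz≈y∙xz P (M ^ N) Λ)) (ΣΩ-stat l) ⟩
        M ^ N * (P * Λ) + M ^ N * h l ≡⟨ *-distribˡ-+ (M ^ N) _ _ ⟨
        M ^ N * (P * Λ + h l) ∎
      own : Fin N → Fin Lᵗ
      own v = lab (not t) (group v)
      dep : ∀ l → DependsOn (λ v → own v ≡ l) (λ ω → Λ + survStat t w₀ x₀ l ω)
      dep l ω ω′ e = cong (Λ +_) (∑-cong (λ w → same w))
        where
        same : ∀ w → ind (lab (not t) w == l) * ∑ (λ x → ind (family t w₀ x₀ w x) * surv t w x ω)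
                   ≡ ind (lab (not t) w == l) * ∑ (λ x → ind (family t w₀ x₀ w x) * surv t w x ω′)
        same w with lab (not t) w == l in eq
        ... | false = refl
        ... | true  = cong (1 *_) (∑-cong (λ x → cong (ind (family t w₀ x₀ w x) *_) (∏-cong (λ v → cong (ind ∘ not) (kill≡ x v)))))
          where
          kill≡ : ∀ x v → kill t (group v) (slot v) (lookup ω v) w x ≡ kill t (group v) (slot v) (lookup ω′ v) w x
          kill≡ x v with own v Fin.≟ l
          ... | yes own≡ = cong (λ val → kill t (group v) (slot v) val w x) (e v own≡)
          ... | no  own≢ = trans (kill-label t (group v) (slot v) (lookup ω v) w x ≢l)
                                 (sym (kill-label t (group v) (slot v) (lookup ω′ v) w x ≢l))
            where
            ≢l : lab (not t) (group v) ≢ lab (not t) w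
            ≢l q = own≢ (trans q (==⇒≡ _ l eq))
      moment : P ^ Lᵗ * ΣΩ N (λ ω → ∏ (λ l → Λ + survStat t w₀ x₀ l ω)) ≤ M ^ N * ∏ (λ l → P * Λ + h l)
      moment = *-cancelˡ-≤ ((M ^ N) ^ Lᵗ) {{m^n≢0 (M ^ N) Lᵗ {{m^n≢0 M N {{>-nonZero 0<M}}}}}} (begin
        (M ^ N) ^ Lᵗ * (P ^ Lᵗ * ΣΩ N (λ ω → ∏ (λ l → Λ + survStat t w₀ x₀ l ω)))
          ≡⟨ x∙yz≈y∙xz ((M ^ N) ^ Lᵗ) (P ^ Lᵗ) _ ⟩
        P ^ Lᵗ * ((M ^ N) ^ Lᵗ * ΣΩ N (λ ω → ∏ (λ l → Λ + survStat t w₀ x₀ l ω)))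
          ≡⟨ cong (P ^ Lᵗ *_) (Ω-Π-independent N own (λ l ω → Λ + survStat t w₀ x₀ l ω) dep) ⟩
        P ^ Lᵗ * (M ^ N * ∏ (λ l → ΣΩ N (λ ω → Λ + survStat t w₀ x₀ l ω)))
          ≡⟨ x∙yz≈y∙xz (P ^ Lᵗ) (M ^ N) _ ⟩
        M ^ N * (P ^ Lᵗ * ∏ (λ l → ΣΩ N (λ ω → Λ + survStat t w₀ x₀ l ω)))
          ≡⟨ cong (M ^ N *_) (trans (cong (_* ∏ (λ l → ΣΩ N (λ ω → Λ + survStat t w₀ x₀ l ω))) (sym (∏-const Lᵗ P))) (sym (∏-* _ _))) ⟩
        M ^ N * ∏ (λ l → P * ΣΩ N (λ ω → Λ + survStat t w₀ x₀ l ω))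
          ≤⟨ *-monoʳ-≤ (M ^ N) (∏-mono factor≤) ⟩
        M ^ N * ∏ (λ l → M ^ N * (P * Λ + h l))
          ≡⟨ cong (M ^ N *_) (trans (∏-* (λ _ → M ^ N) _) (cong (_* ∏ (λ l → P * Λ + h l)) (∏-const Lᵗ (M ^ N)))) ⟩
        M ^ N * ((M ^ N) ^ Lᵗ * ∏ (λ l → P * Λ + h l))
          ≡⟨ x∙yz≈y∙xz (M ^ N) ((M ^ N) ^ Lᵗ) _ ⟩
        (M ^ N) ^ Lᵗ * (M ^ N * ∏ (λ l → P * Λ + h l)) ∎)

  ∑≡0 : ∀ {n} (f : Fin n → ℕ) → ∑ f ≡ 0 → ∀ i → f i ≡ 0
  ∑≡0 f e i = n≤0⇒n≡0 (≤-trans (∑-term f i) (≤-reflexive e))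

  ind≡0 : ∀ {b} → ind b ≡ 0 → b ≡ false
  ind≡0 {false} _ = refl

  -- Distances between groups, for the dependencies of the local lemma.

  module _ {W n C : ℕ} (𝔹 : Board W n C) where

    open Board 𝔹

    Solvable : (Fin W → Bool) → (Fin W → Fin n → Bool) → Set
    Solvable unc alive = ∃ λ (f : Fin W → Fin n) →
      (∀ w → unc w ≡ true → alive w (f w) ≡ true) ×
      (∀ t w w′ → unc w ≡ true → unc w′ ≡ true → cf t w (f w) w′ (f w′) ≡ false)

    -- A multiplicity instead of a relation, so that `compose` counts walks and neighbourhood sizes
    -- become row sums.
    near : Fin W → Fin W → ℕ
    near w w′ = ind (w == w′) + ∑ (λ x → ∑ (λ x′ → ind (cf true w x w′ x′) + ind (cf false w x w′ x′)))

    near-refl : ∀ w → 0 < near w w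
    near-refl w rewrite ==-refl w = s≤s z≤n

    near-sym : ∀ w w′ → near w w′ ≡ near w′ w
    near-sym w w′ = cong₂ _+_ (cong ind (==-sym w w′)) (trans (∑-swap _)
      (∑-cong (λ x → ∑-cong (λ x′ → cong₂ _+_ (cong ind (cf-sym true w x′ w′ x)) (cong ind (cf-sym false w x′ w′ x))))))

    ≡-if-far : ∀ {w w′} → near w w′ ≡ 0 → (w == w′) ≡ false
    ≡-if-far {w} {w′} e = ind≡0 (m+n≡0⇒m≡0 (ind (w == w′)) e)

    cf-if-far : ∀ t {w w′} x x′ → near w w′ ≡ 0 → cf t w x w′ x′ ≡ false
    cf-if-far t {w} {w′} x x′ e = go t
      where
      both : ind (cf true w x w′ x′) + ind (cf false w x w′ x′) ≡ 0
      both = ∑≡0 _ (∑≡0 _ (m+n≡0⇒n≡0 (ind (w == w′)) e) x) x′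
      go : ∀ t → cf t w x w′ x′ ≡ false
      go true  = ind≡0 (m+n≡0⇒m≡0 (ind (cf true w x w′ x′)) both)
      go false = ind≡0 (m+n≡0⇒n≡0 (ind (cf true w x w′ x′)) both)

    ν : ℕ
    ν = 1 + n * (n + n)

    -- Each of the `n` vertices of a group has at most `n` conflicts of each kind. That `W` does not
    -- enter makes the whole argument uniform in the number of parts.
    ∑-near : ∀ w → ∑ (near w) ≤ ν
    ∑-near w = begin
      ∑ (near w) ≡⟨ ∑-+ _ _ ⟩
      ∑ (λ w′ → ind (w == w′)) + ∑ (λ w′ → ∑ (λ x → ∑ (λ x′ → ind (cf true w x w′ x′) + ind (cf false w x w′ x′))))
        ≡⟨ cong₂ _+_ (trans (∑-cong (λ w′ → sym (*-identityʳ _))) (∑-delta w (λ _ → 1)))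
             (trans (∑-swap _) (∑-cong (λ x → trans (∑-cong (λ w′ → ∑-+ _ _)) (∑-+ _ _)))) ⟩
      1 + ∑ (λ x → ∑ (λ w′ → ∑ (λ x′ → ind (cf true w x w′ x′))) + ∑ (λ w′ → ∑ (λ x′ → ind (cf false w x w′ x′))))
        ≤⟨ +-monoʳ-≤ 1 (∑-mono (λ x → +-mono-≤ (degree≤n true w x) (degree≤n false w x))) ⟩
      1 + ∑ {n} (λ _ → n + n) ≡⟨ cong suc (∑-const n (n + n)) ⟩
      ν ∎
      where open ≤-Reasoning

    compose : (Fin W → Fin W → ℕ) → Fin W → Fin W → ℕ
    compose f w w″ = ∑ (λ w′ → f w w′ * f w′ w″)

    compose-sym : ∀ f → (∀ w w′ → f w w′ ≡ f w′ w) → ∀ w w′ → compose f w w′ ≡ compose f w′ w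
    compose-sym f h w w′ = ∑-cong (λ u → trans (*-comm (f w u) _) (cong₂ _*_ (h u w′) (h w u)))

    ∑-compose : ∀ f a → (∀ w → ∑ (f w) ≤ a) → ∀ w → ∑ (compose f w) ≤ a * a
    ∑-compose f a h w = begin
      ∑ (λ w″ → ∑ (λ w′ → f w w′ * f w′ w″)) ≡⟨ trans (∑-swap _) (∑-cong (λ w′ → ∑-*ˡ (f w w′) _)) ⟩
      ∑ (λ w′ → f w w′ * ∑ (f w′))           ≤⟨ ∑-mono (λ w′ → *-monoʳ-≤ (f w w′) (h w′)) ⟩
      ∑ (λ w′ → f w w′ * a)                  ≡⟨ ∑-*ʳ a (f w) ⟩
      ∑ (f w) * a                            ≤⟨ *-monoˡ-≤ a (h w) ⟩
      a * a                                  ∎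
      where open ≤-Reasoning

    compose-pos : ∀ f w w′ w″ → 0 < f w w′ → 0 < f w′ w″ → 0 < compose f w w″
    compose-pos f w w′ w″ p q = ≤-trans (*-mono-≤ p q) (∑-term (λ w′ → f w w′ * f w′ w″) w′)

    -- The statistics at a group involve its conflicting groups and the threats against those, hence
    -- variables up to distance 2. Two such supports can meet only within distance 4.
    near₂ near₄ : Fin W → Fin W → ℕ
    near₂ = compose near
    near₄ = compose near₂

  -- Existence of an outcome in which no statistic deviates.

  module RoundExists {W n C : ℕ} (𝔹 : Board W n C) (R D ℓ : ℕ)
    (alive : Fin W → Fin n → Bool)
    (list≤ℓ : ∀ w → ∑ (λ x → ind (alive w x)) ≤ ℓ)
    (ℓ≤list : ∀ w x → alive w x ≡ true → ℓ ≤ ∑ (λ x′ → ind (alive w x′)))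
    (degs≤D : ∀ t w x → ∑ (λ w′ → ∑ (λ x′ → ind (Board.cf 𝔹 t w x w′ x′ ∧ alive w′ x′))) ≤ D)
    (2D≤M : 2 * D ≤ n + R) (1≤C : 1 ≤ C)
    (J s A S F : ℕ) (0<J : 0 < J) (0<n : 0 < n)
    (A-mean : ℓ * (2 * D) ≤ (n + R) * A) (A≤ : A ≤ J * s)
    (S-mean : (n + R) * D ≤ (n + R + (ℓ + D)) * S) (S≤ : S ≤ J * s)
    (F-mean : D * (A + 2 * s) ≤ (n + R) * F) (F≤ : F ≤ J * s)
    (large : 4 * ((ν 𝔹 * ν 𝔹) * (ν 𝔹 * ν 𝔹) * (1 + n * 4)) * TailBound.K (2 * C) J ^ s ≤ suc (TailBound.K (2 * C) J) ^ s)
    where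

    open Board 𝔹
    open RoundStatistics 𝔹 R D ℓ alive list≤ℓ ℓ≤list degs≤D 2D≤M 1≤C J s A S F 0<J 0<n A-mean A≤ S-mean S≤ F-mean F≤

    statistics : Bool → Fin W → Fin n → Ω → ℕ
    statistics t w x ω = ind (tS ≤ᵇ ∑ (λ l → survStat t w x l ω)) + ind (tF ≤ᵇ ∑ (λ v → failStat t w x v ω))

    -- One deviation of the list and, for each of the `n` vertices, two statistics for each of the
    -- two kinds: these are the 1 + 4 n events counted in `large`.
    bad : Fin W → Ω → ℕ
    bad w ω = ind (tA ≤ᵇ ∑ (λ v → hitStat w v ω)) + ∑ (λ x → statistics true w x ω + statistics false w x ω)

    ΣΩ-bad : ∀ w → ΣΩ N (bad w) * suc K ^ s ≤ (1 + n * 4) * (M ^ N * K ^ s)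
    ΣΩ-bad w = begin
      ΣΩ N (bad w) * suc K ^ s
        ≡⟨ cong (_* suc K ^ s) (trans (Ω-+ N _ _) (cong (ΣΩ N (λ ω → ind (tA ≤ᵇ ∑ (λ v → hitStat w v ω))) +_)
             (trans (Ω-Σ N _) (∑-cong (λ x → trans (Ω-+ N (statistics true w x) _) (cong₂ _+_ (Ω-+ N _ _) (Ω-+ N _ _))))))) ⟩
      (pA + ∑ (λ x → pS true x + pF true x + (pS false x + pF false x))) * suc K ^ s
        ≡⟨ trans (*-distribʳ-+ (suc K ^ s) pA _) (cong (pA * suc K ^ s +_) (sym (∑-*ʳ (suc K ^ s) _))) ⟩
      pA * suc K ^ s + ∑ (λ x → (pS true x + pF true x + (pS false x + pF false x)) * suc K ^ s)
        ≡⟨ cong (pA * suc K ^ s +_) (∑-cong (λ x → e₁ (pS true x) (pF true x) (pS false x) (pF false x) (suc K ^ s))) ⟩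
      pA * suc K ^ s + ∑ (λ x → pS true x * suc K ^ s + pF true x * suc K ^ s + (pS false x * suc K ^ s + pF false x * suc K ^ s))
        ≤⟨ +-mono-≤ (hit-tail w) (∑-mono (λ x → +-mono-≤ (+-mono-≤ (surv-tail true w x) (fail-tail true w x))
                                                        (+-mono-≤ (surv-tail false w x) (fail-tail false w x)))) ⟩
      q + ∑ {n} (λ _ → q + q + (q + q)) ≡⟨ cong (q +_) (∑-const n _) ⟩
      q + n * (q + q + (q + q))         ≡⟨ e₂ q n ⟩
      (1 + n * 4) * q                   ∎
      where
      open ≤-Reasoning
      q pA : ℕ
      q = M ^ N * K ^ s
      pA = ΣΩ N (λ ω → ind (tA ≤ᵇ ∑ (λ v → hitStat w v ω)))
      pS pF : Bool → Fin n → ℕ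
      pS t x = ΣΩ N (λ ω → ind (tS ≤ᵇ ∑ (λ l → survStat t w x l ω)))
      pF t x = ΣΩ N (λ ω → ind (tF ≤ᵇ ∑ (λ v → failStat t w x v ω)))
      e₁ : ∀ a b c d k → (a + b + (c + d)) * k ≡ a * k + b * k + (c * k + d * k)
      e₁ = solve-∀
      e₂ : ∀ q n → q + n * (q + q + (q + q)) ≡ (1 + n * 4) * q
      e₂ = solve-∀

    νν : ℕ
    νν = (ν 𝔹 * ν 𝔹) * (ν 𝔹 * ν 𝔹)

    rare : ∀ w → 4 * ∑ (λ w′ → near₄ 𝔹 w w′ * ΣΩ N (bad w′)) ≤ M ^ N
    rare w = *-cancelʳ-≤ _ _ (suc K ^ s) {{m^n≢0 (suc K) s}} (begin
      4 * ∑ (λ w′ → near₄ 𝔹 w w′ * ΣΩ N (bad w′)) * suc K ^ s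
        ≡⟨ trans (*-assoc 4 (∑ (λ w′ → near₄ 𝔹 w w′ * ΣΩ N (bad w′))) (suc K ^ s)) (cong (4 *_) (trans (sym (∑-*ʳ (suc K ^ s) _)) (∑-cong (λ w′ → *-assoc (near₄ 𝔹 w w′) _ _)))) ⟩
      4 * ∑ (λ w′ → near₄ 𝔹 w w′ * (ΣΩ N (bad w′) * suc K ^ s))
        ≤⟨ *-monoʳ-≤ 4 (∑-mono (λ w′ → *-monoʳ-≤ (near₄ 𝔹 w w′) (ΣΩ-bad w′))) ⟩
      4 * ∑ (λ w′ → near₄ 𝔹 w w′ * q)
        ≡⟨ cong (4 *_) (∑-*ʳ q _) ⟩
      4 * (∑ (near₄ 𝔹 w) * q)
        ≤⟨ *-monoʳ-≤ 4 (*-monoˡ-≤ q (∑-compose 𝔹 (near₂ 𝔹) _ (∑-compose 𝔹 (near 𝔹) _ (∑-near 𝔹)) w)) ⟩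
      4 * (νν * q)
        ≡⟨ e₁ νν (1 + n * 4) (M ^ N) (K ^ s) ⟩
      M ^ N * (4 * (νν * (1 + n * 4)) * K ^ s)
        ≤⟨ *-monoʳ-≤ (M ^ N) large ⟩
      M ^ N * suc K ^ s ∎)
      where
      open ≤-Reasoning
      q : ℕ
      q = (1 + n * 4) * (M ^ N * K ^ s)
      e₁ : ∀ a b m k → 4 * (a * (b * (m * k))) ≡ m * (4 * (a * b) * k)
      e₁ = solve-∀

    support : Fin W → Fin N → Bool
    support w v = 0 <ᵇ near₂ 𝔹 w (group v)

    support⇒ : ∀ w v → support w v ≡ true → 0 < near₂ 𝔹 w (group v)
    support⇒ w v e = <ᵇ⇒< 0 _ (subst T (sym e) _)

    pos⇒support : ∀ w v → 0 < near₂ 𝔹 w (group v) → support w v ≡ true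
    pos⇒support w v p with near₂ 𝔹 w (group v)
    pos⇒support w v (s≤s _) | suc _ = refl

    near₂-sym : ∀ w w′ → near₂ 𝔹 w w′ ≡ near₂ 𝔹 w′ w
    near₂-sym = compose-sym 𝔹 (near 𝔹) (near-sym 𝔹)

    near₄-refl : ∀ w → 0 < near₄ 𝔹 w w
    near₄-refl w = compose-pos 𝔹 (near₂ 𝔹) w w w near₂-refl near₂-refl
      where
      near₂-refl : 0 < near₂ 𝔹 w w
      near₂-refl = compose-pos 𝔹 (near 𝔹) w w w (near-refl 𝔹 w) (near-refl 𝔹 w)

    far⇒disjoint : ∀ e f → near₄ 𝔹 e f ≡ 0 → ∀ v → support f v ≡ true → support e v ≡ false
    far⇒disjoint e f far v sf with support e v in se
    ... | false = refl
    ... | true  = ⊥-elim (<-irrefl (sym far) (compose-pos 𝔹 (near₂ 𝔹) e (group v) f (support⇒ e v se)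
                    (subst (0 <_) (near₂-sym f (group v)) (support⇒ f v sf))))

    hit-far : ∀ w′ z val w x → near 𝔹 w w′ ≡ 0 → hit w′ z val w x ≡ false
    hit-far w′ zero val w x far = pick-false val none
      where
      none : ∀ x′ → alive w′ x′ ∧ conflict w′ x′ w x ≡ false
      none x′ with alive w′ x′
      ... | false = refl
      ... | true rewrite cf-sym true w′ x′ w x | cf-sym false w′ x′ w x
                       | cf-if-far 𝔹 true x x′ far | cf-if-far 𝔹 false x x′ far = refl
    hit-far w′ (suc y) val w x far rewrite ==-sym w′ w | ≡-if-far 𝔹 far = refl

    kill-far : ∀ t w′ z val w x → near 𝔹 w w′ ≡ 0 → kill t w′ z val w x ≡ false
    kill-far t w′ zero val w x far = pick-false val none
      where
      none : ∀ x′ → alive w′ x′ ∧ ((w′ == w) ∨ cf (not t) w′ x′ w x) ≡ false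
      none x′ with alive w′ x′
      ... | false = refl
      ... | true rewrite cf-sym (not t) w′ x′ w x | cf-if-far 𝔹 (not t) x x′ far | ==-sym w′ w | ≡-if-far 𝔹 far = refl
    kill-far t w′ (suc y) val w x far rewrite ==-sym w′ w | ≡-if-far 𝔹 far = refl

    depends : ∀ w → DependsOn (λ v → support w v ≡ true) (bad w)
    depends w₀ ω ω′ agree = cong₂ _+_
      (cong (λ z → ind (tA ≤ᵇ z)) (∑-cong (λ v → ∑-cong (λ x → cong (λ b → ind (alive w₀ x ∧ b)) (hit≡ w₀ (near-refl 𝔹 w₀) v x)))))
      (∑-cong (λ x → cong₂ _+_ (stat≡ true x) (stat≡ false x)))
      where
      -- For `w` near `w₀`, a variable of a group near `w` lies in the support of `w₀`; any other
      -- variable can neither hit nor kill at `w`.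
      local : ∀ w → 0 < near 𝔹 w₀ w → ∀ v → lookup ω v ≡ lookup ω′ v ⊎ near 𝔹 w (group v) ≡ 0
      local w p v with near 𝔹 w (group v) in eq
      ... | zero  = inj₂ refl
      ... | suc _ = inj₁ (agree v (pos⇒support w₀ v (compose-pos 𝔹 (near 𝔹) w₀ w (group v) p (subst (0 <_) (sym eq) (s≤s z≤n)))))
      hit≡ : ∀ w → 0 < near 𝔹 w₀ w → ∀ v x →
        hit (group v) (slot v) (lookup ω v) w x ≡ hit (group v) (slot v) (lookup ω′ v) w x
      hit≡ w p v x with local w p v
      ... | inj₁ eq  = cong (λ val → hit (group v) (slot v) val w x) eq
      ... | inj₂ far = trans (hit-far (group v) (slot v) (lookup ω v) w x far)
                             (sym (hit-far (group v) (slot v) (lookup ω′ v) w x far))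
      kill≡ : ∀ t w → 0 < near 𝔹 w₀ w → ∀ v x →
        kill t (group v) (slot v) (lookup ω v) w x ≡ kill t (group v) (slot v) (lookup ω′ v) w x
      kill≡ t w p v x with local w p v
      ... | inj₁ eq  = cong (λ val → kill t (group v) (slot v) val w x) eq
      ... | inj₂ far = trans (kill-far t (group v) (slot v) (lookup ω v) w x far)
                             (sym (kill-far t (group v) (slot v) (lookup ω′ v) w x far))
      near-or-no-cf : ∀ t x₀ w x → 0 < near 𝔹 w₀ w ⊎ cf t w₀ x₀ w x ≡ false
      near-or-no-cf t x₀ w x with near 𝔹 w₀ w in eq
      ... | zero  = inj₂ (cf-if-far 𝔹 t x₀ x eq)
      ... | suc _ = inj₁ (s≤s z≤n)
      surv≡ : ∀ t x₀ w x → ind (family t w₀ x₀ w x) * surv t w x ω ≡ ind (family t w₀ x₀ w x) * surv t w x ω′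
      surv≡ t x₀ w x with near-or-no-cf t x₀ w x
      ... | inj₁ p = cong (ind (family t w₀ x₀ w x) *_) (∏-cong (λ v → cong (ind ∘ not) (kill≡ t w p v x)))
      ... | inj₂ e rewrite e = refl
      fail≡ : ∀ t x₀ v → failStat t w₀ x₀ v ω ≡ failStat t w₀ x₀ v ω′
      fail≡ t x₀ v with near 𝔹 w₀ (group v) in eq
      ... | suc k = cong (λ z → onSelector (slot v) * (weight t w₀ x₀ (group v) * z))
              (failure-cong (group v) v ω ω′ (λ x → anyᶠ-cong (λ u → cong ((toℕ u <ᵇ toℕ v) ∧_) (hit≡ (group v) p u x))) same)
        where
        p : 0 < near 𝔹 w₀ (group v)
        p = subst (0 <_) (sym eq) (s≤s z≤n)
        same : lookup ω v ≡ lookup ω′ v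
        same = agree v (pos⇒support w₀ v (compose-pos 𝔹 (near 𝔹) w₀ (group v) (group v) p (near-refl 𝔹 (group v))))
      ... | zero  = trans (cong (onSelector (slot v) *_) (none ω)) (sym (cong (onSelector (slot v) *_) (none ω′)))
        where
        none : ∀ ω → weight t w₀ x₀ (group v) * failure (group v) v ω ≡ 0
        none ω = cong (_* failure (group v) v ω)
          (∑-zero (λ x → cong (λ b → ind (b ∧ alive (group v) x)) (cf-if-far 𝔹 t x₀ x eq)))
      stat≡ : ∀ t x₀ → statistics t w₀ x₀ ω ≡ statistics t w₀ x₀ ω′
      stat≡ t x₀ = cong₂ _+_
        (cong (λ z → ind (tS ≤ᵇ z)) (∑-cong (λ l → ∑-cong (λ w → cong (ind (lab (not t) w == l) *_) (∑-cong (λ x → surv≡ t x₀ w x))))))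
        (cong (λ z → ind (tF ≤ᵇ z)) (∑-cong (λ v → fail≡ t x₀ v)))

    <-of-≤ᵇ : ∀ a b → ind (a ≤ᵇ b) ≡ 0 → b < a
    <-of-≤ᵇ a b e with a ≤ᵇ b in eq
    ... | false = ≰⇒> (λ a≤b → subst T eq (≤⇒≤ᵇ a≤b))

    avoiding : ∃ λ ω → ∀ w → bad w ω ≡ 0
    avoiding = LocalLemma.avoid-all bad support depends (near₄ 𝔹) near₄-refl far⇒disjoint 0<M rare

    bad≡0⇒few-hits : ∀ w ω → bad w ω ≡ 0 → ∑ (λ v → hitStat w v ω) < tA
    bad≡0⇒few-hits w ω e = <-of-≤ᵇ tA (∑ (λ v → hitStat w v ω)) (m+n≡0⇒m≡0 (ind (tA ≤ᵇ ∑ (λ v → hitStat w v ω))) e)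

    bad≡0⇒statistics≡0 : ∀ t w x ω → bad w ω ≡ 0 → statistics t w x ω ≡ 0
    bad≡0⇒statistics≡0 t w x ω e = go t
      where
      both : statistics true w x ω + statistics false w x ω ≡ 0
      both = ∑≡0 (λ x → statistics true w x ω + statistics false w x ω)
        (m+n≡0⇒n≡0 (ind (tA ≤ᵇ ∑ (λ v → hitStat w v ω))) e) x
      go : ∀ t → statistics t w x ω ≡ 0
      go true  = m+n≡0⇒m≡0 (statistics true w x ω) both
      go false = m+n≡0⇒n≡0 (statistics true w x ω) both

    bad≡0⇒few-survivors : ∀ t w x ω → bad w ω ≡ 0 → ∑ (λ l → survStat t w x l ω) < tS
    bad≡0⇒few-survivors t w x ω e = <-of-≤ᵇ tS (∑ (λ l → survStat t w x l ω))
      (m+n≡0⇒m≡0 (ind (tS ≤ᵇ ∑ (λ l → survStat t w x l ω))) (bad≡0⇒statistics≡0 t w x ω e))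

    bad≡0⇒few-failures : ∀ t w x ω → bad w ω ≡ 0 → ∑ (λ v → failStat t w x v ω) < tF
    bad≡0⇒few-failures t w x ω e = <-of-≤ᵇ tF (∑ (λ v → failStat t w x v ω))
      (m+n≡0⇒n≡0 (ind (tS ≤ᵇ ∑ (λ l → survStat t w x l ω))) (bad≡0⇒statistics≡0 t w x ω e))

    -- Deterministic consequences of a good outcome.

    module AfterRound (unc : Fin W → Bool) (ω : Ω)
      (few-hits : ∀ w → ∑ (λ v → hitStat w v ω) < tA)
      (few-survivors : ∀ t w x → ∑ (λ l → survStat t w x l ω) < tS)
      (few-failures : ∀ t w x → ∑ (λ v → failStat t w x v ω) < tF)
      where

      value : Fin W → Fin M
      value w = lookup ω (selector w)

      anyHit : Fin W → Fin n → Bool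
      anyHit w x = anyᶠ (λ u → hit (group u) (slot u) (lookup ω u) w x)

      accepts : Fin W → Fin n → Bool
      accepts w x = alive w x ∧ not (early (selector w) ω w x)

      accepted failed : Fin W → Bool
      accepted w = pick (accepts w) (value w)
      failed w = pick (doomed w (selector w) ω) (value w)

      unc′ : Fin W → Bool
      unc′ w = unc w ∧ not (accepted w)

      alive′ : Fin W → Fin n → Bool
      alive′ w x = alive w x ∧ (not (anyHit w x) ∧ not (accepted w))

      ∑-early≤ : ∀ w (p : Fin n → Fin N → Bool) → (∀ x u → p x u ≡ true → hit (group u) (slot u) (lookup ω u) w x ≡ true) →
        ∑ (λ x → ind (alive w x ∧ anyᶠ (p x))) < tA
      ∑-early≤ w p h = ≤-trans (s≤s (begin
        ∑ (λ x → ind (alive w x ∧ anyᶠ (p x))) ≤⟨ ∑-mono (λ x → step x) ⟩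
        ∑ (λ x → ∑ (λ u → ind (alive w x ∧ hit (group u) (slot u) (lookup ω u) w x))) ≡⟨ ∑-swap _ ⟩
        ∑ (λ u → hitStat w u ω) ∎)) (few-hits w)
        where
        open ≤-Reasoning
        step : ∀ x → ind (alive w x ∧ anyᶠ (p x)) ≤ ∑ (λ u → ind (alive w x ∧ hit (group u) (slot u) (lookup ω u) w x))
        step x with alive w x
        ... | false = z≤n
        ... | true  = ≤-trans (anyᶠ≤∑ (p x)) (∑-mono (λ u → ind-mono (h x u)))

      lists : ∀ w → unc′ w ≡ true → ∑ (λ x → ind (alive w x)) ≤ ∑ (λ x → ind (alive′ w x)) + tA
      lists w u = begin
        ∑ (λ x → ind (alive w x)) ≤⟨ ∑-mono split ⟩
        ∑ (λ x → ind (alive′ w x) + ind (alive w x ∧ anyHit w x)) ≡⟨ ∑-+ _ _ ⟩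
        ∑ (λ x → ind (alive′ w x)) + ∑ (λ x → ind (alive w x ∧ anyHit w x))
          ≤⟨ +-monoʳ-≤ _ (<⇒≤ (∑-early≤ w (λ x u → hit (group u) (slot u) (lookup ω u) w x) (λ _ _ e → e))) ⟩
        ∑ (λ x → ind (alive′ w x)) + tA ∎
        where
        open ≤-Reasoning
        cases : ∀ a h c → not c ≡ true → ind a ≤ ind (a ∧ (not h ∧ not c)) + ind (a ∧ h)
        cases false _     _     _ = z≤n
        cases true  false false _ = s≤s z≤n
        cases true  true  false _ = s≤s z≤n
        split : ∀ x → ind (alive w x) ≤ ind (alive′ w x) + ind (alive w x ∧ anyHit w x)
        split x = cases (alive w x) (anyHit w x) (accepted w) (∧-trueʳ {unc w} u)

      variable-eta : ∀ v → combine (group v) (slot v) ≡ v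
      variable-eta v = Fin.combine-remQuot {W} (suc n) v

      idle-or-failed : ∀ w → accepted w ≡ false → pick (alive w) (value w) ≡ false ⊎ failed w ≡ true
      idle-or-failed w na with pick (alive w) (value w) in eq
      ... | false = inj₁ refl
      ... | true with picked (value w) eq
      ...   | x , ax , eval with early (selector w) ω w x in ee
      ...     | true  = inj₂ (trans (eval (doomed w (selector w) ω)) (∧-true ax ee))
      ...     | false = false-true na (trans (eval (accepts w)) (∧-true ax (cong not ee)))

      -- Every threat counted in `kill` is a hit or a pick by the group itself; the two hypotheses
      -- exclude both.
      survives : ∀ t w x → anyHit w x ≡ false → pick (alive w) (value w) ≡ false → surv t w x ω ≡ 1
      survives t w x nh idle = ∏-ind-false _ no-kill
        where
        no-hit : ∀ v → hit (group v) (slot v) (lookup ω v) w x ≡ true → ∀ {A : Set} → A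
        no-hit v h = false-true nh (anyᶠ-intro _ v h)
        no-kill-at : ∀ v w′ z → combine w′ z ≡ v → (hit w′ z (lookup ω v) w x ≡ true → ∀ {A : Set} → A) →
          kill t w′ z (lookup ω v) w x ≡ false
        no-kill-at v w′ (suc y) _ nh with coinHit w′ y (lookup ω v) w x in eq
        ... | false = refl
        ... | true  = nh refl
        no-kill-at v w′ zero refl nh with kill t w′ zero (lookup ω v) w x in eq
        ... | false = refl
        ... | true with picked (lookup ω v) eq
        ...   | x′ , e , eval = split-kill (alive w′ x′) (w′ == w) refl refl e
          where
          conflict-of : cf (not t) w′ x′ w x ≡ true → conflict w′ x′ w x ≡ true
          conflict-of c = go t c
            where
            go : ∀ t → cf (not t) w′ x′ w x ≡ true → conflict w′ x′ w x ≡ true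
            go true  c = ∨-trueʳ (cf true w′ x′ w x) c
            go false c rewrite c = refl
          split-kill : ∀ a b → alive w′ x′ ≡ a → (w′ == w) ≡ b → a ∧ (b ∨ cf (not t) w′ x′ w x) ≡ true → true ≡ false
          split-kill true true ax eqw _ with refl ← ==⇒≡ w′ w eqw = false-true idle (trans (eval (alive w)) ax)
          split-kill true false ax _ c = nh (trans (eval _) (∧-true ax (conflict-of c)))
        no-kill : ∀ v → kill t (group v) (slot v) (lookup ω v) w x ≡ false
        no-kill v = no-kill-at v (group v) (slot v) (variable-eta v) (no-hit v)

      ∑-failed : ∀ t w₀ x₀ → ∑ (λ w → weight t w₀ x₀ w * ind (failed w)) ≤ ∑ (λ v → failStat t w₀ x₀ v ω)
      ∑-failed t w₀ x₀ = begin
        ∑ (λ w → weight t w₀ x₀ w * ind (failed w)) ≤⟨ ∑-mono (λ w → *-monoʳ-≤ (weight t w₀ x₀ w) (fail≤ w)) ⟩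
        ∑ (λ w → weight t w₀ x₀ w * failure w (selector w) ω) ≡⟨ ∑-cong (λ w → sym (at-selector w)) ⟩
        ∑ (λ w → failStat t w₀ x₀ (selector w) ω)
          ≤⟨ ∑-mono (λ w → ∑-term (λ z → failStat t w₀ x₀ (combine w z) ω) zero) ⟩
        ∑ (λ w → ∑ (λ z → failStat t w₀ x₀ (combine w z) ω)) ≡⟨ ∑-combine W (λ v → failStat t w₀ x₀ v ω) ⟨
        ∑ (λ v → failStat t w₀ x₀ v ω) ∎
        where
        open ≤-Reasoning
        fail≤ : ∀ w → ind (failed w) ≤ failure w (selector w) ω
        fail≤ w = ind-mono (λ f → ∧-true f (<⇒<ᵇ≡true (∑-early≤ w (λ x u → (toℕ u <ᵇ toℕ (selector w)) ∧ hit (group u) (slot u) (lookup ω u) w x)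
            (λ x u e → ∧-trueʳ {toℕ u <ᵇ toℕ (selector w)} e))))
        at-selector : ∀ w → failStat t w₀ x₀ (selector w) ω ≡ weight t w₀ x₀ w * failure w (selector w) ω
        at-selector w = trans (cong (λ p → onSelector (proj₂ p) * (weight t w₀ x₀ (proj₁ p) * failure (proj₁ p) (selector w) ω))
          (Fin.remQuot-combine {W} w zero)) (*-identityˡ _)

      -- A neighbour that is still alive was not hit, and its group accepted nothing. Either that
      -- group was idle, so the neighbour survived every threat, or its pick failed.
      degs′ : ∀ t w₀ x₀ → ∑ (λ w → ∑ (λ x → ind (cf t w₀ x₀ w x ∧ alive′ w x))) ≤ tS + tF
      degs′ t w₀ x₀ = begin
        ∑ (λ w → ∑ (λ x → ind (cf t w₀ x₀ w x ∧ alive′ w x)))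
          ≤⟨ ∑-mono (λ w → ∑-mono (λ x → pointwise w x)) ⟩
        ∑ (λ w → ∑ (λ x → ind (family t w₀ x₀ w x) * surv t w x ω + ind (family t w₀ x₀ w x) * ind (failed w)))
          ≡⟨ trans (∑-cong (λ w → ∑-+ _ _)) (∑-+ _ _) ⟩
        ∑ (λ w → ∑ (λ x → ind (family t w₀ x₀ w x) * surv t w x ω))
          + ∑ (λ w → ∑ (λ x → ind (family t w₀ x₀ w x) * ind (failed w)))
          ≡⟨ cong₂ _+_ (sym (trans (∑-swap _) (∑-cong (λ w → ∑-delta (lab (not t) w) (λ _ → ∑ (λ x → ind (family t w₀ x₀ w x) * surv t w x ω))))))
                       (∑-cong (λ w → ∑-*ʳ (ind (failed w)) _)) ⟩
        ∑ (λ l → survStat t w₀ x₀ l ω) + ∑ (λ w → weight t w₀ x₀ w * ind (failed w))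
          ≤⟨ +-mono-≤ (<⇒≤ (few-survivors t w₀ x₀)) (≤-trans (∑-failed t w₀ x₀) (<⇒≤ (few-failures t w₀ x₀))) ⟩
        tS + tF ∎
        where
        open ≤-Reasoning
        pointwise : ∀ w x → ind (cf t w₀ x₀ w x ∧ alive′ w x)
          ≤ ind (family t w₀ x₀ w x) * surv t w x ω + ind (family t w₀ x₀ w x) * ind (failed w)
        pointwise w x with cf t w₀ x₀ w x | alive w x | anyHit w x in eh | accepted w in ea
        ... | false | _     | _     | _     = z≤n
        ... | true  | false | _     | _     = z≤n
        ... | true  | true  | true  | _     = z≤n
        ... | true  | true  | false | true  = z≤n
        ... | true  | true  | false | false with idle-or-failed w ea
        ...   | inj₁ idle rewrite survives t w x eh idle = s≤s z≤n
        ...   | inj₂ fail rewrite fail = m≤n+m 1 (1 * surv t w x ω)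

      conflict-true : ∀ t w x w′ x′ → cf t w x w′ x′ ≡ true → conflict w x w′ x′ ≡ true
      conflict-true true  w x w′ x′ e rewrite e = refl
      conflict-true false w x w′ x′ e with cf true w x w′ x′
      ... | true  = refl
      ... | false = e

      selector-hits : ∀ {w x w′ x′ t} → (∀ q → pick q (value w) ≡ q x) → alive w x ≡ true → cf t w x w′ x′ ≡ true →
        hit (group (selector w)) (slot (selector w)) (lookup ω (selector w)) w′ x′ ≡ true
      selector-hits {w} {x} {w′} {x′} {t} eval ax c = trans
        (cong (λ p → hit (proj₁ p) (proj₂ p) (value w) w′ x′) (Fin.remQuot-combine {W} w zero))
        (trans (eval _) (∧-true ax (conflict-true t w x w′ x′ c)))

      -- Settled groups keep their accepted vertex. Such a vertex hits everything it conflicts with,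
      -- so nothing in a remaining list conflicts with it; and of two conflicting accepted picks the
      -- later one would have been hit early.
      solve : Solvable 𝔹 unc′ alive′ → Solvable 𝔹 unc alive
      solve (f , f-alive , f-ok) = g , g-alive , λ t w w′ u u′ → no-conflict t w w′ u u′ (status w u) (status w′ u′)
        where
        g-at : ∀ w b → accepted w ≡ b → Fin n
        g-at w true  e = proj₁ (picked (value w) e)
        g-at w false e = f w
        g : Fin W → Fin n
        g w = g-at w (accepted w) refl

        Accepted Pending : Fin W → Set
        Accepted w = alive w (g w) ≡ true × early (selector w) ω w (g w) ≡ false × (∀ q → pick q (value w) ≡ q (g w))
        Pending w = unc′ w ≡ true × g w ≡ f w

        status-at : ∀ w → unc w ≡ true → ∀ b (e : accepted w ≡ b) →
          (alive w (g-at w b e) ≡ true × early (selector w) ω w (g-at w b e) ≡ false × (∀ q → pick q (value w) ≡ q (g-at w b e)))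
          ⊎ (unc′ w ≡ true × g-at w b e ≡ f w)
        status-at w u true e with picked {accepts w} (value w) e
        ... | x , ax , eval = inj₁ (∧-trueˡ ax , not-true (∧-trueʳ {alive w x} ax) , eval)
        status-at w u false e = inj₂ (∧-true u (cong not e) , refl)

        status : ∀ w → unc w ≡ true → Accepted w ⊎ Pending w
        status w u = status-at w u (accepted w) refl

        g-alive : ∀ w → unc w ≡ true → alive w (g w) ≡ true
        g-alive w u with status w u
        ... | inj₁ (a , _) = a
        ... | inj₂ (u′ , e) = subst (λ x → alive w x ≡ true) (sym e) (∧-trueˡ (f-alive w u′))

        pending-clash : ∀ t w w′ → Accepted w → Pending w′ → cf t w (g w) w′ (g w′) ≡ true → true ≡ false
        pending-clash t w w′ (ax , _ , eval) (u′ , e) c =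
          false-true (not-true (∧-trueˡ (∧-trueʳ {alive w′ (g w′)} (subst (λ x → alive′ w′ x ≡ true) (sym e) (f-alive w′ u′)))))
                 (anyᶠ-intro _ (selector w) (selector-hits {t = t} eval ax c))

        earlier-clash : ∀ t w w′ → toℕ (selector w) < toℕ (selector w′) → Accepted w → Accepted w′ →
          cf t w (g w) w′ (g w′) ≡ true → true ≡ false
        earlier-clash t w w′ lt (ax , _ , eval) (_ , ne , _) c =
          false-true ne (anyᶠ-intro _ (selector w) (∧-true (<⇒<ᵇ≡true lt) (selector-hits {t = t} eval ax c)))

        no-conflict : ∀ t w w′ → unc w ≡ true → unc w′ ≡ true → Accepted w ⊎ Pending w → Accepted w′ ⊎ Pending w′ →
          cf t w (g w) w′ (g w′) ≡ false
        no-conflict t w w′ u u′ st st′ with cf t w (g w) w′ (g w′) in c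
        ... | false = refl
        no-conflict t w w′ u u′ (inj₁ a) (inj₂ p) | true = pending-clash t w w′ a p c
        no-conflict t w w′ u u′ (inj₂ p) (inj₁ a) | true =
          pending-clash t w′ w a p (trans (cf-sym t w′ (g w′) w (g w)) c)
        no-conflict t w w′ u u′ (inj₂ (v , e)) (inj₂ (v′ , e′)) | true =
          trans (sym (subst₂ (λ x x′ → cf t w x w′ x′ ≡ true) e e′ c)) (f-ok t w w′ v v′)
        no-conflict t w w′ u u′ (inj₁ a) (inj₁ a′) | true with <-cmp (toℕ (selector w)) (toℕ (selector w′))
        ... | tri< lt _ _ = earlier-clash t w w′ lt a a′ c
        ... | tri> _ _ gt = earlier-clash t w′ w gt a′ a (trans (cf-sym t w′ (g w′) w (g w)) c)
        ... | tri≈ _ eq _ with refl ← Fin.combine-injectiveˡ w zero w′ zero (Fin.toℕ-injective eq) =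
          trans (sym c) (cf-irr t w (g w) (g w))

  -- The last step

  -- Cuts a list to an exact length, since a round needs upper and lower bounds for list sizes with
  -- the same ℓ.
  trim : ∀ {n} → ℕ → (Fin n → Bool) → Fin n → Bool
  trim zero    p i       = false
  trim (suc k) p zero    = p zero
  trim (suc k) p (suc i) = trim (if p zero then k else suc k) (p ∘ suc) i

  trim⇒ : ∀ {n} k (p : Fin n → Bool) i → trim k p i ≡ true → p i ≡ true
  trim⇒ (suc k) p zero    e = e
  trim⇒ (suc k) p (suc i) e = trim⇒ (if p zero then k else suc k) (p ∘ suc) i e

  ∑-trim : ∀ {n} k (p : Fin n → Bool) → k ≤ ∑ (λ i → ind (p i)) → ∑ (λ i → ind (trim k p i)) ≡ k
  ∑-trim zero p le = ∑-zero (λ _ → refl)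
  ∑-trim {zero} (suc k) p le = ⊥-elim (n≮0 (≤-trans le (≤-reflexive (∑-zero λ ()))))
  ∑-trim {suc n} (suc k) p le = trans (∑-suc _) (go (p zero) refl)
    where
    go : ∀ b → p zero ≡ b → ind (p zero) + ∑ (λ i → ind (trim (if p zero then k else suc k) (p ∘ suc) i)) ≡ suc k
    go true  e rewrite e = cong suc (∑-trim k (p ∘ suc) (≤-pred (≤-trans le (≤-reflexive
      (trans (∑-suc _) (cong (λ b → ind b + ∑ (λ i → ind (p (suc i)))) e))))))
    go false e rewrite e = ∑-trim (suc k) (p ∘ suc) (≤-trans le (≤-reflexive
      (trans (∑-suc _) (cong (λ b → ind b + ∑ (λ i → ind (p (suc i)))) e))))

  -- `sums≤` encodes that the listed elements are distinct, in the only form in which it is used: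
  -- sums along the enumeration do not exceed sums over the set.
  record Enumeration {n} (ℓ : ℕ) (p : Fin n → Bool) : Set where
    field
      at        : Fin ℓ → Fin n
      satisfies : ∀ v → p (at v) ≡ true
      sums≤     : ∀ (g : Fin n → ℕ) → ∑ (λ v → g (at v)) ≤ ∑ (λ x → ind (p x) * g x)

  enumerate : ∀ {n} ℓ (p : Fin n → Bool) → ℓ ≤ ∑ (λ x → ind (p x)) → Enumeration ℓ p
  enumerate {n} zero p le = record { at = none ; satisfies = λ () ; sums≤ = λ g → ≤-trans (≤-reflexive (∑-zero {0} {λ v → g (none v)} λ ())) z≤n }
    where
    none : Fin 0 → Fin n
    none ()
  enumerate {zero} (suc ℓ) p le = ⊥-elim (n≮0 (≤-trans le (≤-reflexive (∑-zero λ ()))))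
  enumerate {suc n} (suc ℓ) p le = go (p zero) refl
    where
    le′ : ∀ {b} → p zero ≡ b → suc ℓ ≤ ind b + ∑ (λ x → ind (p (suc x)))
    le′ e = ≤-trans le (≤-reflexive (trans (∑-suc _) (cong (λ b → ind b + ∑ (λ x → ind (p (suc x)))) e)))
    go : ∀ b → p zero ≡ b → Enumeration (suc ℓ) p
    go true e = record { at = at′ ; satisfies = sat ; sums≤ = sums }
      where
      module T = Enumeration (enumerate ℓ (p ∘ suc) (≤-pred (le′ e)))
      at′ : Fin (suc ℓ) → Fin (suc n)
      at′ zero    = zero
      at′ (suc v) = suc (T.at v)
      sat : ∀ v → p (at′ v) ≡ true
      sat zero    = e
      sat (suc v) = T.satisfies v
      sums : ∀ (g : Fin (suc n) → ℕ) → ∑ (λ v → g (at′ v)) ≤ ∑ (λ x → ind (p x) * g x)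
      sums g = begin
        ∑ (λ v → g (at′ v))                                     ≡⟨ ∑-suc _ ⟩
        g zero + ∑ (λ v → g (suc (T.at v)))                     ≤⟨ +-mono-≤ (≤-reflexive (trans (sym (*-identityˡ _)) (cong (λ b → ind b * g zero) (sym e)))) (T.sums≤ (g ∘ suc)) ⟩
        ind (p zero) * g zero + ∑ (λ x → ind (p (suc x)) * g (suc x)) ≡⟨ ∑-suc (λ x → ind (p x) * g x) ⟨
        ∑ (λ x → ind (p x) * g x)                               ∎
        where open ≤-Reasoning
    go false e = record { at = suc ∘ T.at ; satisfies = T.satisfies ; sums≤ = λ g →
        ≤-trans (T.sums≤ (g ∘ suc)) (≤-trans (m≤n+m _ (ind (p zero) * g zero)) (≤-reflexive (sym (∑-suc (λ x → ind (p x) * g x))))) }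
      where
      module T = Enumeration (enumerate (suc ℓ) (p ∘ suc) (le′ e))

  module _ {M : ℕ} where

    Ω-marginal : ∀ N (w : Fin N) (f : Fin M → ℕ) → ΣΩ N (λ ω → f (lookup ω w)) * M ≡ M ^ N * ∑ f
    Ω-marginal (suc N) zero f = begin
      ∑ (λ x → ΣΩ N (λ (_ : Vec (Fin M) N) → f x)) * M ≡⟨ cong (_* M) (trans (∑-cong (λ x → Ω-const N (f x))) (∑-*ˡ (M ^ N) f)) ⟩
      M ^ N * ∑ f * M                                  ≡⟨ xy∙z≈zx∙y (M ^ N) (∑ f) M ⟩
      M * M ^ N * ∑ f                                  ∎
      where
      open ≡-Reasoning
    Ω-marginal (suc N) (suc w) f = begin
      ∑ {M} (λ x → ΣΩ N (λ ω → f (lookup ω w))) * M    ≡⟨ ∑-*ʳ M _ ⟨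
      ∑ {M} (λ x → ΣΩ N (λ ω → f (lookup ω w)) * M)    ≡⟨ ∑-cong (λ x → Ω-marginal N w f) ⟩
      ∑ {M} (λ x → M ^ N * ∑ f)                        ≡⟨ ∑-const M _ ⟩
      M * (M ^ N * ∑ f)                                ≡⟨ *-assoc M (M ^ N) _ ⟨
      M * M ^ N * ∑ f                                  ∎
      where open ≡-Reasoning

    Ω-marginal₂ : ∀ N (w w′ : Fin N) (f : Fin M → Fin M → ℕ) → w ≢ w′ →
      ΣΩ N (λ ω → f (lookup ω w) (lookup ω w′)) * (M * M) ≡ M ^ N * ∑ (λ x → ∑ (f x))
    Ω-marginal₂ (suc N) zero zero f neq = ⊥-elim (neq refl)
    Ω-marginal₂ (suc N) zero (suc w′) f neq = begin
      ∑ (λ x → ΣΩ N (λ ω → f x (lookup ω w′))) * (M * M) ≡⟨ *-assoc (∑ (λ x → ΣΩ N (λ ω → f x (lookup ω w′)))) M M ⟨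
      ∑ (λ x → ΣΩ N (λ ω → f x (lookup ω w′))) * M * M   ≡⟨ cong (_* M) (trans (sym (∑-*ʳ M _)) (trans (∑-cong (λ x → Ω-marginal N w′ (f x))) (∑-*ˡ (M ^ N) _))) ⟩
      M ^ N * ∑ (λ x → ∑ (f x)) * M                      ≡⟨ xy∙z≈zx∙y (M ^ N) (∑ (λ x → ∑ (f x))) M ⟩
      M * M ^ N * ∑ (λ x → ∑ (f x))                      ∎
      where
      open ≡-Reasoning
    Ω-marginal₂ (suc N) (suc w) zero f neq =
      trans (Ω-marginal₂ (suc N) zero (suc w) (λ x y → f y x) λ ()) (cong (M ^ suc N *_) (∑-swap _))
    Ω-marginal₂ (suc N) (suc w) (suc w′) f neq = begin
      ∑ {M} (λ x → ΣΩ N (λ ω → f (lookup ω w) (lookup ω w′))) * (M * M) ≡⟨ ∑-*ʳ (M * M) _ ⟨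
      ∑ {M} (λ x → ΣΩ N (λ ω → f (lookup ω w) (lookup ω w′)) * (M * M)) ≡⟨ ∑-cong (λ x → Ω-marginal₂ N w w′ f (neq ∘ cong suc)) ⟩
      ∑ {M} (λ x → M ^ N * ∑ (λ x → ∑ (f x)))          ≡⟨ ∑-const M _ ⟩
      M * (M ^ N * ∑ (λ x → ∑ (f x)))                  ≡⟨ *-assoc M (M ^ N) _ ⟨
      M * M ^ N * ∑ (λ x → ∑ (f x))                    ∎
      where open ≡-Reasoning

  module _ {W n C : ℕ} (𝔹 : Board W n C) where

    open Board 𝔹

    record State (unc : Fin W → Bool) (alive : Fin W → Fin n → Bool) (ℓ D : ℕ) : Set where
      field
        lists : ∀ w → unc w ≡ true → ℓ ≤ ∑ (λ x → ind (alive w x))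
        degs  : ∀ t w x → ∑ (λ w′ → ∑ (λ x′ → ind (cf t w x w′ x′ ∧ alive w′ x′))) ≤ D

  module Finish {W n C : ℕ} (𝔹 : Board W n C) (unc : Fin W → Bool) (alive : Fin W → Fin n → Bool)
    (ℓ D : ℕ) (state : State 𝔹 unc alive ℓ D) (0<ℓ : 0 < ℓ) (32D≤ℓ : 32 * D ≤ ℓ) (default : Fin n) where

    open Board 𝔹
    open State state

    choose-at : ∀ w b → unc w ≡ b → Fin ℓ → Fin n
    choose-at w true  e = Enumeration.at (enumerate ℓ (alive w) (lists w e))
    -- An arbitrary value for a settled group; the factors `ind (unc w)` in `clash` silence it.
    choose-at w false e = const default

    choose : ∀ w → Fin ℓ → Fin n
    choose w = choose-at w (unc w) refl

    choose-alive : ∀ w v → unc w ≡ true → alive w (choose w v) ≡ true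
    choose-alive w v = at (unc w) refl
      where
      at : ∀ b (e : unc w ≡ b) → unc w ≡ true → alive w (choose-at w b e v) ≡ true
      at true  e u = Enumeration.satisfies (enumerate ℓ (alive w) (lists w e)) v
      at false e u = case trans (sym e) u of λ ()

    choose-sums : ∀ w (g : Fin n → ℕ) → ind (unc w) * ∑ (λ v → g (choose w v)) ≤ ∑ (λ x → ind (alive w x) * g x)
    choose-sums w g = at (unc w) refl
      where
      at : ∀ b (e : unc w ≡ b) → ind b * ∑ (λ v → g (choose-at w b e v)) ≤ ∑ (λ x → ind (alive w x) * g x)
      at true  e = ≤-trans (≤-reflexive (*-identityˡ _)) (Enumeration.sums≤ (enumerate ℓ (alive w) (lists w e)) g)
      at false e = z≤n

    clash : Fin W → Fin W → Fin ℓ → Fin ℓ → ℕ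
    clash w w′ v v′ = ind (unc w) * (ind (unc w′) * (ind (cf true w (choose w v) w′ (choose w′ v′)) + ind (cf false w (choose w v) w′ (choose w′ v′))))

    clash-sym : ∀ w w′ v v′ → clash w w′ v v′ ≡ clash w′ w v′ v
    clash-sym w w′ v v′ = trans (cong (λ z → ind (unc w) * (ind (unc w′) * z))
        (cong₂ _+_ (cong ind (cf-sym true w _ w′ _)) (cong ind (cf-sym false w _ w′ _))))
      (x∙yz≈y∙xz (ind (unc w)) (ind (unc w′)) _)

    clashes : Fin W → Fin W → ℕ
    clashes w w′ = ∑ (λ v → ∑ (clash w w′ v))

    clashes-sym : ∀ w w′ → clashes w w′ ≡ clashes w′ w
    clashes-sym w w′ = trans (∑-swap _) (∑-cong (λ v′ → ∑-cong (λ v → clash-sym w w′ v v′)))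

    ∑-clashes : ∀ w → ∑ (clashes w) ≤ ℓ * (2 * D)
    ∑-clashes w = begin
      ∑ (λ w′ → ∑ (λ v → ∑ (clash w w′ v))) ≡⟨ ∑-swap _ ⟩
      ∑ (λ v → ∑ (λ w′ → ∑ (clash w w′ v))) ≤⟨ ∑-mono (λ v → ∑-mono (λ w′ → step v w′)) ⟩
      ∑ (λ v → ∑ (λ w′ → ∑ (λ x′ → ind (cf true w (choose w v) w′ x′ ∧ alive w′ x′))
                       + ∑ (λ x′ → ind (cf false w (choose w v) w′ x′ ∧ alive w′ x′))))
        ≤⟨ ∑-mono (λ v → ≤-trans (≤-reflexive (∑-+ _ _)) (+-mono-≤ (degs true w (choose w v)) (degs false w (choose w v)))) ⟩
      ∑ {ℓ} (λ v → D + D) ≡⟨ trans (∑-const ℓ (D + D)) (cong (λ z → ℓ * (D + z)) (sym (+-identityʳ D))) ⟩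
      ℓ * (2 * D) ∎
      where
      open ≤-Reasoning
      g : Fin ℓ → Fin W → Fin n → ℕ
      g v w′ x′ = ind (cf true w (choose w v) w′ x′) + ind (cf false w (choose w v) w′ x′)
      swap-ind : ∀ a b → ind a * ind b ≡ ind (b ∧ a)
      swap-ind a b = trans (*-comm (ind a) _) (sym (ind-∧ b a))
      step : ∀ v w′ → ∑ (clash w w′ v) ≤ ∑ (λ x′ → ind (cf true w (choose w v) w′ x′ ∧ alive w′ x′))
                                       + ∑ (λ x′ → ind (cf false w (choose w v) w′ x′ ∧ alive w′ x′))
      step v w′ = begin
        ∑ (λ v′ → ind (unc w) * (ind (unc w′) * g v w′ (choose w′ v′)))
          ≡⟨ trans (∑-*ˡ (ind (unc w)) _) (cong (ind (unc w) *_) (∑-*ˡ (ind (unc w′)) _)) ⟩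
        ind (unc w) * (ind (unc w′) * ∑ (λ v′ → g v w′ (choose w′ v′)))
          ≤⟨ *-monoˡ-≤ _ (ind≤1 (unc w)) ⟩
        1 * (ind (unc w′) * ∑ (λ v′ → g v w′ (choose w′ v′)))
          ≡⟨ *-identityˡ _ ⟩
        ind (unc w′) * ∑ (λ v′ → g v w′ (choose w′ v′))
          ≤⟨ choose-sums w′ (g v w′) ⟩
        ∑ (λ x′ → ind (alive w′ x′) * g v w′ x′)
          ≡⟨ ∑-cong (λ x′ → trans (*-distribˡ-+ (ind (alive w′ x′)) _ _) (cong₂ _+_ (swap-ind (alive w′ x′) (cf true w (choose w v) w′ x′)) (swap-ind (alive w′ x′) (cf false w (choose w v) w′ x′)))) ⟩
        ∑ (λ x′ → ind (cf true w (choose w v) w′ x′ ∧ alive w′ x′) + ind (cf false w (choose w v) w′ x′ ∧ alive w′ x′))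
          ≡⟨ ∑-+ _ _ ⟩
        ∑ (λ x′ → ind (cf true w (choose w v) w′ x′ ∧ alive w′ x′)) + ∑ (λ x′ → ind (cf false w (choose w v) w′ x′ ∧ alive w′ x′)) ∎

    fst snd : Fin (W * W) → Fin W
    fst e = proj₁ (remQuot {W} W e)
    snd e = proj₂ (remQuot {W} W e)

    bad : Fin (W * W) → Vec (Fin ℓ) W → ℕ
    bad e ω = clash (fst e) (snd e) (lookup ω (fst e)) (lookup ω (snd e))

    ΣΩ-bad : ∀ e → ΣΩ W (bad e) * (ℓ * ℓ) ≤ ℓ ^ W * clashes (fst e) (snd e)
    ΣΩ-bad e with fst e Fin.≟ snd e
    ... | no  neq = ≤-reflexive (Ω-marginal₂ W (fst e) (snd e) (clash (fst e) (snd e)) neq)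
    -- On the diagonal the two picks coincide and are not independent, but a group has no conflict
    -- with itself.
    ... | yes eq = ≤-trans (≤-reflexive (cong (_* (ℓ * ℓ)) (trans (Ω-cong W none) (trans (Ω-const W 0) (*-zeroʳ (ℓ ^ W)))))) z≤n
      where
      none : ∀ ω → bad e ω ≡ 0
      none ω = trans (cong (λ w → clash (fst e) w (lookup ω (fst e)) (lookup ω w)) (sym eq)) (trans
        (cong (λ z → ind (unc (fst e)) * (ind (unc (fst e)) * z))
          (cong₂ (λ a b → ind a + ind b) (cf-irr true (fst e) _ _) (cf-irr false (fst e) _ _)))
        (trans (cong (ind (unc (fst e)) *_) (*-zeroʳ (ind (unc (fst e))))) (*-zeroʳ (ind (unc (fst e))))))

    meet : Fin W → Fin W → Fin W → Fin W → ℕ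
    meet w w′ y y′ = ind (w == y) + ind (w == y′) + (ind (w′ == y) + ind (w′ == y′))

    near-pairs : Fin (W * W) → Fin (W * W) → ℕ
    near-pairs e f = meet (fst e) (snd e) (fst f) (snd f)

    -- Two ordered pairs can meet in four ways, and each contributes a row or column sum of at most
    -- ℓ · 2 D. With the factor 4 of the local lemma this becomes 32 ℓ D, the origin of the 32.
    ∑-meet : ∀ w w′ → ∑ (λ y → ∑ (λ y′ → meet w w′ y y′ * clashes y y′)) ≤ 8 * (ℓ * D)
    ∑-meet w w′ = begin
      ∑ (λ y → ∑ (λ y′ → meet w w′ y y′ * clashes y y′))
        ≡⟨ ∑-cong (λ y → ∑-cong (λ y′ → e₁ (ind (w == y)) (ind (w == y′)) (ind (w′ == y)) (ind (w′ == y′)) (clashes y y′))) ⟩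
      ∑ (λ y → ∑ (λ y′ → ind (w == y) * clashes y y′ + ind (w == y′) * clashes y y′
                       + (ind (w′ == y) * clashes y y′ + ind (w′ == y′) * clashes y y′)))
        ≡⟨ trans (∑-cong (λ y → trans (∑-+ _ _) (cong₂ _+_ (∑-+ _ _) (∑-+ _ _)))) (trans (∑-+ _ _) (cong₂ _+_ (∑-+ _ _) (∑-+ _ _))) ⟩
      row w + col w + (row w′ + col w′)
        ≤⟨ +-mono-≤ (+-mono-≤ (row≤ w) (col≤ w)) (+-mono-≤ (row≤ w′) (col≤ w′)) ⟩
      ℓ * (2 * D) + ℓ * (2 * D) + (ℓ * (2 * D) + ℓ * (2 * D)) ≡⟨ e₂ ℓ D ⟩
      8 * (ℓ * D) ∎
      where
      open ≤-Reasoning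
      e₁ : ∀ a b c d k → (a + b + (c + d)) * k ≡ a * k + b * k + (c * k + d * k)
      e₁ = solve-∀
      e₂ : ∀ l d → l * (2 * d) + l * (2 * d) + (l * (2 * d) + l * (2 * d)) ≡ 8 * (l * d)
      e₂ = solve-∀
      row col : Fin W → ℕ
      row w = ∑ (λ y → ∑ (λ y′ → ind (w == y) * clashes y y′))
      col w = ∑ (λ y → ∑ (λ y′ → ind (w == y′) * clashes y y′))
      row≤ : ∀ w → row w ≤ ℓ * (2 * D)
      row≤ w = ≤-trans (≤-reflexive (trans (∑-cong (λ y → ∑-*ˡ (ind (w == y)) _)) (∑-delta w (λ y → ∑ (clashes y))))) (∑-clashes w)
      col≤ : ∀ w → col w ≤ ℓ * (2 * D)
      col≤ w = ≤-trans (≤-reflexive (∑-cong (λ y → trans (∑-delta w (clashes y)) (clashes-sym y w)))) (∑-clashes w)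

    rare : ∀ e → 4 * ∑ (λ f → near-pairs e f * ΣΩ W (bad f)) ≤ ℓ ^ W
    rare e = *-cancelʳ-≤ _ _ (ℓ * ℓ) {{m*n≢0 ℓ ℓ {{>-nonZero 0<ℓ}} {{>-nonZero 0<ℓ}}}} (begin
      4 * ∑ (λ f → near-pairs e f * ΣΩ W (bad f)) * (ℓ * ℓ)
        ≡⟨ trans (*-assoc 4 (∑ (λ f → near-pairs e f * ΣΩ W (bad f))) (ℓ * ℓ)) (cong (4 *_) (trans (sym (∑-*ʳ (ℓ * ℓ) _)) (∑-cong (λ f → *-assoc (near-pairs e f) (ΣΩ W (bad f)) (ℓ * ℓ))))) ⟩
      4 * ∑ (λ f → near-pairs e f * (ΣΩ W (bad f) * (ℓ * ℓ)))
        ≤⟨ *-monoʳ-≤ 4 (∑-mono (λ f → *-monoʳ-≤ (near-pairs e f) (ΣΩ-bad f))) ⟩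
      4 * ∑ (λ f → near-pairs e f * (ℓ ^ W * clashes (fst f) (snd f)))
        ≡⟨ cong (4 *_) (trans (∑-cong (λ f → x∙yz≈y∙xz (near-pairs e f) (ℓ ^ W) _)) (∑-*ˡ (ℓ ^ W) _)) ⟩
      4 * (ℓ ^ W * ∑ (λ f → near-pairs e f * clashes (fst f) (snd f)))
        ≡⟨ cong (λ z → 4 * (ℓ ^ W * z)) (trans (∑-combine W _) (∑-cong (λ y → ∑-cong (λ y′ →
             cong (λ p → meet (fst e) (snd e) (proj₁ p) (proj₂ p) * clashes (proj₁ p) (proj₂ p)) (Fin.remQuot-combine {W} y y′))))) ⟩
      4 * (ℓ ^ W * ∑ (λ y → ∑ (λ y′ → meet (fst e) (snd e) y y′ * clashes y y′)))
        ≤⟨ *-monoʳ-≤ 4 (*-monoʳ-≤ (ℓ ^ W) (∑-meet (fst e) (snd e))) ⟩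
      4 * (ℓ ^ W * (8 * (ℓ * D)))   ≡⟨ e₂ (ℓ ^ W) ℓ D ⟩
      ℓ ^ W * (ℓ * (32 * D))        ≤⟨ *-monoʳ-≤ (ℓ ^ W) (*-monoʳ-≤ ℓ 32D≤ℓ) ⟩
      ℓ ^ W * (ℓ * ℓ)               ∎)
      where
      open ≤-Reasoning
      e₂ : ∀ p l d → 4 * (p * (8 * (l * d))) ≡ p * (l * (32 * d))
      e₂ = solve-∀

    support : Fin (W * W) → Fin W → Bool
    support e v = (fst e == v) ∨ (snd e == v)

    depends : ∀ e → DependsOn (λ v → support e v ≡ true) (bad e)
    depends e ω ω′ h = cong₂ (clash (fst e) (snd e)) (h (fst e) (∨-trueˡ (snd e == fst e) (==-refl (fst e))))
                                                     (h (snd e) (∨-trueʳ (fst e == snd e) (==-refl (snd e))))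

    near-refl-pairs : ∀ e → 0 < near-pairs e e
    near-refl-pairs e rewrite ==-refl (fst e) = s≤s z≤n

    far⇒disjoint : ∀ e f → near-pairs e f ≡ 0 → ∀ v → support f v ≡ true → support e v ≡ false
    far⇒disjoint e f far v sf with fst e == v in e₁ | snd e == v in e₂
    ... | false | false = refl
    ... | true  | _ with refl ← ==⇒≡ (fst e) v e₁ = ⊥-elim (absurd (fst f == fst e) (snd f == fst e) sf
            (trans (==-sym (fst f) (fst e)) (ind≡0 (m+n≡0⇒m≡0 _ (m+n≡0⇒m≡0 _ far))))
            (trans (==-sym (snd f) (fst e)) (ind≡0 (m+n≡0⇒n≡0 (ind (fst e == fst f)) (m+n≡0⇒m≡0 _ far)))))
      where
      absurd : ∀ a b → a ∨ b ≡ true → a ≡ false → b ≡ false → ⊥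
      absurd false false () _ _
    ... | false | true with refl ← ==⇒≡ (snd e) v e₂ = ⊥-elim (absurd (fst f == snd e) (snd f == snd e) sf
            (trans (==-sym (fst f) (snd e)) (ind≡0 (m+n≡0⇒m≡0 _ (m+n≡0⇒n≡0 (ind (fst e == fst f) + ind (fst e == snd f)) far))))
            (trans (==-sym (snd f) (snd e)) (ind≡0 (m+n≡0⇒n≡0 (ind (snd e == fst f)) (m+n≡0⇒n≡0 (ind (fst e == fst f) + ind (fst e == snd f)) far)))))
      where
      absurd : ∀ a b → a ∨ b ≡ true → a ≡ false → b ≡ false → ⊥
      absurd false false () _ _

    avoiding : ∃ λ ω → ∀ e → bad e ω ≡ 0
    avoiding = LocalLemma.avoid-all bad support depends near-pairs near-refl-pairs far⇒disjoint 0<ℓ rare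

    no-clash : ∀ w w′ ω → clash w w′ (lookup ω w) (lookup ω w′) ≡ 0 → unc w ≡ true → unc w′ ≡ true →
      ∀ t → cf t w (choose w (lookup ω w)) w′ (choose w′ (lookup ω w′)) ≡ false
    no-clash w w′ ω z u u′ = go
      where
      a b : ℕ
      a = ind (cf true w (choose w (lookup ω w)) w′ (choose w′ (lookup ω w′)))
      b = ind (cf false w (choose w (lookup ω w)) w′ (choose w′ (lookup ω w′)))
      a+b≡0 : a + b ≡ 0
      a+b≡0 = trans (sym (trans (cong₂ (λ p q → ind p * (ind q * (a + b))) u u′) (trans (*-identityˡ _) (*-identityˡ _)))) z
      go : ∀ t → cf t w (choose w (lookup ω w)) w′ (choose w′ (lookup ω w′)) ≡ false
      go true  = ind≡0 (m+n≡0⇒m≡0 a a+b≡0)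
      go false = ind≡0 (m+n≡0⇒n≡0 a a+b≡0)

    avoided : ∀ ω → (∀ e → bad e ω ≡ 0) → ∀ w w′ → clash w w′ (lookup ω w) (lookup ω w′) ≡ 0
    avoided ω h w w′ = trans
      (sym (cong (λ p → clash (proj₁ p) (proj₂ p) (lookup ω (proj₁ p)) (lookup ω (proj₂ p))) (Fin.remQuot-combine {W} w w′)))
      (h (combine w w′))

    finish : Solvable 𝔹 unc alive
    finish = (λ w → choose w (lookup ω w)) , (λ w u → choose-alive w (lookup ω w) u) ,
      λ t w w′ u u′ → no-clash w w′ ω (avoided ω (proj₂ avoiding) w w′) u u′ t
      where
      ω : Vec (Fin ℓ) W
      ω = proj₁ avoiding

  -- Iterating the rounds

  -- The induction on the degree replaces K by 2K + 1, since (1 + 1/(2K+1))² ≤ 1 + 1/K.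
  exp-beats-poly : ∀ p K X → 0 < K → ∃ λ s₀ → ∀ s → s₀ ≤ s → X * suc s ^ p * K ^ s ≤ suc K ^ s
  exp-beats-poly zero K X 0<K = K * X , λ s s₀≤s → *-cancelˡ-≤ K {{>-nonZero 0<K}} (begin
    K * (X * 1 * K ^ s)  ≡⟨ e₁ K X (K ^ s) ⟩
    K * X * K ^ s        ≤⟨ *-monoˡ-≤ (K ^ s) (≤-trans s₀≤s (m≤n+m s K)) ⟩
    (K + s) * K ^ s      ≤⟨ bernoulli K s ⟩
    K * suc K ^ s        ∎)
    where
    open ≤-Reasoning
    e₁ : ∀ k x p → k * (x * 1 * p) ≡ k * x * p
    e₁ = solve-∀
  exp-beats-poly (suc p) K X 0<K with exp-beats-poly p (suc (K + K)) (X * suc (K + K)) (s≤s z≤n)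
  ... | s₀ , ih = s₀ , λ s s₀≤s → let a = K₂ ^ s; b = suc K₂ ^ s; q = suc s ^ p in
    *-cancelʳ-≤ _ _ (K₂ * (a * a)) {{m*n≢0 K₂ (a * a) {{_}} {{m*n≢0 a a {{m^n≢0 K₂ s}} {{m^n≢0 K₂ s}}}}}} (begin
    X * (suc s * q) * K ^ s * (K₂ * (a * a))        ≡⟨ e₁ X (suc s) q (K ^ s) K₂ a ⟩
    K ^ s * (X * K₂ * q * a * (suc s * a))          ≤⟨ *-monoʳ-≤ (K ^ s) (*-mono-≤ (ih s s₀≤s)
          (≤-trans (*-monoˡ-≤ a (s≤s (m≤n+m s (K + K)))) (bernoulli K₂ s))) ⟩
    K ^ s * (b * (K₂ * b))                          ≡⟨ e₂ (K ^ s) b K₂ ⟩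
    K₂ * (b * b * K ^ s)                            ≡⟨ cong (λ z → K₂ * (z * K ^ s)) (^-distribʳ-* (suc K₂) (suc K₂) s) ⟨
    K₂ * ((suc K₂ * suc K₂) ^ s * K ^ s)            ≤⟨ *-monoʳ-≤ K₂ (^-distribʳ-≤ {suc K₂ * suc K₂} s square) ⟩
    K₂ * ((K₂ * K₂) ^ s * suc K ^ s)                ≡⟨ cong (λ z → K₂ * (z * suc K ^ s)) (^-distribʳ-* K₂ K₂ s) ⟩
    K₂ * (a * a * suc K ^ s)                        ≡⟨ x∙yz≈z∙xy K₂ (a * a) (suc K ^ s) ⟩
    suc K ^ s * (K₂ * (a * a))                      ∎)
    where
    open ≤-Reasoning
    K₂ : ℕ
    K₂ = suc (K + K)
    e₁ : ∀ x σ q k k₂ a → x * (σ * q) * k * (k₂ * (a * a)) ≡ k * (x * k₂ * q * a * (σ * a))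
    e₁ = solve-∀
    e₂ : ∀ k b k₂ → k * (b * (k₂ * b)) ≡ k₂ * (b * b * k)
    e₂ = solve-∀
    e₄ : ∀ k → suc (suc (k + k)) * suc (suc (k + k)) * k + suc k ≡ suc (k + k) * suc (k + k) * suc k
    e₄ = solve-∀
    square : suc K₂ * suc K₂ * K ≤ K₂ * K₂ * suc K
    square = ≤-trans (m≤m+n _ (suc K)) (≤-reflexive (e₄ K))

  monomial-* : ∀ σ i j {a b u v} → a ≤ u * σ ^ i → b ≤ v * σ ^ j → a * b ≤ u * v * σ ^ (i + j)
  monomial-* σ i j {a} {b} {u} {v} a≤ b≤ = ≤-trans (*-mono-≤ a≤ b≤) (≤-reflexive
    (trans ([m*n]*[o*p]≡[m*o]*[n*p] u (σ ^ i) v (σ ^ j)) (cong (u * v *_) (sym (^-distribˡ-+-* σ i j)))))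

  -- The neighbourhood bound `ν` is quadratic in `n` and enters to the fourth power; the number of
  -- events is linear.
  degree-nine : ∀ σ r n U V → r ≤ U * σ ^ 2 → n ≤ V * σ ^ 1 →
    4 * ((r * r) * (r * r) * n) ≤ 4 * ((U * U) * (U * U) * V) * σ ^ 9
  degree-nine σ r n U V r≤ n≤ = ≤-trans
    (*-monoʳ-≤ 4 (monomial-* σ 8 1 {r * r * (r * r)} {n} {U * U * (U * U)} {V}
      (monomial-* σ 4 4 {r * r} {r * r} {U * U} {U * U} r² r²) n≤))
    (≤-reflexive (sym (*-assoc 4 ((U * U) * (U * U) * V) (σ ^ 9))))
    where
    r² : r * r ≤ U * U * σ ^ 4
    r² = monomial-* σ 2 2 {r} {r} {U} {U} r≤ r≤

  -- The hypothesis `large` of a round for n = S s and J = S, with `r` in the place of `ν`.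
  Large : ℕ → ℕ → ℕ → Set
  Large C S s = 4 * ((r * r) * (r * r) * (1 + S * s * 4)) * K ^ s ≤ suc K ^ s
    where
    r K : ℕ
    r = 1 + S * s * (S * s + S * s)
    K = TailBound.K (2 * C) S

  eventually-large : ∀ C S → ∃ λ s₀ → ∀ s → s₀ ≤ s → Large C S s
  eventually-large C S = proj₁ growth , λ s s₀≤s → ≤-trans
    (*-monoˡ-≤ (TailBound.K (2 * C) S ^ s) (degree-nine (suc s) (1 + S * s * (S * s + S * s)) (1 + S * s * 4) U (1 + S * 4) (r≤ s) (n≤ s)))
    (proj₂ growth s s₀≤s)
    where
    U : ℕ
    U = 1 + S * (S + S)
    growth : ∃ λ s₀ → ∀ s → s₀ ≤ s →
      4 * ((U * U) * (U * U) * (1 + S * 4)) * suc s ^ 9 * TailBound.K (2 * C) S ^ s ≤ suc (TailBound.K (2 * C) S) ^ s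
    growth = exp-beats-poly 9 (TailBound.K (2 * C) S) (4 * ((U * U) * (U * U) * (1 + S * 4))) (s≤s z≤n)
    e₁ : ∀ S s → 1 + S * s * (S * s + S * s) + (S * (S + S) * (s + s + 1) + (s * s + s + s)) ≡ (1 + S * (S + S)) * (suc s * (suc s * 1))
    e₁ = solve-∀
    e₂ : ∀ S s → 1 + S * s * 4 + (S * 4 + s) ≡ (1 + S * 4) * (suc s * 1)
    e₂ = solve-∀
    r≤ : ∀ s → 1 + S * s * (S * s + S * s) ≤ U * (suc s * (suc s * 1))
    r≤ s = ≤-trans (m≤m+n _ _) (≤-reflexive (e₁ S s))
    n≤ : ∀ s → 1 + S * s * 4 ≤ (1 + S * 4) * (suc s * 1)
    n≤ s = ≤-trans (m≤m+n _ (S * 4 + s)) (≤-reflexive (e₂ S s))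

  -- A round in units of `s`: the number of vertices is S s, the number M of values is Z s, and
  -- lists, degrees and means are multiples of `s` as well. The numerical conditions thereby become
  -- free of `s`, and each deviation 2 s turns into a summand 2.
  round-step : ∀ {W C} S Z s (𝔹 : Board W (S * s) C) → 1 ≤ C → 0 < S → 0 < s → S ≤ Z → Large C S s →
    ∀ {l d b β φ l′ d′} → 2 * d ≤ Z → l * (2 * d) ≤ Z * b → Z * d ≤ (Z + (l + d)) * β → d * (b + 2) ≤ Z * φ →
    b ≤ S → β ≤ S → φ ≤ S → l′ + (b + 2) ≤ l → β + 2 + (φ + 2) ≤ d′ →
    ∀ unc alive → State 𝔹 unc alive (l * s) (d * s) →
    (∀ unc′ alive′ → State 𝔹 unc′ alive′ (l′ * s) (d′ * s) → Solvable 𝔹 unc′ alive′) →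
    Solvable 𝔹 unc alive
  round-step {W} {C} S Z s 𝔹 1≤C 0<S 0<s S≤Z large {l} {d} {b} {β} {φ} {l′} {d′}
    2d≤Z A-mean S-mean F-mean b≤S β≤S φ≤S l′≤ d′≥ unc alive state continue =
    untrim (After.solve (continue After.unc′ After.alive′ state′))
    where
    open Board 𝔹
    open State state
    n R : ℕ
    n = S * s
    R = Z * s ∸ n
    n+R≡ : n + R ≡ Z * s
    n+R≡ = m+[n∸m]≡n (*-monoˡ-≤ s S≤Z)
    -- Emptying the lists of settled groups keeps them from picking again and removes them from all
    -- degrees.
    trimmed : Fin W → Fin n → Bool
    trimmed w x = unc w ∧ trim (l * s) (alive w) x
    trimmed⇒ : ∀ w x → trimmed w x ≡ true → alive w x ≡ true
    trimmed⇒ w x e = trim⇒ (l * s) (alive w) x (∧-trueʳ {unc w} e)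
    trimmed-list : ∀ w → unc w ≡ true → ∑ (λ x → ind (trimmed w x)) ≡ l * s
    trimmed-list w u rewrite u = ∑-trim (l * s) (alive w) (lists w u)
    list≤ : ∀ w → ∑ (λ x → ind (trimmed w x)) ≤ l * s
    list≤ w = go (unc w) refl
      where
      go : ∀ c → unc w ≡ c → ∑ (λ x → ind (trimmed w x)) ≤ l * s
      go true  e = ≤-reflexive (trimmed-list w e)
      go false e = ≤-trans (≤-reflexive (∑-zero (λ x → cong (λ c → ind (c ∧ trim (l * s) (alive w) x)) e))) z≤n
    ≤list : ∀ w x → trimmed w x ≡ true → l * s ≤ ∑ (λ x → ind (trimmed w x))
    ≤list w x e = ≤-reflexive (sym (trimmed-list w (∧-trueˡ e)))
    degs≤ : ∀ t w x → ∑ (λ w′ → ∑ (λ x′ → ind (cf t w x w′ x′ ∧ trimmed w′ x′))) ≤ d * s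
    degs≤ t w x = ≤-trans (∑-mono (λ w′ → ∑-mono (λ x′ → ind-mono (λ e →
      ∧-true (∧-trueˡ e) (trimmed⇒ w′ x′ (∧-trueʳ {cf t w x w′ x′} e)))))) (degs t w x)
    untrim : Solvable 𝔹 unc trimmed → Solvable 𝔹 unc alive
    untrim (f , a , ok) = f , (λ w u → trimmed⇒ w (f w) (a w u)) , ok
    e₁ : ∀ l d s → l * s * (2 * (d * s)) ≡ l * (2 * d) * (s * s)
    e₁ = solve-∀
    e₂ : ∀ z b s → z * b * (s * s) ≡ z * s * (b * s)
    e₂ = solve-∀
    e₃ : ∀ z d s → z * s * (d * s) ≡ z * d * (s * s)
    e₃ = solve-∀
    e₄ : ∀ z l d β s → (z + (l + d)) * β * (s * s) ≡ (z * s + (l * s + d * s)) * (β * s)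
    e₄ = solve-∀
    e₅ : ∀ d b s → d * s * (b * s + 2 * s) ≡ d * (b + 2) * (s * s)
    e₅ = solve-∀
    A-mean′ : l * s * (2 * (d * s)) ≤ (n + R) * (b * s)
    A-mean′ = subst (λ m → l * s * (2 * (d * s)) ≤ m * (b * s)) (sym n+R≡)
      (subst₂ _≤_ (sym (e₁ l d s)) (e₂ Z b s) (*-monoˡ-≤ (s * s) A-mean))
    S-mean′ : (n + R) * (d * s) ≤ (n + R + (l * s + d * s)) * (β * s)
    S-mean′ = subst (λ m → m * (d * s) ≤ (m + (l * s + d * s)) * (β * s)) (sym n+R≡)
      (subst₂ _≤_ (sym (e₃ Z d s)) (e₄ Z l d β s) (*-monoˡ-≤ (s * s) S-mean))
    F-mean′ : d * s * (b * s + 2 * s) ≤ (n + R) * (φ * s)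
    F-mean′ = subst (λ m → d * s * (b * s + 2 * s) ≤ m * (φ * s)) (sym n+R≡)
      (subst₂ _≤_ (sym (e₅ d b s)) (e₂ Z φ s) (*-monoˡ-≤ (s * s) F-mean))
    2D≤M : 2 * (d * s) ≤ n + R
    2D≤M = subst₂ _≤_ (*-assoc 2 d s) (sym n+R≡) (*-monoˡ-≤ s 2d≤Z)
    module R = RoundExists 𝔹 R (d * s) (l * s) trimmed list≤ ≤list degs≤ 2D≤M 1≤C S s (b * s) (β * s) (φ * s)
      0<S (*-mono-≤ 0<S 0<s) A-mean′ (*-monoˡ-≤ s b≤S) S-mean′ (*-monoˡ-≤ s β≤S) F-mean′ (*-monoˡ-≤ s φ≤S) large
    module After = R.AfterRound unc (proj₁ R.avoiding)
      (λ w → R.bad≡0⇒few-hits w (proj₁ R.avoiding) (proj₂ R.avoiding w))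
      (λ t w x → R.bad≡0⇒few-survivors t w x (proj₁ R.avoiding) (proj₂ R.avoiding w))
      (λ t w x → R.bad≡0⇒few-failures t w x (proj₁ R.avoiding) (proj₂ R.avoiding w))
    state′ : State 𝔹 After.unc′ After.alive′ (l′ * s) (d′ * s)
    state′ = record { lists = lists′ ; degs = λ t w x → ≤-trans (After.degs′ t w x) (subst (_≤ d′ * s) (e₆ β φ s) (*-monoˡ-≤ s d′≥)) }
      where
      e₆ : ∀ β φ s → (β + 2 + (φ + 2)) * s ≡ β * s + 2 * s + (φ * s + 2 * s)
      e₆ = solve-∀
      e₇ : ∀ l b s → (l + (b + 2)) * s ≡ l * s + (b * s + 2 * s)
      e₇ = solve-∀
      lists′ : ∀ w → After.unc′ w ≡ true → l′ * s ≤ ∑ (λ x → ind (After.alive′ w x))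
      lists′ w u = +-cancelʳ-≤ (b * s + 2 * s) _ _ (≤-trans
        (≤-trans (≤-reflexive (sym (e₇ l′ b s))) (≤-trans (*-monoˡ-≤ s l′≤) (≤-reflexive (sym (trimmed-list w (∧-trueˡ u))))))
        (After.lists w u))

  -- The pair (list size, degree) follows the curve (w (w + a), w²), on which (ℓ − D)²/D is constant;
  -- along the exact dynamics of the nibble that quantity increases, and the difference pays for the rounding errors.
  module Schedule (e f : ℕ) (0<e : 0 < e) (924≤f : 924 ≤ f) (cube≤f : 31 * (31 * (31 * suc e)) ≤ f) where

    open ≤-Reasoning

    -- With Z = w² (w + c) the degrees lose about w (2w + a)/(w + c) in a round. For a = 2c this
    -- would be 2w, the first-order drop of w² from `w` to w - 1; the excess 2f in `a` is the
    -- reserve for all errors. The lists tolerate it up to `w₀` if `c` is somewhat larger than 2 e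
    -- f, here by 4 f. At `w₀` the ratio D/ℓ equals e/(e+1).
    c a w₀ S : ℕ
    c  = f * (2 * e + 4)
    a  = 2 * (c + f)
    w₀ = a * e
    S  = w₀ * (w₀ + a)

    Z : ℕ → ℕ
    Z w = w * w * (w + c)

    e<f : suc e ≤ f
    e<f = ≤-trans (≤-trans (m≤n*m (suc e) 31) (≤-trans (m≤n*m (31 * suc e) 31) (m≤n*m (31 * (31 * suc e)) 31))) cube≤f

    f≤a : f ≤ a
    f≤a = ≤-trans (m≤n+m f c) (m≤m+n (c + f) _)

    f≤c : f ≤ c
    f≤c = ≤-trans (≤-reflexive (sym (*-identityʳ f))) (*-monoʳ-≤ f (≤-trans (s≤s z≤n) (m≤n+m 4 (2 * e))))

    -- The drop of w (w + a) in one step is 2w + a - 1, and setting 2 aside for the deviation leaves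
    -- `b`. After expansion with a = 2 (c + f), the claim reduces to `slack`, and the requirement of
    -- `slack` at w = w₀ is what determines `c`.
    list-loss : ∀ w b → w ≤ w₀ → b + 3 ≡ 2 * w + a → w * (w + a) * (2 * (w * w)) ≤ Z w * b
    list-loss w b w≤w₀ hb = begin
      w * (w + a) * (2 * (w * w))       ≡⟨ e₁ w a ⟩
      w * w * (2 * (w * (w + a)))       ≤⟨ *-monoʳ-≤ (w * w) core ⟩
      w * w * ((w + c) * b)             ≡⟨ *-assoc (w * w) (w + c) b ⟨
      Z w * b                           ∎
      where
      e₁ : ∀ w a → w * (w + a) * (2 * (w * w)) ≡ w * w * (2 * (w * (w + a)))
      e₁ = solve-∀
      e₂ : ∀ w c f → (w + c) * (2 * w + 2 * (c + f)) + 2 * (w * f) ≡ 2 * (w * (w + 2 * (c + f))) + 2 * (c * (c + f))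
      e₂ = solve-∀
      e₃ : ∀ x y f → 2 * (x * f) + 3 * (x + y) ≡ x * (2 * f + 3) + 3 * y
      e₃ = solve-∀
      e₄ : ∀ g e f → 2 * g * e * (2 * f + 3) + 3 * g ≡ g * (4 * (e * f) + (6 * e + 3))
      e₄ = solve-∀
      e₅ : ∀ g e f → g * (4 * (e * f) + 8 * f) ≡ 2 * (f * (2 * e + 4) * g)
      e₅ = solve-∀
      e₆ : ∀ e → 6 * e + 3 + 3 ≡ 6 * suc e
      e₆ = solve-∀
      6e+3≤8f : 6 * e + 3 ≤ 8 * f
      6e+3≤8f = begin
        6 * e + 3     ≤⟨ m≤m+n _ 3 ⟩
        6 * e + 3 + 3 ≡⟨ e₆ e ⟩
        6 * suc e     ≤⟨ *-mono-≤ {6} {8} (s≤s (s≤s (s≤s (s≤s (s≤s (s≤s z≤n)))))) e<f ⟩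
        8 * f         ∎
      slack : 2 * (w * f) + 3 * (w + c) ≤ 2 * (c * (c + f))
      slack = begin
        2 * (w * f) + 3 * (w + c)                     ≡⟨ e₃ w c f ⟩
        w * (2 * f + 3) + 3 * c                       ≤⟨ +-mono-≤ (*-monoˡ-≤ (2 * f + 3) w≤w₀) (*-monoʳ-≤ 3 (m≤m+n c f)) ⟩
        2 * (c + f) * e * (2 * f + 3) + 3 * (c + f)   ≡⟨ e₄ (c + f) e f ⟩
        (c + f) * (4 * (e * f) + (6 * e + 3))         ≤⟨ *-monoʳ-≤ (c + f) (+-monoʳ-≤ (4 * (e * f)) 6e+3≤8f) ⟩
        (c + f) * (4 * (e * f) + 8 * f)               ≡⟨ e₅ (c + f) e f ⟩
        2 * (c * (c + f))                             ∎
      core : 2 * (w * (w + a)) ≤ (w + c) * b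
      core = +-cancelʳ-≤ (2 * (w * f) + 3 * (w + c)) _ _ (begin
        2 * (w * (w + a)) + (2 * (w * f) + 3 * (w + c))   ≤⟨ +-monoʳ-≤ (2 * (w * (w + a))) slack ⟩
        2 * (w * (w + a)) + 2 * (c * (c + f))             ≡⟨ e₂ w c f ⟨
        (w + c) * (2 * w + a) + 2 * (w * f)               ≡⟨ cong (λ z → (w + c) * z + 2 * (w * f)) hb ⟨
        (w + c) * (b + 3) + 2 * (w * f)                   ≡⟨ e₇ (w + c) b (2 * (w * f)) ⟩
        (w + c) * b + (2 * (w * f) + 3 * (w + c))         ∎)
        where
        e₇ : ∀ x b y → x * (b + 3) + y ≡ x * b + (y + 3 * x)
        e₇ = solve-∀

    -- With x = (ℓ + D)/Z, survival costs D x/(1 + x), and `core` says that this is at least 2w +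
    -- 36. Since D x = 2w + 2wf/(w + c), the second summand has to pay for 36 and for the
    -- denominator 1 + x. Here 924 is half of 102 + 18 · 31 + 1188, the coefficients collected by
    -- means of a ≤ 31 w and 1 ≤ w.
    degree-loss : ∀ w β → 0 < w → a ≤ 31 * w → w * w ≡ β + (2 * w + 36) →
      Z w * (w * w) ≤ (Z w + (w * (w + a) + w * w)) * β
    degree-loss w β 0<w a≤31w hβ = +-cancelʳ-≤ (w * (2 * w + a) * (2 * w + 36)) _ _ (begin
      Z w * (w * w) + w * (2 * w + a) * (2 * w + 36)
        ≡⟨ cong (λ z → Z w * z + w * (2 * w + a) * (2 * w + 36)) hβ ⟩
      Z w * (β + (2 * w + 36)) + w * (2 * w + a) * (2 * w + 36)
        ≡⟨ e₁ (Z w) β (2 * w + 36) (w * (2 * w + a)) ⟩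
      Z w * β + (Z w + w * (2 * w + a)) * (2 * w + 36)
        ≤⟨ +-monoʳ-≤ (Z w * β) core ⟩
      Z w * β + w * (2 * w + a) * (w * w)
        ≡⟨ cong (λ z → Z w * β + w * (2 * w + a) * z) hβ ⟩
      Z w * β + w * (2 * w + a) * (β + (2 * w + 36))
        ≡⟨ e₂ (Z w) w a β (2 * w + 36) ⟩
      (Z w + (w * (w + a) + w * w)) * β + w * (2 * w + a) * (2 * w + 36) ∎)
      where
      e₁ : ∀ z β k y → z * (β + k) + y * k ≡ z * β + (z + y) * k
      e₁ = solve-∀
      e₂ : ∀ z w a β k → z * β + w * (2 * w + a) * (β + k) ≡ (z + (w * (w + a) + w * w)) * β + w * (2 * w + a) * k
      e₂ = solve-∀
      e₃ : ∀ w c k → (w * w * (w + c) + w * (33 * w)) * k ≡ w * w * (k * (w + c + 33))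
      e₃ = solve-∀
      e₄ : ∀ w x → w * x * (w * w) ≡ w * w * (w * x)
      e₄ = solve-∀
      e₅ : ∀ w c → (2 * w + 36) * (w + c + 33) ≡ 2 * (w * w) + 2 * (w * c) + (102 * w + 18 * (2 * c) + 1188)
      e₅ = solve-∀
      e₆ : ∀ w → 102 * w + 18 * (31 * w) + 1188 * w ≡ 2 * (w * 924)
      e₆ = solve-∀
      e₇ : ∀ w c f → 2 * (w * w) + 2 * (w * c) + 2 * (w * f) ≡ w * (2 * w + 2 * (c + f))
      e₇ = solve-∀
      e₈ : ∀ w → 2 * w + 31 * w ≡ 33 * w
      e₈ = solve-∀
      2c≤a : 2 * c ≤ a
      2c≤a = *-monoʳ-≤ 2 (m≤m+n c f)
      quadratic : (2 * w + 36) * (w + c + 33) ≤ w * (2 * w + a)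
      quadratic = begin
        (2 * w + 36) * (w + c + 33) ≡⟨ e₅ w c ⟩
        2 * (w * w) + 2 * (w * c) + (102 * w + 18 * (2 * c) + 1188)
          ≤⟨ +-monoʳ-≤ (2 * (w * w) + 2 * (w * c)) (+-mono-≤ (+-monoʳ-≤ (102 * w) (*-monoʳ-≤ 18 (≤-trans 2c≤a a≤31w)))
               (≤-trans (≤-reflexive (sym (*-identityʳ 1188))) (*-monoʳ-≤ 1188 0<w))) ⟩
        2 * (w * w) + 2 * (w * c) + (102 * w + 18 * (31 * w) + 1188 * w) ≡⟨ cong (2 * (w * w) + 2 * (w * c) +_) (e₆ w) ⟩
        2 * (w * w) + 2 * (w * c) + 2 * (w * 924)
          ≤⟨ +-monoʳ-≤ (2 * (w * w) + 2 * (w * c)) (*-monoʳ-≤ 2 (*-monoʳ-≤ w 924≤f)) ⟩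
        2 * (w * w) + 2 * (w * c) + 2 * (w * f) ≡⟨ e₇ w c f ⟩
        w * (2 * w + a) ∎
      core : (Z w + w * (2 * w + a)) * (2 * w + 36) ≤ w * (2 * w + a) * (w * w)
      core = begin
        (Z w + w * (2 * w + a)) * (2 * w + 36)
          ≤⟨ *-monoˡ-≤ (2 * w + 36) (+-monoʳ-≤ (Z w) (*-monoʳ-≤ w (≤-trans (+-monoʳ-≤ (2 * w) a≤31w) (≤-reflexive (e₈ w))))) ⟩
        (Z w + w * (33 * w)) * (2 * w + 36)      ≡⟨ e₃ w c (2 * w + 36) ⟩
        w * w * ((2 * w + 36) * (w + c + 33))    ≤⟨ *-monoʳ-≤ (w * w) quadratic ⟩
        w * w * (w * (2 * w + a))                ≡⟨ e₄ w (2 * w + a) ⟨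
        w * (2 * w + a) * (w * w)                ∎

    -- As long as a ≤ 31 w, the lists lose fewer than 2w + 31w per round, so the failed picks amount
    -- to at most 33w · w²/Z ≤ 33.
    failures : ∀ w b → a ≤ 31 * w → b + 3 ≡ 2 * w + a → w * w * (b + 2) ≤ Z w * 33
    failures w b a≤31w hb = begin
      w * w * (b + 2)          ≤⟨ *-monoʳ-≤ (w * w) (+-monoʳ-≤ b (s≤s (s≤s z≤n))) ⟩
      w * w * (b + 3)          ≡⟨ cong (w * w *_) hb ⟩
      w * w * (2 * w + a)      ≤⟨ *-monoʳ-≤ (w * w) (+-monoʳ-≤ (2 * w) a≤31w) ⟩
      w * w * (2 * w + 31 * w) ≡⟨ e₁ w ⟩
      w * w * w * 33           ≤⟨ *-monoˡ-≤ 33 (*-monoʳ-≤ (w * w) (m≤m+n w c)) ⟩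
      Z w * 33                 ∎
      where
      e₁ : ∀ w → w * w * (2 * w + 31 * w) ≡ w * w * w * 33
      e₁ = solve-∀

    ef≤a : e * f ≤ a
    ef≤a = ≤-trans (m≤m+n (e * f) _) (≤-reflexive (sym (e₁ e f)))
      where
      e₁ : ∀ e f → 2 * (f * (2 * e + 4) + f) ≡ e * f + (3 * (e * f) + 10 * f)
      e₁ = solve-∀

    -- This ensures M ≥ n in every round, as Z w ≥ w³. Since S = a² e (e + 1), the hypothesis on `f`
    -- gives k³ S ≤ a² e f ≤ a³ ≤ (k w)³.
    S≤w³ : ∀ k w → .{{_ : NonZero k}} → k * (k * (k * suc e)) ≤ f → a ≤ k * w → S ≤ w * w * w
    S≤w³ k w cube a≤kw = *-cancelˡ-≤ {S} {w * w * w} k (*-cancelˡ-≤ {k * S} {k * (w * w * w)} k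
      (*-cancelˡ-≤ {k * (k * S)} {k * (k * (w * w * w))} k (begin
        k * (k * (k * S))                          ≡⟨ e₁ k a e ⟩
        a * (a * (e * (k * (k * (k * suc e)))))    ≤⟨ *-monoʳ-≤ a (*-monoʳ-≤ a (*-monoʳ-≤ e cube)) ⟩
        a * (a * (e * f))                          ≤⟨ *-monoʳ-≤ a (*-monoʳ-≤ a ef≤a) ⟩
        a * (a * a)                                ≤⟨ *-mono-≤ a≤kw (*-mono-≤ a≤kw a≤kw) ⟩
        k * w * (k * w * (k * w))                  ≡⟨ e₂ k w ⟩
        k * (k * (k * (w * w * w)))                ∎)))
      where
      e₁ : ∀ k a e → k * (k * (k * (a * e * (a * e + a)))) ≡ a * (a * (e * (k * (k * (k * suc e)))))
      e₁ = solve-∀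
      e₂ : ∀ k w → k * w * (k * w * (k * w)) ≡ k * (k * (k * (w * w * w)))
      e₂ = solve-∀

    S≤Z : ∀ w → a ≤ 31 * w → S ≤ Z w
    S≤Z w a≤31w = ≤-trans (S≤w³ 31 w cube≤f a≤31w) (*-monoʳ-≤ (w * w) (m≤m+n w c))

    0<w₀ : 0 < w₀
    0<w₀ = *-mono-≤ {1} {a} {1} {e} (≤-trans (≤-trans (s≤s z≤n) 924≤f) f≤a) 0<e

    0<S : 0 < S
    0<S = *-mono-≤ {1} {w₀} {1} 0<w₀ (≤-trans 0<w₀ (m≤m+n w₀ a))

    module Descent {W C s : ℕ} (𝔹 : Board W (S * s) C) (1≤C : 1 ≤ C) (0<s : 0 < s) (large : Large C S s) where

      final : ∀ w → 0 < w → 31 * w ≤ a → ∀ unc alive → State 𝔹 unc alive (w * (w + a) * s) (w * w * s) →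
        Solvable 𝔹 unc alive
      final w 0<w 31w≤a unc alive state = Finish.finish 𝔹 unc alive (w * (w + a) * s) (w * w * s) state
        (*-mono-≤ (*-mono-≤ 0<w (≤-trans 0<w (m≤m+n w a))) 0<s)
        (begin
          32 * (w * w * s)      ≡⟨ e₁ w s ⟩
          w * (w + 31 * w) * s  ≤⟨ *-monoˡ-≤ s (*-monoʳ-≤ w (+-monoʳ-≤ w 31w≤a)) ⟩
          w * (w + a) * s       ∎)
        (fromℕ< {0} (*-mono-≤ 0<S 0<s))
        where
        e₁ : ∀ w s → 32 * (w * w * s) ≡ w * (w + 31 * w) * s
        e₁ = solve-∀

      -- `b` and `β` are given by additive equations, which avoids truncated subtraction. The 37
      -- collects the bound 33 for failures and the two deviations of 2 for survivors and failures.
      step-with : ∀ v b β → 3 + b ≡ 2 * suc v + a → 37 + β ≡ v * v → suc v ≤ w₀ → a ≤ 31 * suc v → ∀ unc alive →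
        State 𝔹 unc alive (suc v * (suc v + a) * s) (suc v * suc v * s) →
        (0 < v → ∀ unc alive → State 𝔹 unc alive (v * (v + a) * s) (v * v * s) → Solvable 𝔹 unc alive) →
        Solvable 𝔹 unc alive
      step-with v b β 3+b≡ 37+β≡ w≤w₀ a≤31w unc alive state continue = round-step S (Z w) s 𝔹 1≤C 0<S 0<s (S≤Z w a≤31w) large
        {w * (w + a)} {w * w} {b} {β} {33} {v * (v + a)} {v * v}
        2d≤Z (list-loss w b w≤w₀ hb) (degree-loss w β (s≤s z≤n) a≤31w hβ) (failures w b a≤31w hb)
        (≤-trans (≤-trans (m≤m+n b 2) (m≤n+m (b + 2) (v * (v + a)))) (≤-trans l′≤l l≤S))
        (≤-trans (m≤n+m β 37) (≤-trans (≤-reflexive 37+β≡) v²≤S))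
        (≤-trans (≤-trans (≤ᵇ⇒≤ 33 37 _) (m≤m+n 37 β)) (≤-trans (≤-reflexive 37+β≡) v²≤S))
        l′≤l (≤-reflexive (trans (e₄ β) 37+β≡)) unc alive state (continue 0<v)
        where
        w : ℕ
        w = suc v
        hb : b + 3 ≡ 2 * w + a
        hb = trans (+-comm b 3) 3+b≡
        e₁ : ∀ v β → 37 + β + (2 * v + 1) ≡ β + (2 * suc v + 36)
        e₁ = solve-∀
        e₂ : ∀ v → suc v * suc v ≡ v * v + (2 * v + 1)
        e₂ = solve-∀
        e₃ : ∀ v a → v * (v + a) + (2 * suc v + a) ≡ suc v * (suc v + a) + 1
        e₃ = solve-∀
        e₄ : ∀ β → β + 2 + (33 + 2) ≡ 37 + β
        e₄ = solve-∀
        e₅ : ∀ x b → x + (b + 2) + 1 ≡ x + (b + 3)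
        e₅ = solve-∀
        hβ : w * w ≡ β + (2 * w + 36)
        hβ = trans (e₂ v) (trans (cong (_+ (2 * v + 1)) (sym 37+β≡)) (e₁ v β))
        l′≤l : v * (v + a) + (b + 2) ≤ w * (w + a)
        l′≤l = +-cancelʳ-≤ 1 _ _ (≤-reflexive (trans (e₅ (v * (v + a)) b) (trans (cong (v * (v + a) +_) hb) (e₃ v a))))
        l≤S : w * (w + a) ≤ S
        l≤S = *-mono-≤ w≤w₀ (+-monoˡ-≤ a w≤w₀)
        v²≤S : v * v ≤ S
        v²≤S = ≤-trans (*-mono-≤ (n≤1+n v) (≤-trans (n≤1+n v) (m≤m+n w a))) l≤S
        2d≤Z : 2 * (w * w) ≤ Z w
        2d≤Z = ≤-trans (≤-reflexive (*-comm 2 (w * w))) (*-monoʳ-≤ (w * w)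
          (≤-trans (≤-trans (s≤s (s≤s z≤n)) 924≤f) (≤-trans f≤c (m≤n+m c w))))
        0<v : 0 < v
        0<v = n≢0⇒n>0 λ { refl → case trans (sym 37+β≡) refl of λ () }

      step : ∀ v → suc v ≤ w₀ → a < 31 * suc v → ∀ unc alive →
        State 𝔹 unc alive (suc v * (suc v + a) * s) (suc v * suc v * s) →
        (0 < v → ∀ unc alive → State 𝔹 unc alive (v * (v + a) * s) (v * v * s) → Solvable 𝔹 unc alive) →
        Solvable 𝔹 unc alive
      step v w≤w₀ a<31w = step-with v (proj₁ b∃) (proj₁ β∃) (proj₂ b∃) (proj₂ β∃) w≤w₀ (<⇒≤ a<31w)
        where
        b∃ : ∃ λ b → 3 + b ≡ 2 * suc v + a
        b∃ = m≤n⇒∃[o]m+o≡n (≤-trans (≤-trans (s≤s (s≤s (s≤s z≤n))) 924≤f) (≤-trans f≤a (m≤n+m a (2 * suc v))))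
        -- 7 is the least `v` with v² ≥ 37, and a smaller one would give a < 31 · 7 = 217, against
        -- 924 ≤ a.
        7≤v : 7 ≤ v
        7≤v = ≮⇒≥ λ v<7 → <⇒≱ (≤-<-trans 924≤f (≤-<-trans f≤a (<-≤-trans a<31w (*-monoʳ-≤ 31 v<7)))) (≤ᵇ⇒≤ 217 924 _)
        β∃ : ∃ λ β → 37 + β ≡ v * v
        β∃ = m≤n⇒∃[o]m+o≡n (≤-trans (≤ᵇ⇒≤ 37 49 _) (*-mono-≤ 7≤v 7≤v))

      descend : ∀ w → 0 < w → w ≤ w₀ → ∀ unc alive → State 𝔹 unc alive (w * (w + a) * s) (w * w * s) →
        Solvable 𝔹 unc alive
      descend (suc v) 0<w w≤w₀ unc alive state with 31 * suc v ≤? a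
      ... | yes le = final (suc v) 0<w le unc alive state
      ... | no ¬le = step v w≤w₀ (≰⇒> ¬le) unc alive state (λ 0<v → descend v 0<v (≤-trans (n≤1+n v) w≤w₀))

  -- By `relation`, degrees may reach the fixed fraction e/(e+1) of the number of vertices, which
  -- runs through the multiples of `S`.
  record Threshold (e C : ℕ) : Set where
    field
      S d s₀   : ℕ
      0<S      : 0 < S
      relation : suc e * d ≡ e * S
      solve    : ∀ s → s₀ ≤ s → 0 < s → ∀ W (𝔹 : Board W (S * s) C) →
        (∀ t w x → ∑ (λ w′ → ∑ (λ x′ → ind (Board.cf 𝔹 t w x w′ x′))) ≤ d * s) →
        ∃ λ (f : Fin W → Fin (S * s)) → ∀ t w w′ → Board.cf 𝔹 t w (f w) w′ (f w′) ≡ false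

  threshold : ∀ e C → 0 < e → 1 ≤ C → Threshold e C
  threshold e C 0<e 1≤C = record
    { S = Sch.S ; d = Sch.w₀ * Sch.w₀ ; s₀ = proj₁ growth ; 0<S = Sch.0<S ; relation = e₁ Sch.a e ; solve = solve }
    where
    f : ℕ
    f = 31 * (31 * (31 * suc e)) + 924
    module Sch = Schedule e f 0<e (m≤n+m 924 (31 * (31 * (31 * suc e)))) (m≤m+n (31 * (31 * (31 * suc e))) 924)
    growth : ∃ λ s₀ → ∀ s → s₀ ≤ s → Large C Sch.S s
    growth = eventually-large C Sch.S
    e₁ : ∀ a e → suc e * (a * e * (a * e)) ≡ e * (a * e * (a * e + a))
    e₁ = solve-∀
    solve : ∀ s → proj₁ growth ≤ s → 0 < s → ∀ W (𝔹 : Board W (Sch.S * s) C) →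
      (∀ t w x → ∑ (λ w′ → ∑ (λ x′ → ind (Board.cf 𝔹 t w x w′ x′))) ≤ Sch.w₀ * Sch.w₀ * s) →
      ∃ λ (f : Fin W → Fin (Sch.S * s)) → ∀ t w w′ → Board.cf 𝔹 t w (f w) w′ (f w′) ≡ false
    solve s s₀≤s 0<s W 𝔹 degs≤ = proj₁ solution , λ t w w′ → proj₂ (proj₂ solution) t w w′ refl refl
      where
      initial : State 𝔹 (const true) (λ _ _ → true) (Sch.w₀ * (Sch.w₀ + Sch.a) * s) (Sch.w₀ * Sch.w₀ * s)
      initial = record
        { lists = λ w _ → ≤-reflexive (sym (trans (∑-const (Sch.S * s) 1) (*-identityʳ _)))
        ; degs  = λ t w x → ≤-trans (∑-mono (λ w′ → ∑-mono (λ x′ → ind-mono ∧-trueˡ))) (degs≤ t w x)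
        }
      solution : Solvable 𝔹 (const true) (λ _ _ → true)
      solution = Sch.Descent.descend 𝔹 1≤C 0<s (proj₂ growth s s₀≤s) Sch.w₀ Sch.0<w₀ ≤-refl (const true) (λ _ _ → true) initial

  -- From choices on a board to packings of transversals

  ∑-inject≤ : ∀ {m n} (m≤n : m ≤ n) (f : Fin n → ℕ) → ∑ (λ x → f (inject≤ x m≤n)) ≤ ∑ f
  ∑-inject≤ {zero}          _   f = ≤-trans (≤-reflexive (∑-zero λ ())) z≤n
  ∑-inject≤ {suc m} {suc n} m≤n f = subst₂ _≤_ (sym (∑-suc (λ x → f (inject≤ x m≤n)))) (sym (∑-suc f))
    (+-monoʳ-≤ (f zero) (∑-inject≤ (s≤s⁻¹ m≤n) (f ∘ suc)))

  module Packing {k : ℕ} {sizes : Fin k → ℕ} (G : MultipartiteGraph k sizes) (n m C Δ : ℕ)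
    (n≤ : ∀ i → n ≤ sizes i)
    (degree≤Δ : ∀ v → degree G v ≤ Δ) (localDeg≤C : ∀ v j → localDeg G v j ≤ C)
    (1≤C : 1 ≤ C) (m≤Δ : m ≤ Δ) (Δ≤n : Δ ≤ n)
    where

    W : ℕ
    W = k * m

    part : Fin W → Fin k
    part w = proj₁ (remQuot {k} m w)

    color : Fin W → Fin m
    color w = proj₂ (remQuot {k} m w)

    -- Parts are cut to their first `n` vertices: the initial lists become equally long, and degrees
    -- can only drop.
    vertex : Fin k → Fin n → Vtx k sizes
    vertex i x = i , inject≤ x (n≤ i)

    ∑-groups : (F : Fin k → Fin m → ℕ) → ∑ (λ w → F (part w) (color w)) ≡ ∑ (λ i → ∑ (λ b → F i b))
    ∑-groups F = trans (∑-combine k _) (∑-cong (λ i → ∑-cong (λ b →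
      cong (λ p → F (proj₁ p) (proj₂ p)) (Fin.remQuot-combine {k} i b))))

    -- In the second kind the colors must differ, since otherwise a pair would conflict with itself.
    conflicts : Bool → Fin W → Fin n → Fin W → Fin n → Bool
    conflicts true  w x w′ x′ = (color w == color w′) ∧ adj G (vertex (part w) x) (vertex (part w′) x′)
    conflicts false w x w′ x′ = (part w == part w′) ∧ (not (color w == color w′) ∧ (x == x′))

    symmetry : ∀ t w x w′ x′ → conflicts t w x w′ x′ ≡ conflicts t w′ x′ w x
    symmetry true  w x w′ x′ = cong₂ _∧_ (==-sym (color w) (color w′)) (symmetric G _ _)
    symmetry false w x w′ x′ = cong₂ _∧_ (==-sym (part w) (part w′))
      (cong₂ _∧_ (cong not (==-sym (color w) (color w′))) (==-sym x x′))

    irreflexivity : ∀ t w x x′ → conflicts t w x w x′ ≡ false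
    irreflexivity true  w x x′ rewrite ==-refl (color w) = noEdgeInPart G (part w) _ _
    irreflexivity false w x x′ rewrite ==-refl (color w) | ==-refl (part w) = refl

    labels : Bool → ℕ
    labels true  = m
    labels false = k

    label : ∀ t → Fin W → Fin (labels t)
    label true  = color
    label false = part

    label-conflicts : ∀ t {w x w′ x′} → conflicts t w x w′ x′ ≡ true → label t w ≡ label t w′
    label-conflicts true  e = ==⇒≡ _ _ (∧-trueˡ e)
    label-conflicts false e = ==⇒≡ _ _ (∧-trueˡ e)

    neighbours≤localDeg : ∀ v j → ∑ (λ x′ → ind (adj G v (vertex j x′))) ≤ localDeg G v j
    neighbours≤localDeg v j = ≤-trans (∑-inject≤ (n≤ j) (λ y → ind (adj G v (j , y))))
      (≤-reflexive (sym (count≡∑ (λ y → adj G v (j , y)))))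

    ∑-delta-1 : ∀ {l} (i : Fin l) → ∑ (λ j → ind (i == j)) ≡ 1
    ∑-delta-1 i = trans (∑-cong (λ j → sym (*-identityʳ _))) (∑-delta i (λ _ → 1))

    edge-term : ∀ w x j b → ∑ (λ x′ → ind ((color w == b) ∧ adj G (vertex (part w) x) (vertex j x′)))
      ≤ ind (color w == b) * localDeg G (vertex (part w) x) j
    edge-term w x j b = ≤-trans
      (≤-reflexive (trans (∑-cong (λ x′ → ind-∧ (color w == b) _)) (∑-*ˡ (ind (color w == b)) _)))
      (*-monoʳ-≤ (ind (color w == b)) (neighbours≤localDeg (vertex (part w) x) j))

    vertex-term : ∀ w (x : Fin n) j b → ∑ (λ x′ → ind ((part w == j) ∧ (not (color w == b) ∧ (x == x′)))) ≤ ind (part w == j)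
    vertex-term w x j b = begin
      ∑ (λ x′ → ind ((part w == j) ∧ (not (color w == b) ∧ (x == x′))))
        ≤⟨ ∑-mono (λ x′ → drop (part w == j) (not (color w == b)) (x == x′)) ⟩
      ∑ (λ x′ → ind (part w == j) * ind (x == x′))
        ≡⟨ trans (∑-*ˡ (ind (part w == j)) _) (trans (cong (ind (part w == j) *_) (∑-delta-1 x)) (*-identityʳ _)) ⟩
      ind (part w == j) ∎
      where
      open ≤-Reasoning
      drop : ∀ p q r → ind (p ∧ (q ∧ r)) ≤ ind p * ind r
      drop false q     r = z≤n
      drop true  false r = z≤n
      drop true  true  r = ≤-reflexive (sym (*-identityˡ _))

    spread : ∀ t w x l → ∑ (λ w′ → ind (label (not t) w′ == l) * ∑ (λ x′ → ind (conflicts t w x w′ x′))) ≤ C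
    spread true w x l = begin
      ∑ (λ w′ → ind (part w′ == l) * ∑ (λ x′ → ind (conflicts true w x w′ x′)))
        ≡⟨ ∑-groups (λ j b → ind (j == l) * ∑ (λ x′ → ind ((color w == b) ∧ adj G (vertex (part w) x) (vertex j x′)))) ⟩
      ∑ (λ j → ∑ (λ b → ind (j == l) * ∑ (λ x′ → ind ((color w == b) ∧ adj G (vertex (part w) x) (vertex j x′)))))
        ≤⟨ ∑-mono (λ j → ∑-mono (λ b → *-monoʳ-≤ (ind (j == l)) (edge-term w x j b))) ⟩
      ∑ (λ j → ∑ (λ b → ind (j == l) * (ind (color w == b) * localDeg G (vertex (part w) x) j)))
        ≡⟨ ∑-cong (λ j → trans (∑-*ˡ (ind (j == l)) _)
             (cong₂ _*_ (cong ind (==-sym j l)) (∑-delta (color w) (λ _ → localDeg G (vertex (part w) x) j)))) ⟩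
      ∑ (λ j → ind (l == j) * localDeg G (vertex (part w) x) j)
        ≡⟨ ∑-delta l _ ⟩
      localDeg G (vertex (part w) x) l
        ≤⟨ localDeg≤C _ l ⟩
      C ∎
      where open ≤-Reasoning
    spread false w x l = begin
      ∑ (λ w′ → ind (color w′ == l) * ∑ (λ x′ → ind (conflicts false w x w′ x′)))
        ≡⟨ ∑-groups (λ j b → ind (b == l) * ∑ (λ x′ → ind ((part w == j) ∧ (not (color w == b) ∧ (x == x′))))) ⟩
      ∑ (λ j → ∑ (λ b → ind (b == l) * ∑ (λ x′ → ind ((part w == j) ∧ (not (color w == b) ∧ (x == x′))))))
        ≤⟨ ∑-mono (λ j → ∑-mono (λ b → *-mono-≤ (≤-reflexive (cong ind (==-sym b l))) (vertex-term w x j b))) ⟩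
      ∑ (λ j → ∑ (λ b → ind (l == b) * ind (part w == j)))
        ≡⟨ trans (∑-cong (λ j → ∑-delta l (λ _ → ind (part w == j)))) (∑-delta-1 (part w)) ⟩
      1 ≤⟨ 1≤C ⟩
      C ∎
      where open ≤-Reasoning

    conflict-degree : ∀ t w x → ∑ (λ w′ → ∑ (λ x′ → ind (conflicts t w x w′ x′))) ≤ Δ
    conflict-degree true w x = begin
      ∑ (λ w′ → ∑ (λ x′ → ind (conflicts true w x w′ x′)))
        ≡⟨ ∑-groups (λ j b → ∑ (λ x′ → ind ((color w == b) ∧ adj G (vertex (part w) x) (vertex j x′)))) ⟩
      ∑ (λ j → ∑ (λ b → ∑ (λ x′ → ind ((color w == b) ∧ adj G (vertex (part w) x) (vertex j x′)))))
        ≤⟨ ∑-mono (λ j → ∑-mono (λ b → edge-term w x j b)) ⟩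
      ∑ (λ j → ∑ (λ b → ind (color w == b) * localDeg G (vertex (part w) x) j))
        ≡⟨ ∑-cong (λ j → ∑-delta (color w) (λ _ → localDeg G (vertex (part w) x) j)) ⟩
      ∑ (localDeg G (vertex (part w) x))
        ≡⟨ ∑≡Σfin _ ⟩
      degree G (vertex (part w) x)
        ≤⟨ degree≤Δ _ ⟩
      Δ ∎
      where open ≤-Reasoning
    conflict-degree false w x = begin
      ∑ (λ w′ → ∑ (λ x′ → ind (conflicts false w x w′ x′)))
        ≡⟨ ∑-groups (λ j b → ∑ (λ x′ → ind ((part w == j) ∧ (not (color w == b) ∧ (x == x′))))) ⟩
      ∑ (λ j → ∑ (λ b → ∑ (λ x′ → ind ((part w == j) ∧ (not (color w == b) ∧ (x == x′))))))
        ≤⟨ ∑-mono (λ j → ∑-mono (λ b → vertex-term w x j b)) ⟩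
      ∑ (λ j → ∑ {m} (λ b → ind (part w == j)))
        ≡⟨ trans (∑-swap _) (trans (∑-cong (λ b → ∑-delta-1 (part w))) (∑-const m 1)) ⟩
      m * 1 ≡⟨ *-identityʳ m ⟩
      m     ≤⟨ m≤Δ ⟩
      Δ     ∎
      where open ≤-Reasoning

    board : Board W n C
    board = record
      { cf = conflicts ; cf-sym = symmetry ; cf-irr = irreflexivity
      ; L = labels ; lab = label ; lab-cf = label-conflicts ; spread = spread
      ; degree≤n = λ t w x → ≤-trans (conflict-degree t w x) Δ≤n
      }

    module FromChoice (f : Fin W → Fin n) (free : ∀ t w w′ → conflicts t w (f w) w′ (f w′) ≡ false) where

      transversal : Fin m → Transversal G
      transversal a i = inject≤ (f (combine i a)) (n≤ i)

      free-true : ∀ i a j b → ((a == b) ∧ adj G (i , transversal a i) (j , transversal b j)) ≡ false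
      free-true i a j b = trans
        (sym (cong₂ (λ p q → (proj₂ p == proj₂ q) ∧ adj G (vertex (proj₁ p) (f (combine i a))) (vertex (proj₁ q) (f (combine j b))))
          (Fin.remQuot-combine {k} i a) (Fin.remQuot-combine {k} j b)))
        (free true (combine i a) (combine j b))

      free-false : ∀ i a j b → ((i == j) ∧ (not (a == b) ∧ (f (combine i a) == f (combine j b)))) ≡ false
      free-false i a j b = trans
        (sym (cong₂ (λ p q → (proj₁ p == proj₁ q) ∧ (not (proj₂ p == proj₂ q) ∧ (f (combine i a) == f (combine j b))))
          (Fin.remQuot-combine {k} i a) (Fin.remQuot-combine {k} j b)))
        (free false (combine i a) (combine j b))

      packing : DisjointIndepTransversals G m transversal
      packing = independent , disjoint
        where
        independent : ∀ a → IndependentTransversal G (transversal a)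
        independent a i j = trans (sym (cong (_∧ adj G (i , transversal a i) (j , transversal a j)) (==-refl a))) (free-true i a j a)
        disjoint : ∀ a b → a ≢ b → ∀ i → transversal a i ≢ transversal b i
        disjoint a b a≢b i same with a == b in ab
        ... | true  = a≢b (==⇒≡ a b ab)
        ... | false = case trans (sym (free-false i a i b)) all-true of λ ()
          where
          f≡ : f (combine i a) ≡ f (combine i b)
          f≡ = Fin.inject≤-injective (n≤ i) (n≤ i) _ _ same
          all-true : ((i == i) ∧ (not (a == b) ∧ (f (combine i a) == f (combine i b)))) ≡ true
          all-true rewrite ==-refl i | ab | f≡ = ==-refl (f (combine i b))

-- From natural to rational bounds, and the choice of parameters.

open import Data.Fin using (Fin)
open import Data.Integer as ℤ using (+_; -[1+_]; +[1+_])
import Data.Integer.Properties as ℤ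
open import Data.Nat as ℕ using (ℕ; suc; _≥_; s≤s; z≤n)
open import Data.Nat.DivMod using (m≡m%n+[m/n]*n; m%n<n; /-mono-≤; m*n/n≡m)
import Data.Nat.Properties as ℕ
open import Data.Nat.Tactic.RingSolver using (solve-∀)
open import Data.Product using (Σ; ∃; _×_; _,_; proj₁; proj₂; ∃-syntax)
open import Data.Rational using (ℚ; mkℚ; _≤_; _<_; _-_; _*_; _+_; -_; 0ℚ; 1ℚ; *<*; toℚᵘ; Positive; NonNegative)
import Data.Rational.Properties as ℚ
open import Data.Rational.Unnormalised as ℚᵘ using (mkℚᵘ; *≡*)
import Data.Rational.Unnormalised.Properties as ℚᵘ
open import Relation.Binary.PropositionalEquality

open Nibble using (Threshold; threshold; module Packing)

toℚᵘ-ℕ→ℚ : ∀ n → toℚᵘ (ℕ→ℚ n) ℚᵘ.≃ mkℚᵘ (+ n) 0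
toℚᵘ-ℕ→ℚ n = ℚ.toℚᵘ-fromℚᵘ (mkℚᵘ (+ n) 0)

ℕ→ℚ-* : ∀ a b → ℕ→ℚ (a ℕ.* b) ≡ ℕ→ℚ a * ℕ→ℚ b
ℕ→ℚ-* a b = ℚ.toℚᵘ-injective (ℚᵘ.≃-trans (toℚᵘ-ℕ→ℚ (a ℕ.* b)) (ℚᵘ.≃-trans
  (*≡* (cong (ℤ._* + 1) (ℤ.pos-* a b)))
  (ℚᵘ.≃-sym (ℚᵘ.≃-trans (ℚ.toℚᵘ-homo-* (ℕ→ℚ a) (ℕ→ℚ b)) (ℚᵘ.*-cong (toℚᵘ-ℕ→ℚ a) (toℚᵘ-ℕ→ℚ b))))))

ℕ→ℚ-suc : ∀ a → ℕ→ℚ (suc a) ≡ 1ℚ + ℕ→ℚ a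
ℕ→ℚ-suc a = ℚ.toℚᵘ-injective (ℚᵘ.≃-trans (toℚᵘ-ℕ→ℚ (suc a)) (ℚᵘ.≃-trans
  (*≡* (cong (λ z → (+ 1 ℤ.+ z) ℤ.* + 1) (sym (ℤ.*-identityʳ (+ a)))))
  (ℚᵘ.≃-sym (ℚᵘ.≃-trans (ℚ.toℚᵘ-homo-+ 1ℚ (ℕ→ℚ a)) (ℚᵘ.+-congʳ (toℚᵘ 1ℚ) (toℚᵘ-ℕ→ℚ a))))))

ℕ→ℚ-mono : ∀ {a b} → a ℕ.≤ b → ℕ→ℚ a ≤ ℕ→ℚ b
ℕ→ℚ-mono {a} {b} a≤b = ℚ.toℚᵘ-cancel-≤ (ℚᵘ.≤-trans (ℚᵘ.≤-reflexive (toℚᵘ-ℕ→ℚ a)) (ℚᵘ.≤-trans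
  (ℚᵘ.*≤* (ℤ.*-monoʳ-≤-nonNeg (+ 1) (ℤ.+≤+ a≤b))) (ℚᵘ.≤-reflexive (ℚᵘ.≃-sym (toℚᵘ-ℕ→ℚ b)))))

ℕ→ℚ-cancel : ∀ {a b} → ℕ→ℚ a ≤ ℕ→ℚ b → a ℕ.≤ b
ℕ→ℚ-cancel {a} {b} le with ℚᵘ.≤-trans (ℚᵘ.≤-reflexive (ℚᵘ.≃-sym (toℚᵘ-ℕ→ℚ a)))
  (ℚᵘ.≤-trans (ℚ.toℚᵘ-mono-≤ le) (ℚᵘ.≤-reflexive (toℚᵘ-ℕ→ℚ b)))
... | ℚᵘ.*≤* le′ = ℤ.drop‿+≤+ (subst₂ ℤ._≤_ (ℤ.*-identityʳ (+ a)) (ℤ.*-identityʳ (+ b)) le′)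

ℕ→ℚ-nonNeg : ∀ n → NonNegative (ℕ→ℚ n)
ℕ→ℚ-nonNeg n = ℚ.normalize-nonNeg n 1

ℕ→ℚ-pos : ∀ n → Positive (ℕ→ℚ (suc n))
ℕ→ℚ-pos n = ℚ.normalize-pos (suc n) 1

archimedean : ∀ C → ∃ λ c → 1 ℕ.≤ c × C ≤ ℕ→ℚ c
archimedean (mkℚ p d cop) = suc ℤ.∣ p ∣ , s≤s z≤n ,
  ℚ.toℚᵘ-cancel-≤ (ℚᵘ.≤-trans (ℚᵘ.*≤* (bound p)) (ℚᵘ.≤-reflexive (ℚᵘ.≃-sym (toℚᵘ-ℕ→ℚ (suc ℤ.∣ p ∣)))))
  where
  bound : ∀ p → p ℤ.* + 1 ℤ.≤ + suc ℤ.∣ p ∣ ℤ.* + suc d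
  bound (+ a)    = subst₂ ℤ._≤_ (sym (ℤ.*-identityʳ (+ a))) (ℤ.pos-* (suc a) (suc d))
    (ℤ.+≤+ (ℕ.≤-trans (ℕ.n≤1+n a) (ℕ.m≤m*n (suc a) (suc d))))
  bound -[1+ a ] = ℤ.-≤+

-- With q the denominator of ε > 0 one has q (1 − ε) ≤ q − 1.
scale : ∀ ε → 0ℚ < ε → ∃ λ q → ∀ n → ℕ→ℚ (suc q) * ((1ℚ - ε) * ℕ→ℚ n) ≤ ℕ→ℚ (q ℕ.* n)
scale ε@(mkℚ +[1+ p ] q _) _ = q , λ n → begin
  ℕ→ℚ (suc q) * ((1ℚ - ε) * ℕ→ℚ n) ≡⟨ ℚ.*-assoc (ℕ→ℚ (suc q)) (1ℚ - ε) (ℕ→ℚ n) ⟨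
  ℕ→ℚ (suc q) * (1ℚ - ε) * ℕ→ℚ n   ≤⟨ ℚ.*-monoʳ-≤-nonNeg (ℕ→ℚ n) {{ℕ→ℚ-nonNeg n}} factor ⟩
  ℕ→ℚ q * ℕ→ℚ n                    ≡⟨ ℕ→ℚ-* q n ⟨
  ℕ→ℚ (q ℕ.* n)                    ∎
  where
  open ℚ.≤-Reasoning
  qε : ℕ→ℚ (suc q) * ε ≡ ℕ→ℚ (suc p)
  qε = ℚ.toℚᵘ-injective (ℚᵘ.≃-trans (ℚᵘ.≃-trans (ℚ.toℚᵘ-homo-* (ℕ→ℚ (suc q)) ε)
    (ℚᵘ.*-cong (toℚᵘ-ℕ→ℚ (suc q)) ℚᵘ.≃-refl)) (ℚᵘ.≃-trans (*≡* cross) (ℚᵘ.≃-sym (toℚᵘ-ℕ→ℚ (suc p)))))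
    where
    cross : (+ suc q ℤ.* +[1+ p ]) ℤ.* + 1 ≡ + suc p ℤ.* (+ 1 ℤ.* + suc q)
    cross = trans (ℤ.*-identityʳ _) (trans (ℤ.*-comm (+ suc q) (+ suc p)) (cong (+ suc p ℤ.*_) (sym (ℤ.*-identityˡ (+ suc q)))))
  factor : ℕ→ℚ (suc q) * (1ℚ - ε) ≤ ℕ→ℚ q
  factor = begin
    ℕ→ℚ (suc q) * (1ℚ - ε)                   ≡⟨ ℚ.*-distribˡ-+ (ℕ→ℚ (suc q)) 1ℚ (- ε) ⟩
    ℕ→ℚ (suc q) * 1ℚ + ℕ→ℚ (suc q) * (- ε)   ≡⟨ cong₂ _+_ (ℚ.*-identityʳ (ℕ→ℚ (suc q))) (trans (sym (ℚ.neg-distribʳ-* (ℕ→ℚ (suc q)) ε)) (cong -_ qε)) ⟩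
    ℕ→ℚ (suc q) - ℕ→ℚ (suc p)                ≤⟨ ℚ.+-monoʳ-≤ (ℕ→ℚ (suc q)) (ℚ.neg-antimono-≤ (ℕ→ℚ-mono {1} {suc p} (s≤s z≤n))) ⟩
    ℕ→ℚ (suc q) - 1ℚ                         ≡⟨ cong (_- 1ℚ) (trans (ℕ→ℚ-suc q) (ℚ.+-comm 1ℚ (ℕ→ℚ q))) ⟩
    ℕ→ℚ q + 1ℚ - 1ℚ                          ≡⟨ trans (ℚ.+-assoc (ℕ→ℚ q) 1ℚ (- 1ℚ)) (ℚ.+-identityʳ (ℕ→ℚ q)) ⟩
    ℕ→ℚ q                                    ∎
scale (mkℚ (+ 0) q _) (*<* (ℤ.+<+ ()))
scale (mkℚ -[1+ p ] q _) (*<* ())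

-- 2q(dt) = (2q − 1)St covers 2(q − 1)(St + S) as soon as t ≥ 2(q − 1); here q is written suc q.
rounding : ∀ q S d t n → suc (suc (q ℕ.+ q)) ℕ.* d ≡ suc (q ℕ.+ q) ℕ.* S → n ℕ.≤ S ℕ.* t ℕ.+ S → q ℕ.+ q ℕ.≤ t →
  q ℕ.* n ℕ.≤ suc q ℕ.* (d ℕ.* t)
rounding q S d t n relation n≤ 2q≤t = ℕ.*-cancelˡ-≤ 2 (begin
  2 ℕ.* (q ℕ.* n)                            ≤⟨ ℕ.*-monoʳ-≤ 2 (ℕ.*-monoʳ-≤ q n≤) ⟩
  2 ℕ.* (q ℕ.* (S ℕ.* t ℕ.+ S))              ≡⟨ e₁ q S t ⟩
  (q ℕ.+ q) ℕ.* S ℕ.* t ℕ.+ S ℕ.* (q ℕ.+ q)  ≤⟨ ℕ.+-monoʳ-≤ ((q ℕ.+ q) ℕ.* S ℕ.* t) (ℕ.*-monoʳ-≤ S 2q≤t) ⟩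
  (q ℕ.+ q) ℕ.* S ℕ.* t ℕ.+ S ℕ.* t          ≡⟨ e₂ q S t ⟩
  suc (q ℕ.+ q) ℕ.* S ℕ.* t                  ≡⟨ cong (ℕ._* t) relation ⟨
  suc (suc (q ℕ.+ q)) ℕ.* d ℕ.* t            ≡⟨ e₃ q d t ⟩
  2 ℕ.* (suc q ℕ.* (d ℕ.* t))                ∎)
  where
  open ℕ.≤-Reasoning
  e₁ : ∀ q S t → 2 ℕ.* (q ℕ.* (S ℕ.* t ℕ.+ S)) ≡ (q ℕ.+ q) ℕ.* S ℕ.* t ℕ.+ S ℕ.* (q ℕ.+ q)
  e₁ = solve-∀
  e₂ : ∀ q S t → (q ℕ.+ q) ℕ.* S ℕ.* t ℕ.+ S ℕ.* t ≡ suc (q ℕ.+ q) ℕ.* S ℕ.* t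
  e₂ = solve-∀
  e₃ : ∀ q d t → suc (suc (q ℕ.+ q)) ℕ.* d ℕ.* t ≡ 2 ℕ.* (suc q ℕ.* (d ℕ.* t))
  e₃ = solve-∀

Conclusion : (ε C : ℚ) → ℕ → Set
Conclusion ε C n = ∀ k (s : Fin k → ℕ) → (∀ i → s i ≥ n) → (G : MultipartiteGraph k s) →
  (∀ v → ℕ→ℚ (degree G v) ≤ (1ℚ - ε) * ℕ→ℚ n) → (∀ v j → ℕ→ℚ (localDeg G v j) ≤ C) →
  ∃[ m ] (((1ℚ - ε) * ℕ→ℚ n ≤ ℕ→ℚ m) × Σ (Fin m → Transversal G) (DisjointIndepTransversals G m))

-- The ratio (2q + 1)/(2q + 2) lies strictly between q/(q + 1), which is at least 1 - ε, and 1. The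
-- lower gap absorbs the rounding of `n` down to a multiple of `S`. The number d t then exceeds (1 -
-- ε) n or equals it, and serves both as the number of transversals and as the degree bound.
conclusion : ∀ ε C q c → (∀ n → ℕ→ℚ (suc q) * ((1ℚ - ε) * ℕ→ℚ n) ≤ ℕ→ℚ (q ℕ.* n)) →
  1 ℕ.≤ c → C ≤ ℕ→ℚ c → Threshold (suc (q ℕ.+ q)) c → ∃[ n₀ ] ∀ n → n ≥ n₀ → Conclusion ε C n
conclusion ε C q c scaled 1≤c C≤c T = S ℕ.* t₀ , main
  where
  open Threshold T
  t₀ : ℕ
  -- `s₀` is demanded by the nibble and 2q by `rounding`; the successor makes the scale positive.
  t₀ = suc (s₀ ℕ.+ (q ℕ.+ q))
  instance
    S≢0 : ℕ.NonZero S
    S≢0 = ℕ.>-nonZero 0<S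
  d≤S : d ℕ.≤ S
  d≤S = ℕ.*-cancelˡ-≤ (suc (suc (q ℕ.+ q))) (ℕ.≤-trans (ℕ.≤-reflexive relation) (ℕ.m≤n+m _ S))
  main : ∀ n → n ≥ S ℕ.* t₀ → Conclusion ε C n
  main n n≥ k s s≥ G degree≤ localDeg≤ = d ℕ.* t , enough , Choice.transversal , Choice.packing
    where
    t : ℕ
    t = n ℕ./ S
    t₀≤t : t₀ ℕ.≤ t
    t₀≤t = ℕ.≤-trans (ℕ.≤-reflexive (sym (m*n/n≡m t₀ S))) (/-mono-≤ {o = S} (ℕ.≤-trans (ℕ.≤-reflexive (ℕ.*-comm t₀ S)) n≥) ℕ.≤-refl)
    n≡ : n ≡ S ℕ.* t ℕ.+ n ℕ.% S
    n≡ = trans (m≡m%n+[m/n]*n n S) (trans (ℕ.+-comm (n ℕ.% S) _) (cong (ℕ._+ n ℕ.% S) (ℕ.*-comm t S)))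
    St≤n : S ℕ.* t ℕ.≤ n
    St≤n = ℕ.≤-trans (ℕ.m≤m+n (S ℕ.* t) (n ℕ.% S)) (ℕ.≤-reflexive (sym n≡))
    n≤St+S : n ℕ.≤ S ℕ.* t ℕ.+ S
    n≤St+S = ℕ.≤-trans (ℕ.≤-reflexive n≡) (ℕ.+-monoʳ-≤ (S ℕ.* t) (ℕ.<⇒≤ (m%n<n n S)))
    qn≤ : q ℕ.* n ℕ.≤ suc q ℕ.* (d ℕ.* t)
    qn≤ = rounding q S d t n relation n≤St+S
      (ℕ.≤-trans (ℕ.m≤n+m (q ℕ.+ q) s₀) (ℕ.≤-trans (ℕ.n≤1+n _) t₀≤t))
    enough : (1ℚ - ε) * ℕ→ℚ n ≤ ℕ→ℚ (d ℕ.* t)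
    enough = ℚ.*-cancelˡ-≤-pos (ℕ→ℚ (suc q)) {{ℕ→ℚ-pos q}}
      (ℚ.≤-trans (scaled n) (ℚ.≤-trans (ℕ→ℚ-mono qn≤) (ℚ.≤-reflexive (ℕ→ℚ-* (suc q) (d ℕ.* t)))))
    degree≤dt : ∀ v → degree G v ℕ.≤ d ℕ.* t
    degree≤dt v = ℕ→ℚ-cancel (ℚ.≤-trans (degree≤ v) enough)
    module Pack = Packing G (S ℕ.* t) (d ℕ.* t) c (d ℕ.* t) (λ i → ℕ.≤-trans St≤n (s≥ i))
      degree≤dt (λ v j → ℕ→ℚ-cancel (ℚ.≤-trans (localDeg≤ v j) C≤c)) 1≤c ℕ.≤-refl (ℕ.*-monoˡ-≤ t d≤S)
    choice : ∃ λ (f : Fin Pack.W → Fin (S ℕ.* t)) → ∀ u w w′ → Pack.conflicts u w (f w) w′ (f w′) ≡ _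
    choice = solve t (ℕ.≤-trans (ℕ.≤-trans (ℕ.m≤m+n s₀ _) (ℕ.n≤1+n _)) t₀≤t) (ℕ.≤-trans (s≤s z≤n) t₀≤t)
      Pack.W Pack.board Pack.conflict-degree
    module Choice = Pack.FromChoice (proj₁ choice) (proj₂ choice)

theorem1p7 : (ε C : ℚ) → 0ℚ < ε → ε < 1ℚ → 0ℚ < C →
    ∃[ n₀ ] ∀ (n : ℕ) → n ≥ n₀ →
    ∀ (k : ℕ) (s : Fin k → ℕ) → (∀ i → s i ≥ n) →
    (G : MultipartiteGraph k s) →
    (∀ v → ℕ→ℚ (degree G v) ≤ (1ℚ - ε) * ℕ→ℚ n) →
    (∀ v j → ℕ→ℚ (localDeg G v j) ≤ C) →
    ∃[ m ] (((1ℚ - ε) * ℕ→ℚ n ≤ ℕ→ℚ m) ×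
    Σ (Fin m → Transversal G) (DisjointIndepTransversals G m))
theorem1p7 ε C 0<ε _ _ = conclusion ε C (proj₁ (scale ε 0<ε)) (proj₁ (archimedean C)) (proj₂ (scale ε 0<ε))
  (proj₁ (proj₂ (archimedean C))) (proj₂ (proj₂ (archimedean C))) (threshold _ _ (s≤s z≤n) (proj₁ (proj₂ (archimedean C))))
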